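{- Every simple graph with arboricity $a$ and maximum degree $\Delta$ satisfies $a_{\text{star}} \leq a + O(\log a + \sqrt{\log \Delta})$ and $a_{\text{star}}^{\text{list}} \leq a + O(\log \Delta)$, where the constants in $O(\cdot)$ are universal.
   Context: The arboricity $a$ of a graph is the minimum number of forests into which its edges can be partitioned. A star-forest is a forest in which every connected component is a star. The star-arboricity $a_{\text{star}}$ is the minimum number of star-forests into which the edges of the graph can be partitioned. If each edge $e$ has a set (palette) of colors $Q(e)$, a list-star-forest-decomposition (LSFD) is a choice of a color $\phi(e) \in Q(e)$ for every edge $e$ such that for each color $c$ the edges of color $c$ form a star-forest. The list-star-arboricity $a_{\text{star}}^{\text{list}}$ is the smallest $k$ such that an LSFD exists whenever each edge has a palette of size $k$. -}

module Defs where

open import Data.Bool using (Bool; false; T)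
open import Data.Empty using (⊥-elim)
open import Data.Fin using (Fin; zero; suc; inject₁; fromℕ; _<_)
open import Data.Fin.Subset using (Subset; ∣_∣)
open import Data.List using (List; length; map; allFin)
open import Data.List.Extrema.Nat using (max)
open import Data.List.Membership.Propositional using (_∈_)
open import Data.List.Relation.Unary.Unique.Propositional using (Unique)
open import Data.Nat as ℕ using (ℕ; zero; suc; _+_; _*_; _≤_; z≤n; s≤s)
import Data.Nat.Properties as ℕₚ
open import Data.Product using (Σ; ∃; ∃-syntax; _×_; _,_)
open import Data.Sum using (_⊎_; inj₁; inj₂)
open import Data.Vec using (tabulate)
open import Function.Definitions using (Injective)
open import Relation.Binary.Construct.Closure.ReflexiveTransitive using () renaming (Star to Closure*)
open import Relation.Binary.PropositionalEquality using (_≡_; _≢_; refl)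
open import Relation.Nullary using (¬_; yes; no)

------------------------------------------------------------------------
-- Finite simple graphs

record Graph : Set where
  field
    order    : ℕ
    adj      : Fin order → Fin order → Bool
    adj-sym  : ∀ u v → adj u v ≡ adj v u
    loopless : ∀ v → adj v v ≡ false

  Vertex : Set
  Vertex = Fin order

  neighbours : Vertex → Subset order
  neighbours v = tabulate (adj v)

  degree : Vertex → ℕ
  degree v = ∣ neighbours v ∣

  -- The maximum degree of the graph with no vertices is 0.
  maxDegree : ℕ
  maxDegree = max 0 (map degree (allFin order))

  -- Each undirected edge is represented once, with its endpoints in
  -- increasing order.
  record Edge : Set where
    field
      src tgt  : Vertex
      src<tgt  : src < tgt
      adjacent : T (adj src tgt)

  Joins : Edge → Vertex → Vertex → Set
  Joins e u v = (src ≡ u × tgt ≡ v) ⊎ (src ≡ v × tgt ≡ u)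
    where open Edge e

  -- The adjacency relation of the spanning subgraph formed by the edges
  -- of colour c.
  ColourClass : {C : Set} → (Edge → C) → C → Vertex → Vertex → Set
  ColourClass φ c u v = ∃[ e ] (φ e ≡ c × Joins e u v)

------------------------------------------------------------------------
-- Forests and star-forests, given by an adjacency relation on the
-- vertices that is symmetric and irreflexive

module _ {V : Set} (_~_ : V → V → Set) where

  -- A cycle has 3 + m distinct vertices.
  Cycle : Set
  Cycle = ∃[ m ] Σ (Fin (3 + m) → V) λ c →
      Injective _≡_ _≡_ c
    × (∀ (i : Fin (2 + m)) → c (inject₁ i) ~ c (suc i))
    × c (fromℕ (2 + m)) ~ c zero

  IsForest : Set
  IsForest = ¬ Cycle

  Connected : V → V → Set
  Connected = Closure* _~_

  -- The component of v is a K₁,ₘ with centre c.  An isolated vertex is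
  -- the star K₁,₀.
  ComponentIsStar : V → Set
  ComponentIsStar v = ∃[ c ]
    ( Connected v c
    × (∀ u → Connected v u → u ≢ c → c ~ u)
    × (∀ u w → Connected v u → u ~ w → u ≡ c ⊎ w ≡ c))

  IsStarForest : Set
  IsStarForest = IsForest × (∀ v → ComponentIsStar v)

------------------------------------------------------------------------
-- Arboricity, star-arboricity and list-star-arboricity

IsLeast : (ℕ → Set) → ℕ → Set
IsLeast P k = P k × (∀ j → P j → k ≤ j)

module _ (G : Graph) where
  open Graph G

  PartitionsIntoForests : ℕ → Set
  PartitionsIntoForests k =
    Σ (Edge → Fin k) λ φ → ∀ c → IsForest (ColourClass φ c)

  PartitionsIntoStarForests : ℕ → Set
  PartitionsIntoStarForests k =
    Σ (Edge → Fin k) λ φ → ∀ c → IsStarForest (ColourClass φ c)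

  -- Colours are natural numbers; a palette is a duplicate-free list, so
  -- that its size is its length.
  IsPaletteAssignment : ℕ → (Edge → List ℕ) → Set
  IsPaletteAssignment k Q = ∀ e → Unique (Q e) × length (Q e) ≡ k

  IsLSFD : (Edge → List ℕ) → (Edge → ℕ) → Set
  IsLSFD Q φ = (∀ e → φ e ∈ Q e) × (∀ c → IsStarForest (ColourClass φ c))

  LSFDsExist : ℕ → Set
  LSFDsExist k = ∀ Q → IsPaletteAssignment k Q → ∃[ φ ] IsLSFD Q φ

  IsArboricity : ℕ → Set
  IsArboricity = IsLeast PartitionsIntoForests

  IsStarArboricity : ℕ → Set
  IsStarArboricity = IsLeast PartitionsIntoStarForests

  IsListStarArboricity : ℕ → Set
  IsListStarArboricity = IsLeast LSFDsExist

------------------------------------------------------------------------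
-- Square root rounded up.
--
-- Real-valued bounds of the form C · (log a + √(log Δ)) and C · log Δ are
-- rendered with ⌈log₂_⌉ and ⌈√_⌉.  For n ≥ 1 one has
-- log₂ n ≤ ⌈log₂ n⌉ ≤ 2 log₂ n and √n ≤ ⌈√n⌉ ≤ 2√n, so rounding only
-- changes the constant C; in particular ⌈log₂ 1⌉ = 0 exactly.  For an
-- edgeless graph (a = Δ = 0) the convention is ⌈log₂ 0⌉ = 0.

⌈√_⌉ : ℕ → ℕ
⌈√ zero ⌉ = 0
⌈√ suc n ⌉ with suc n ℕ.≤? ⌈√ n ⌉ * ⌈√ n ⌉
... | yes _ = ⌈√ n ⌉
... | no  _ = suc ⌈√ n ⌉

n≤⌈√n⌉² : ∀ n → n ≤ ⌈√ n ⌉ * ⌈√ n ⌉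
n≤⌈√n⌉² zero = z≤n
n≤⌈√n⌉² (suc n) with suc n ℕ.≤? ⌈√ n ⌉ * ⌈√ n ⌉
... | yes p = p
... | no  _ = ℕₚ.≤-trans (s≤s (n≤⌈√n⌉² n))
                (s≤s (ℕₚ.≤-trans (ℕₚ.*-monoʳ-≤ ⌈√ n ⌉ (ℕₚ.n≤1+n _)) (ℕₚ.m≤n+m _ ⌈√ n ⌉)))

⌈√⌉-least : ∀ n s → n ≤ s * s → ⌈√ n ⌉ ≤ s
⌈√⌉-least zero s _ = z≤n
⌈√⌉-least (suc n) s p with suc n ℕ.≤? ⌈√ n ⌉ * ⌈√ n ⌉
... | yes _ = ⌈√⌉-least n s (ℕₚ.≤-trans (ℕₚ.n≤1+n n) p)
... | no ¬q with ⌈√ n ⌉ ℕ.<? s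
...   | yes r<s = r<s
...   | no  r≮s = ⊥-elim (¬q (ℕₚ.≤-trans p (ℕₚ.*-mono-≤ (ℕₚ.≮⇒≥ r≮s) (ℕₚ.≮⇒≥ r≮s))))

{-# OPTIONS --safe #-}

-- Root each of the a forests and orient its edges towards the root, so that every
-- vertex has out-degree at most a.  Give every vertex v a random set C(v)
-- of colours, each colour with small probability, and let the edge v → u use only
-- colours of C(u) ∖ C(v).  If the out-edges of each v moreover get distinct
-- colours, every colour class is a star-forest centred at the heads.
--
-- Such a choice at v is a matching of the out-edges of v into colours.  By Hall's
-- theorem it exists up to d exceptions unless some x of the out-edges see fewer
-- than x − d colours.  For fixed x out-edges the colours are packed into A bins, each
-- with at least x/2 chances of being seen, so that a violation leaves A + d + 1 − x
-- bins unseen; a union bound over those bins makes this rarer than 2^(−R(d+1)),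
-- provided that the expected size of C(v) is a multiple of log a + R.  The local
-- lemma, proved by counting, then applies as soon as 2^(R(d+1)) exceeds a fixed
-- multiple of Δ².  Lists take d = 0 and R of order log Δ.  For ordinary
-- star-forests d and R are both of order √(log Δ), and the at most d leftover
-- out-edges of each vertex are coloured with 4d new colours.
module Submission where

open import Defs
open import Data.Bool using (Bool; true; false; not; _∧_; _∨_; if_then_else_; T)
import Data.Bool.Properties as Bool
open import Data.Empty using (⊥-elim)
open import Data.Fin as Fin using (Fin; zero; suc; toℕ)
import Data.Fin.Induction as Fin
import Data.Fin.Properties as Fin
open import Data.Fin.Subset as Subset
  using (Subset; inside; outside; ∣_∣; _∩_; _∪_; _─_; _-_; ∁; ⊥; ⊤; ⁅_⁆; _∈_; _∉_; _⊆_)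
import Data.Fin.Subset.Properties as Subset
open import Data.List as List using (List; []; _∷_; _++_; length; allFin; upTo)
import Data.List.Properties as List
open import Data.List.Membership.Propositional using () renaming (_∈_ to _∈ˡ_; _∉_ to _∉ˡ_)
import Data.List.Membership.Propositional.Properties as Mem
import Data.List.Relation.Unary.All as All
open import Data.List.Relation.Unary.Any using (here; there)
open import Data.List.Relation.Unary.Unique.Propositional using (Unique; []; _∷_)
import Data.List.Relation.Unary.Unique.Propositional.Properties as Unique
open import Data.Nat hiding (∣_-_∣)
open import Data.Nat.Properties
open import Data.Nat.DivMod using (m≡m%n+[m/n]*n; m%n<n; m/n*n≤m)
open import Data.Nat.Logarithm using (⌈log₂_⌉; ⌈log₂⌉-mono-≤; ⌈log₂⌈n/2⌉⌉≡⌈log₂n⌉∸1)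
open import Data.Nat.Tactic.RingSolver using (solve-∀)
open import Data.Product using (Σ; ∃; ∃-syntax; _×_; _,_; proj₁; proj₂)
open import Data.Sum using (_⊎_; inj₁; inj₂; [_,_]′)
import Data.Sum.Properties as Sum
open import Data.Vec as Vec using (Vec; []; _∷_; lookup; _[_]≔_)
import Data.Vec.Properties as Vec
open import Function using (_∘_; id; case_of_)
open import Induction.WellFounded using (WellFounded; Acc; acc)
open import Relation.Binary.PropositionalEquality hiding (J)
open import Relation.Nullary using (¬_; Dec; yes; no; does; contradiction)
open import Relation.Nullary.Decidable using (¬?; _×-dec_; dec-true)
open import Relation.Binary.Definitions using (DecidableEquality; tri<; tri≈; tri>)

-- Sums over lists

-- Palettes may come from an arbitrarily large set of colours, so a union bound over the colours
-- missed by a violator is useless; packing leaves only the choice among A bins, whatever the number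
-- of colours.
--
-- The set C(v) helps the edges entering v but takes colours from the edges leaving it. This harm is
-- not a bad event: C(v) is drawn from those sets that take at most s colours from each palette at
-- v. The condition concerns one coordinate at a time, so independence survives, and over at most A
-- heads it costs a factor 2 in probability. A bad event at v is then judged for each fixed value of
-- C(v), with only the sets at the heads random.
--
-- The excess of the palettes over a is of order log a + R, and d leftovers per vertex cost 4d
-- further colours. The local lemma constrains only the product R(d+1), which has to reach about 2
-- log Δ; taking R = d balances the two costs and yields the square root. Lists admit no new
-- colours, whence d = 0.
--
-- Probabilities are counts in lists with repetition, and all inequalities are cleared of
-- denominators.

private
  variable
    𝐴 𝐵 : Set
    m n N : ℕ

⟦_⟧ : Bool → ℕ
⟦ true ⟧  = 1
⟦ false ⟧ = 0

∑ : List 𝐴 → (𝐴 → ℕ) → ℕ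
∑ []       f = 0
∑ (x ∷ xs) f = f x + ∑ xs f

∑-mono : ∀ (xs : List 𝐴) {f g : 𝐴 → ℕ} → (∀ x → x ∈ˡ xs → f x ≤ g x) → ∑ xs f ≤ ∑ xs g
∑-mono []       f≤g = z≤n
∑-mono (x ∷ xs) f≤g = +-mono-≤ (f≤g x (here refl)) (∑-mono xs λ y y∈ → f≤g y (there y∈))

∑-cong : ∀ (xs : List 𝐴) {f g : 𝐴 → ℕ} → (∀ x → f x ≡ g x) → ∑ xs f ≡ ∑ xs g
∑-cong []       f≗g = refl
∑-cong (x ∷ xs) f≗g = cong₂ _+_ (f≗g x) (∑-cong xs f≗g)

∑-++ : ∀ (xs ys : List 𝐴) (f : 𝐴 → ℕ) → ∑ (xs ++ ys) f ≡ ∑ xs f + ∑ ys f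
∑-++ []       ys f = refl
∑-++ (x ∷ xs) ys f = trans (cong (f x +_) (∑-++ xs ys f)) (sym (+-assoc (f x) _ _))

∑-map : ∀ (h : 𝐵 → 𝐴) (xs : List 𝐵) (f : 𝐴 → ℕ) → ∑ (List.map h xs) f ≡ ∑ xs (f ∘ h)
∑-map h []       f = refl
∑-map h (x ∷ xs) f = cong (f (h x) +_) (∑-map h xs f)

+-interchange : ∀ a b c d → (a + b) + (c + d) ≡ (a + c) + (b + d)
+-interchange = solve-∀

∑-+ : ∀ (xs : List 𝐴) (f g : 𝐴 → ℕ) → ∑ xs (λ x → f x + g x) ≡ ∑ xs f + ∑ xs g
∑-+ []       f g = refl
∑-+ (x ∷ xs) f g = trans (cong (f x + g x +_) (∑-+ xs f g)) (+-interchange (f x) (g x) _ _)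

∑-*ˡ : ∀ (xs : List 𝐴) k (f : 𝐴 → ℕ) → ∑ xs (λ x → k * f x) ≡ k * ∑ xs f
∑-*ˡ []       k f = sym (*-zeroʳ k)
∑-*ˡ (x ∷ xs) k f = trans (cong (k * f x +_) (∑-*ˡ xs k f)) (sym (*-distribˡ-+ k (f x) _))

∑-*ʳ : ∀ (xs : List 𝐴) k (f : 𝐴 → ℕ) → ∑ xs (λ x → f x * k) ≡ ∑ xs f * k
∑-*ʳ xs k f = trans (∑-cong xs λ x → *-comm (f x) k) (trans (∑-*ˡ xs k f) (*-comm k _))

∑-const : ∀ (xs : List 𝐴) k → ∑ xs (λ _ → k) ≡ length xs * k
∑-const []       k = refl
∑-const (x ∷ xs) k = cong (k +_) (∑-const xs k)

∑-swap : ∀ (xs : List 𝐴) (ys : List 𝐵) (f : 𝐴 → 𝐵 → ℕ) →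
         ∑ xs (λ x → ∑ ys (f x)) ≡ ∑ ys (λ y → ∑ xs (λ x → f x y))
∑-swap []       ys f = sym (trans (∑-const ys 0) (*-zeroʳ (length ys)))
∑-swap (x ∷ xs) ys f =
  trans (cong (∑ ys (f x) +_) (∑-swap xs ys f)) (sym (∑-+ ys (f x) _))

∑-∈ : ∀ {x : 𝐴} {xs : List 𝐴} (f : 𝐴 → ℕ) → x ∈ˡ xs → f x ≤ ∑ xs f
∑-∈ f (here refl) = m≤m+n _ _
∑-∈ f (there x∈)  = ≤-trans (∑-∈ f x∈) (m≤n+m _ _)

∑-positive : ∀ (xs : List 𝐴) (f : 𝐴 → ℕ) → 0 < ∑ xs f → ∃[ x ] (x ∈ˡ xs × 0 < f x)
∑-positive (x ∷ xs) f 0<∑ with f x in eq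
... | suc _ = x , here refl , subst (0 <_) (sym eq) z<s
... | zero  with y , y∈ , 0<fy ← ∑-positive xs f 0<∑ = y , there y∈ , 0<fy

∑-filter-≤ : ∀ {P : 𝐴 → Set} (P? : ∀ x → Dec (P x)) (xs : List 𝐴) (f : 𝐴 → ℕ) →
             ∑ (List.filter P? xs) f ≤ ∑ xs f
∑-filter-≤ P? []       f = z≤n
∑-filter-≤ P? (x ∷ xs) f with does (P? x)
... | true  = +-monoʳ-≤ (f x) (∑-filter-≤ P? xs f)
... | false = ≤-trans (∑-filter-≤ P? xs f) (m≤n+m _ (f x))

lookup-injective : ∀ {xs : List 𝐴} → Unique xs →
                   ∀ i j → List.lookup xs i ≡ List.lookup xs j → i ≡ j
lookup-injective (x∉ ∷ xs!) zero    zero    eq = refl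
lookup-injective (x∉ ∷ xs!) zero    (suc j) eq = contradiction eq (All.lookup x∉ (Mem.∈-lookup j))
lookup-injective (x∉ ∷ xs!) (suc i) zero    eq = contradiction (sym eq) (All.lookup x∉ (Mem.∈-lookup i))
lookup-injective (x∉ ∷ xs!) (suc i) (suc j) eq = cong suc (lookup-injective xs! i j eq)

unique-⊆-length : ∀ {xs ys : List 𝐴} → Unique xs → (∀ {x} → x ∈ˡ xs → x ∈ˡ ys) →
                  length xs ≤ length ys
unique-⊆-length {xs = xs} {ys} xs! xs⊆ys = Fin.injective⇒≤ {f = position} position-injective
  where
  open import Data.List.Relation.Unary.Any using (index)
  open import Data.List.Relation.Unary.Any.Properties using (lookup-index)

  position : Fin (length xs) → Fin (length ys)
  position i = index (xs⊆ys (Mem.∈-lookup {xs = xs} i))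

  position-lookup : ∀ i → List.lookup xs i ≡ List.lookup ys (position i)
  position-lookup i = lookup-index (xs⊆ys (Mem.∈-lookup {xs = xs} i))

  position-injective : ∀ {i j} → position i ≡ position j → i ≡ j
  position-injective {i} {j} eq = lookup-injective xs! i j
    (trans (position-lookup i) (trans (cong (List.lookup ys) eq) (sym (position-lookup j))))

-- Resampling coordinates

module Resampling {A : Set} {n : ℕ} (L : Fin n → List A) where

  private
    Outcome = Vec A n

  -- An unnormalised conditional expectation given the coordinates outside `us`: values range over
  -- the lists `L u`, repetitions included, and `mass us` is the missing denominator.
  resample : List (Fin n) → (Outcome → ℕ) → Outcome → ℕ
  resample []       f ω = f ω
  resample (u ∷ us) f ω = ∑ (L u) λ a → resample us f (ω [ u ]≔ a)

  mass : List (Fin n) → ℕ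
  mass []       = 1
  mass (u ∷ us) = length (L u) * mass us

  resample-mono : ∀ us {f g : Outcome → ℕ} → (∀ ω → f ω ≤ g ω) →
                  ∀ ω → resample us f ω ≤ resample us g ω
  resample-mono []       f≤g ω = f≤g ω
  resample-mono (u ∷ us) f≤g ω = ∑-mono (L u) λ a _ → resample-mono us f≤g (ω [ u ]≔ a)

  resample-cong : ∀ us {f g : Outcome → ℕ} → (∀ ω → f ω ≡ g ω) →
                  ∀ ω → resample us f ω ≡ resample us g ω
  resample-cong []       f≗g ω = f≗g ω
  resample-cong (u ∷ us) f≗g ω = ∑-cong (L u) λ a → resample-cong us f≗g (ω [ u ]≔ a)

  resample-cong-off : ∀ us w → w ∉ˡ us → ∀ {f g : Outcome → ℕ} ω →
                      (∀ ω′ → lookup ω′ w ≡ lookup ω w → f ω′ ≡ g ω′) →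
                      resample us f ω ≡ resample us g ω
  resample-cong-off []       w w∉ ω f≗g = f≗g ω refl
  resample-cong-off (u ∷ us) w w∉ ω f≗g = ∑-cong (L u) λ a →
    resample-cong-off us w (w∉ ∘ there) (ω [ u ]≔ a) λ ω′ eq →
      f≗g ω′ (trans eq (Vec.lookup∘updateAt′ w u (w∉ ∘ here) ω))

  resample-+ : ∀ us (f g : Outcome → ℕ) ω →
               resample us (λ ω → f ω + g ω) ω ≡ resample us f ω + resample us g ω
  resample-+ []       f g ω = refl
  resample-+ (u ∷ us) f g ω =
    trans (∑-cong (L u) λ a → resample-+ us f g (ω [ u ]≔ a)) (∑-+ (L u) _ _)

  -- The form in which independence enters: `h` ignores the coordinates `us`, hence is a constant
  -- for the conditional expectation.
  resample-pull : ∀ us (h f : Outcome → ℕ) →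
                  (∀ u → u ∈ˡ us → ∀ ω a → h (ω [ u ]≔ a) ≡ h ω) →
                  ∀ ω → resample us (λ ω → h ω * f ω) ω ≡ h ω * resample us f ω
  resample-pull []       h f h-inv ω = refl
  resample-pull (u ∷ us) h f h-inv ω =
    trans (∑-cong (L u) λ a →
             trans (resample-pull us h f (λ w w∈ → h-inv w (there w∈)) (ω [ u ]≔ a))
                   (cong (_* _) (h-inv u (here refl) ω a)))
          (∑-*ˡ (L u) (h ω) _)

  resample-* : ∀ us k (f : Outcome → ℕ) ω →
               resample us (λ ω → k * f ω) ω ≡ k * resample us f ω
  resample-* us k f = resample-pull us (λ _ → k) f (λ _ _ _ _ → refl)

  resample-∑ : ∀ {B : Set} us (xs : List B) (f : B → Outcome → ℕ) ω →
               resample us (λ ω → ∑ xs λ x → f x ω) ω ≡ ∑ xs λ x → resample us (f x) ω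
  resample-∑ []       xs f ω = refl
  resample-∑ (u ∷ us) xs f ω =
    trans (∑-cong (L u) λ a → resample-∑ us xs f (ω [ u ]≔ a)) (∑-swap (L u) xs _)

  private
    average : Fin n → (Outcome → ℕ) → Outcome → ℕ
    average u = resample (u ∷ [])

  resample-comm : ∀ us u (f : Outcome → ℕ) ω →
                  resample us (average u f) ω ≡ average u (resample us f) ω
  resample-comm []       u f ω = refl
  resample-comm (w ∷ us) u f ω =
    trans (∑-cong (L w) λ b → resample-comm us u f (ω [ w ]≔ b)) swap
    where
    swap : ∑ (L w) (λ b → average u (resample us f) (ω [ w ]≔ b))
         ≡ ∑ (L u) (λ a → ∑ (L w) λ b → resample us f (ω [ u ]≔ a [ w ]≔ b))
    swap with u Fin.≟ w
    ... | yes refl = ∑-cong (L u) λ b →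
      trans (∑-cong (L u) λ a → cong (resample us f) (Vec.[]≔-idempotent ω u))
            (sym (∑-cong (L u) λ a → cong (resample us f) (Vec.[]≔-idempotent ω u)))
    ... | no u≢w = trans
      (∑-cong (L w) λ b → ∑-cong (L u) λ a →
         cong (resample us f) (Vec.[]≔-commutes ω w u (u≢w ∘ sym)))
      (∑-swap (L w) (L u) _)

  -- The inner average overwrites `u`, so the outer sum over the same coordinate has equal terms and
  -- contributes only their number.
  resample-average : ∀ us u (f : Outcome → ℕ) → u ∈ˡ us →
                     ∀ ω → resample us (average u f) ω ≡ length (L u) * resample us f ω
  resample-average (w ∷ us) .w f (here refl) ω =
    trans (∑-cong (L w) λ b →
             trans (resample-comm us w f (ω [ w ]≔ b))
                   (∑-cong (L w) λ a → cong (resample us f) (Vec.[]≔-idempotent ω w)))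
          (∑-const (L w) _)
  resample-average (w ∷ us) u f (there u∈) ω =
    trans (∑-cong (L w) λ b → resample-average us u f u∈ (ω [ w ]≔ b))
          (∑-*ˡ (L w) (length (L u)) _)

  -- The first moment method. The disjunction lets the induction carry both the coordinates already
  -- set and those still to be resampled.
  resample-positive : ∀ us (f : Outcome → ℕ) ω → 0 < resample us f ω →
                      ∃[ ω′ ] (0 < f ω′ × (∀ u → lookup ω u ∈ˡ L u ⊎ u ∈ˡ us → lookup ω′ u ∈ˡ L u))
  resample-positive [] f ω 0<f = ω , 0<f , λ { u (inj₁ ∈L) → ∈L }
  resample-positive (w ∷ us) f ω 0<∑
    with a , a∈ , 0<r ← ∑-positive (L w) _ 0<∑
    with ω′ , 0<f , ok ← resample-positive us f (ω [ w ]≔ a) 0<r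
    = ω′ , 0<f , ok′
    where
    ok′ : ∀ u → lookup ω u ∈ˡ L u ⊎ u ∈ˡ w ∷ us → lookup ω′ u ∈ˡ L u
    ok′ u h with u Fin.≟ w
    ... | yes refl = ok u (inj₁ (subst (_∈ˡ L u) (sym (Vec.lookup∘updateAt u ω)) a∈))
    ok′ u (inj₁ ∈L)           | no u≢w =
      ok u (inj₁ (subst (_∈ˡ L u) (sym (Vec.lookup∘updateAt′ u w u≢w ω)) ∈L))
    ok′ u (inj₂ (here u≡w))   | no u≢w = contradiction u≡w u≢w
    ok′ u (inj₂ (there u∈us)) | no u≢w = ok u (inj₂ u∈us)

  total : (Outcome → ℕ) → Outcome → ℕ
  total = resample (allFin n)

  -- The tower law, with `mass us` as the price of leaving expectations unnormalised.
  total-resample : ∀ us (f : Outcome → ℕ) ω → total (resample us f) ω ≡ mass us * total f ω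
  total-resample []       f ω = sym (*-identityˡ _)
  total-resample (u ∷ us) f ω =
    trans (resample-average (allFin n) u (resample us f) (Mem.∈-allFin u) ω)
          (trans (cong (length (L u) *_) (total-resample us f ω)) (sym (*-assoc (length (L u)) _ _)))

  mass-positive : (∀ u → 0 < length (L u)) → ∀ us → 0 < mass us
  mass-positive L>0 []       = z<s
  mass-positive L>0 (u ∷ us) = *-mono-≤ (L>0 u) (mass-positive L>0 us)

-- The local lemma

-- The symmetric local lemma in a one-sided form. `bad v` may depend on coordinates outside `R v`,
-- since `rarely-bad` is demanded for every setting of these; in return `Γ v` only has to list the
-- events that read a coordinate of `R v`.
module LocalLemma
  {A E : Set} {n : ℕ} (L : Fin n → List A) (L-nonempty : ∀ u → 0 < length (L u))
  (_≟ᴱ_ : DecidableEquality E) (bad : E → Vec A n → Bool)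
  (R : E → List (Fin n)) (Γ : E → List E) (D : ℕ) .{{_ : NonZero D}}
  (Γ-bounded : ∀ v → length (Γ v) ≤ D)
  (Γ-complete : ∀ v w → w ∉ˡ Γ v → ∀ u → u ∈ˡ R v → ∀ ω a → bad w (ω [ u ]≔ a) ≡ bad w ω)
  (rarely-bad : ∀ v ω → 4 * D * Resampling.resample L (R v) (λ ω → ⟦ bad v ω ⟧) ω
                        ≤ Resampling.mass L (R v))
  (ω₀ : Vec A n)
  where

  open Resampling L
  open import Data.List.Membership.DecPropositional _≟ᴱ_ using (_∈?_)

  private
    T# : (Vec A n → ℕ) → ℕ
    T# f = total f ω₀

    T#-mono : ∀ {f g} → (∀ ω → f ω ≤ g ω) → T# f ≤ T# g
    T#-mono f≤g = resample-mono (allFin n) f≤g ω₀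

    T#-cong : ∀ {f g} → (∀ ω → f ω ≡ g ω) → T# f ≡ T# g
    T#-cong f≗g = resample-cong (allFin n) f≗g ω₀

  badness : E → Vec A n → ℕ
  badness v ω = ⟦ bad v ω ⟧

  good : List E → Vec A n → ℕ
  good []      ω = 1
  good (v ∷ S) ω = ⟦ not (bad v ω) ⟧ * good S ω

  module _ {P : E → Set} (P? : ∀ v → Dec (P v)) where

    good-filter : ∀ S ω → good S ω ≤ good (List.filter P? S) ω
    good-filter []      ω = ≤-refl
    good-filter (v ∷ S) ω with does (P? v)
    ... | true  = *-monoʳ-≤ ⟦ not (bad v ω) ⟧ (good-filter S ω)
    ... | false with bad v ω
    ...   | true  = z≤n
    ...   | false = ≤-trans (≤-reflexive (*-identityˡ _)) (good-filter S ω)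

  module _ {P : E → Set} (P? : ∀ v → Dec (P v)) where

    inside# outside# : List E → List E
    inside#  = List.filter P?
    outside# = List.filter (λ v → ¬? (P? v))

    good-union : ∀ S ω → good (outside# S) ω ≤
                 good S ω + ∑ (inside# S) (λ w → badness w ω * good (outside# S) ω)
    good-union []      ω = ≤-refl
    good-union (v ∷ S) ω with does (P? v)
    ... | true  with bad v ω
    ...   | true  = ≤-trans (≤-reflexive (sym (+-identityʳ _))) (m≤m+n _ _)
    ...   | false = ≤-trans (good-union S ω) (≤-reflexive (cong (_+ ∑ (inside# S) (λ w → badness w ω * good (outside# S) ω)) (sym (*-identityˡ (good S ω)))))
    good-union (v ∷ S) ω | false = begin
      b * good S₂ ω                                          ≤⟨ *-monoʳ-≤ b (good-union S ω) ⟩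
      b * (good S ω + ∑ S₁ (λ w → badness w ω * good S₂ ω))  ≡⟨ *-distribˡ-+ b (good S ω) _ ⟩
      b * good S ω + b * ∑ S₁ (λ w → badness w ω * good S₂ ω)
        ≡⟨ cong (b * good S ω +_) (sym (∑-*ˡ S₁ b _)) ⟩
      b * good S ω + ∑ S₁ (λ w → b * (badness w ω * good S₂ ω))
        ≡⟨ cong (b * good S ω +_) (∑-cong S₁ λ w → rotate b (badness w ω) _) ⟩
      b * good S ω + ∑ S₁ (λ w → badness w ω * (b * good S₂ ω)) ∎
      where
      open ≤-Reasoning
      b = ⟦ not (bad v ω) ⟧
      S₁ = inside# S
      S₂ = outside# S
      rotate : ∀ x y z → x * (y * z) ≡ y * (x * z)
      rotate = solve-∀

    inside-outside-length : ∀ S → length (inside# S) + length (outside# S) ≡ length S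
    inside-outside-length []      = refl
    inside-outside-length (v ∷ S) with does (P? v)
    ... | true  = cong suc (inside-outside-length S)
    ... | false = trans (+-suc _ _) (cong suc (inside-outside-length S))

  good-invariant : ∀ S u → (∀ w → w ∈ˡ S → ∀ ω a → bad w (ω [ u ]≔ a) ≡ bad w ω) →
                   ∀ ω a → good S (ω [ u ]≔ a) ≡ good S ω
  good-invariant []      u inv ω a = refl
  good-invariant (w ∷ S) u inv ω a =
    cong₂ _*_ (cong (⟦_⟧ ∘ not) (inv w (here refl) ω a))
              (good-invariant S u (λ w w∈ → inv w (there w∈)) ω a)

  split-bad : ∀ v S ω → good S ω ≡ badness v ω * good S ω + good (v ∷ S) ω
  split-bad v S ω with bad v ω
  ... | true  = sym (trans (+-identityʳ _) (+-identityʳ _))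
  ... | false = sym (+-identityʳ _)

  -- No event of `S` reads `R v`, so `good S` factors out of the conditional expectation over `R v`,
  -- where `rarely-bad` applies pointwise.
  rare-off-Γ : ∀ v S → (∀ w → w ∈ˡ S → w ∉ˡ Γ v) →
               4 * D * T# (λ ω → badness v ω * good S ω) ≤ T# (good S)
  rare-off-Γ v S S∉Γ = *-cancelˡ-≤ (mass (R v)) {{>-nonZero (mass-positive L-nonempty (R v))}} (begin
    mass (R v) * (4 * D * T# (λ ω → badness v ω * good S ω))
      ≡⟨ swap (mass (R v)) (4 * D) _ ⟩
    4 * D * (mass (R v) * T# (λ ω → badness v ω * good S ω))
      ≡⟨ cong (4 * D *_) (sym (total-resample (R v) _ ω₀)) ⟩
    4 * D * T# (resample (R v) (λ ω → badness v ω * good S ω))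
      ≡⟨ cong (4 * D *_) (T#-cong λ ω →
           trans (resample-cong (R v) (λ ω → *-comm (badness v ω) (good S ω)) ω)
                 (resample-pull (R v) (good S) (badness v) inv ω)) ⟩
    4 * D * T# (λ ω → good S ω * resample (R v) (badness v) ω)
      ≡⟨ sym (resample-* (allFin n) (4 * D) _ ω₀) ⟩
    T# (λ ω → 4 * D * (good S ω * resample (R v) (badness v) ω))
      ≤⟨ T#-mono (λ ω → ≤-trans (≤-reflexive (swap (4 * D) (good S ω) _))
                       (≤-trans (*-monoʳ-≤ (good S ω) (rarely-bad v ω))
                                (≤-reflexive (*-comm (good S ω) _)))) ⟩
    T# (λ ω → mass (R v) * good S ω)
      ≡⟨ resample-* (allFin n) (mass (R v)) _ ω₀ ⟩
    mass (R v) * T# (good S) ∎)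
    where
    open ≤-Reasoning
    swap : ∀ x y z → x * (y * z) ≡ y * (x * z)
    swap = solve-∀
    inv : ∀ u → u ∈ˡ R v → ∀ ω a → good S (ω [ u ]≔ a) ≡ good S ω
    inv u u∈ = good-invariant S u λ w w∈ → Γ-complete v w (S∉Γ w w∈) u u∈

  -- Proved together with `halving`. Each of the at most `D` events of `S` in `Γ v` has conditional
  -- probability at most 1/(2D) by induction on length, so dropping them all at most doubles the
  -- weight of `good`; this factor 2 turns the 1/(4D) of `rare-off-Γ` into 1/(2D).
  conditionally-rare : ∀ k S → length S ≤ k → Unique S → ∀ v →
                       2 * D * T# (λ ω → badness v ω * good S ω) ≤ T# (good S)
  halving : ∀ k S → length S ≤ k → Unique S → ∀ v →
            T# (good (outside# (_∈? Γ v) S)) ≤ 2 * T# (good S)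

  conditionally-rare k S S≤k S! v = *-cancelˡ-≤ 2 (begin
    2 * (2 * D * T# (λ ω → badness v ω * good S ω))
      ≡⟨ assoc D _ ⟩
    4 * D * T# (λ ω → badness v ω * good S ω)
      ≤⟨ *-monoʳ-≤ (4 * D) (T#-mono λ ω → *-monoʳ-≤ (badness v ω) (good-filter _ S ω)) ⟩
    4 * D * T# (λ ω → badness v ω * good (outside# (_∈? Γ v) S) ω)
      ≤⟨ rare-off-Γ v (outside# (_∈? Γ v) S)
           (λ w w∈ → proj₂ (Mem.∈-filter⁻ (λ w → ¬? (w ∈? Γ v)) {xs = S} w∈)) ⟩
    T# (good (outside# (_∈? Γ v) S))
      ≤⟨ halving k S S≤k S! v ⟩
    2 * T# (good S) ∎)
    where
    open ≤-Reasoning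
    assoc : ∀ d t → 2 * (2 * d * t) ≡ 4 * d * t
    assoc = solve-∀

  halving zero    [] S≤k S! v = m≤m+n _ _
  halving (suc k) S S≤k S! v = *-cancelˡ-≤ D (+-cancelˡ-≤ (D * t₂) _ _ (begin
    D * t₂ + D * t₂                     ≡⟨ double D t₂ ⟩
    2 * D * t₂                          ≤⟨ *-monoʳ-≤ (2 * D) union ⟩
    2 * D * (t + ∑ S₁ bad₂)             ≡⟨ *-distribˡ-+ (2 * D) t _ ⟩
    2 * D * t + 2 * D * ∑ S₁ bad₂       ≤⟨ +-monoʳ-≤ (2 * D * t) intersecting ⟩
    2 * D * t + D * t₂                  ≡⟨ rearrange D t (D * t₂) ⟩
    D * t₂ + D * (2 * t)                ∎))
    where
    open ≤-Reasoning
    S₁ = inside# (_∈? Γ v) S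
    S₂ = outside# (_∈? Γ v) S
    t  = T# (good S)
    t₂ = T# (good S₂)
    bad₂ : E → ℕ
    bad₂ w = T# (λ ω → badness w ω * good S₂ ω)

    double : ∀ d x → d * x + d * x ≡ 2 * d * x
    double = solve-∀
    rearrange : ∀ d x y → 2 * d * x + y ≡ y + d * (2 * x)
    rearrange = solve-∀

    union : t₂ ≤ t + ∑ S₁ bad₂
    union = ≤-trans (T#-mono (good-union (_∈? Γ v) S))
      (≤-reflexive (trans (resample-+ (allFin n) _ _ ω₀)
                          (cong (t +_) (resample-∑ (allFin n) S₁ _ ω₀))))

    -- A dropped event `w` witnesses that `S₂` is strictly shorter than `S`, which licenses the
    -- induction.
    S₂-shorter : ∀ {w} → w ∈ˡ S₁ → length S₂ ≤ k
    S₂-shorter w∈ = s≤s⁻¹ (≤-trans (+-monoˡ-≤ (length S₂) (nonempty w∈))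
                          (≤-trans (≤-reflexive (inside-outside-length (_∈? Γ v) S)) S≤k))
      where
      nonempty : ∀ {w} {xs : List E} → w ∈ˡ xs → 1 ≤ length xs
      nonempty (here _)  = s≤s z≤n
      nonempty (there _) = s≤s z≤n

    S₁≤D : length S₁ ≤ D
    S₁≤D = ≤-trans (unique-⊆-length (Unique.filter⁺ (_∈? Γ v) S!)
                     (λ w∈ → proj₂ (Mem.∈-filter⁻ (_∈? Γ v) {xs = S} w∈))) (Γ-bounded v)

    intersecting : 2 * D * ∑ S₁ bad₂ ≤ D * t₂
    intersecting = begin
      2 * D * ∑ S₁ bad₂            ≡⟨ sym (∑-*ˡ S₁ (2 * D) bad₂) ⟩
      ∑ S₁ (λ w → 2 * D * bad₂ w)
        ≤⟨ ∑-mono S₁ (λ w w∈ → conditionally-rare k S₂ (S₂-shorter w∈)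
             (Unique.filter⁺ (λ w → ¬? (w ∈? Γ v)) S!) w) ⟩
      ∑ S₁ (λ _ → t₂)              ≡⟨ ∑-const S₁ t₂ ⟩
      length S₁ * t₂               ≤⟨ *-monoˡ-≤ t₂ S₁≤D ⟩
      D * t₂                       ∎

  total-1 : ∀ us ω → resample us (λ _ → 1) ω ≡ mass us
  total-1 []       ω = refl
  total-1 (u ∷ us) ω = trans (∑-cong (L u) λ a → total-1 us (ω [ u ]≔ a)) (∑-const (L u) _)

  good-positive : ∀ S → Unique S → 0 < T# (good S)
  good-positive []      S!        = subst (0 <_) (sym (total-1 (allFin n) ω₀)) (mass-positive L-nonempty (allFin n))
  good-positive (v ∷ S) (_ ∷ S!) = ≰⇒> λ none → <-irrefl refl (begin-strict
    0               <⟨ good-positive S S! ⟩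
    t               ≤⟨ +-cancelˡ-≤ t _ _ (two (n≤0⇒n≡0 none)) ⟩
    0               ∎)
    where
    open ≤-Reasoning
    t = T# (good S)
    b = T# (λ ω → badness v ω * good S ω)
    -- If no outcome avoided `v` along with `S`, then `bad v` would carry all the weight `t` of
    -- `good S`, although it carries at most half of it.
    two : T# (good (v ∷ S)) ≡ 0 → t + t ≤ t + 0
    two none = begin
      t + t       ≡⟨ cong₂ _+_ t≡b t≡b ⟩
      b + b       ≡⟨ cong (b +_) (sym (+-identityʳ b)) ⟩
      2 * b       ≤⟨ *-monoˡ-≤ b (m≤m*n 2 D) ⟩
      2 * D * b   ≤⟨ conditionally-rare (length S) S ≤-refl S! v ⟩
      t           ≡⟨ sym (+-identityʳ t) ⟩
      t + 0       ∎
      where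
      t≡b : t ≡ b
      t≡b = trans (T#-cong (split-bad v S)) (trans (resample-+ (allFin n) _ _ ω₀)
            (trans (cong (b +_) none) (+-identityʳ b)))

  good-sound : ∀ S ω → 0 < good S ω → ∀ v → v ∈ˡ S → bad v ω ≡ false
  good-sound (w ∷ S) ω pos v v∈ with bad w ω in eq
  good-sound (w ∷ S) ω pos .w (here refl) | false = eq
  good-sound (w ∷ S) ω pos v  (there v∈)  | false =
    good-sound S ω (subst (0 <_) (*-identityˡ _) pos) v v∈

  avoid-all : ∀ S → Unique S →
              ∃[ ω ] ((∀ v → v ∈ˡ S → bad v ω ≡ false) × (∀ u → lookup ω u ∈ˡ L u))
  avoid-all S S! with ω , pos , ω∈ ← resample-positive (allFin n) (good S) ω₀ (good-positive S S!)
    = ω , good-sound S ω pos , λ u → ω∈ u (inj₂ (Mem.∈-allFin u))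

-- Random subsets

-- Bernoulli's inequality (1 - 1/c)^h ≥ 1 - h/c for c = B + 1.
bernoulli-below : ∀ B h → suc B ^ h * suc B ≤ B ^ h * suc B + h * suc B ^ h
bernoulli-below B zero    = m≤m+n _ _
bernoulli-below B (suc h) = begin
  c * X * c                            ≡⟨ expand B X ⟩
  X * c * B + X * c                    ≤⟨ +-monoˡ-≤ (X * c) (*-monoˡ-≤ B (bernoulli-below B h)) ⟩
  (Y * c + h * X) * B + X * c          ≤⟨ m≤m+n _ (h * X) ⟩
  (Y * c + h * X) * B + X * c + h * X  ≡⟨ collect B X Y h ⟩
  B * Y * c + suc h * (c * X)          ∎
  where
  open ≤-Reasoning
  c = suc B
  X = suc B ^ h
  Y = B ^ h
  expand : ∀ B X → suc B * X * suc B ≡ X * suc B * B + X * suc B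
  expand = solve-∀
  collect : ∀ B X Y h → (Y * suc B + h * X) * B + X * suc B + h * X
                      ≡ B * Y * suc B + suc h * (suc B * X)
  collect = solve-∀

half-power : ∀ B h → 2 * h ≤ suc B → suc B ^ h ≤ 2 * B ^ h
half-power B h 2h≤ = *-cancelʳ-≤ _ _ (suc B) (+-cancelʳ-≤ (X * c) _ _ (begin
  X * c + X * c            ≡⟨ double X c ⟩
  2 * (X * c)              ≤⟨ *-monoʳ-≤ 2 (bernoulli-below B h) ⟩
  2 * (Y * c + h * X)      ≡⟨ distrib X Y c h ⟩
  2 * Y * c + 2 * h * X    ≤⟨ +-monoʳ-≤ (2 * Y * c) (*-monoˡ-≤ X 2h≤) ⟩
  2 * Y * c + c * X        ≡⟨ cong (2 * Y * c +_) (*-comm c X) ⟩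
  2 * Y * c + X * c        ∎))
  where
  open ≤-Reasoning
  c = suc B
  X = suc B ^ h
  Y = B ^ h
  double : ∀ X c → X * c + X * c ≡ 2 * (X * c)
  double = solve-∀
  distrib : ∀ X Y c h → 2 * (Y * c + h * X) ≡ 2 * Y * c + 2 * h * X
  distrib = solve-∀

-- Bernoulli's inequality (1 + 1/b)^n ≥ 1 + n/b, multiplied by b^(n+1).
bernoulli-above : ∀ b n → b ^ n * (b + n) ≤ b * suc b ^ n
bernoulli-above b zero    = ≤-reflexive (base b)
  where
  base : ∀ b → 1 * (b + 0) ≡ b * 1
  base = solve-∀
bernoulli-above b (suc n) = begin
  b * b ^ n * (b + suc n)                ≤⟨ m≤m+n _ (b ^ n * n) ⟩
  b * b ^ n * (b + suc n) + b ^ n * n    ≡⟨ collect b n (b ^ n) ⟩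
  suc b * (b ^ n * (b + n))              ≤⟨ *-monoʳ-≤ (suc b) (bernoulli-above b n) ⟩
  suc b * (b * suc b ^ n)                ≡⟨ swap (suc b) b _ ⟩
  b * (suc b * suc b ^ n)                ∎
  where
  open ≤-Reasoning
  collect : ∀ b n Y → b * Y * (b + suc n) + Y * n ≡ suc b * (Y * (b + n))
  collect = solve-∀
  swap : ∀ x y z → x * (y * z) ≡ y * (x * z)
  swap = solve-∀

-- In other terms (1 - 1/B)^B ≤ 1/2 for B = b + 1: every B independent chances of probability 1/B
-- halve the probability that none occurs.
double-power : ∀ b → 2 * b ^ suc b ≤ suc b ^ suc b
double-power b = begin
  2 * (b * b ^ b)    ≡⟨ rearrange b (b ^ b) ⟩
  b ^ b * (b + b)    ≤⟨ bernoulli-above b b ⟩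
  b * suc b ^ b      ≤⟨ *-monoˡ-≤ (suc b ^ b) (n≤1+n b) ⟩
  suc b * suc b ^ b  ∎
  where
  open ≤-Reasoning
  rearrange : ∀ b Y → 2 * (b * Y) ≡ Y * (b + b)
  rearrange = solve-∀

^-distribʳ-* : ∀ x y k → (x * y) ^ k ≡ x ^ k * y ^ k
^-distribʳ-* x y zero    = refl
^-distribʳ-* x y (suc k) =
  trans (cong (x * y *_) (^-distribʳ-* x y k)) (rearrange x y (x ^ k) (y ^ k))
  where
  rearrange : ∀ x y X Y → x * y * (X * Y) ≡ x * X * (y * Y)
  rearrange = solve-∀

power-tail : ∀ {x y k t} → x ≤ y → k ≤ t → ∀ {p q} → p * x ^ k ≤ q * y ^ k → p * x ^ t ≤ q * y ^ t
power-tail {x} {y} {k} {t} x≤y k≤t {p} {q} base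
  with e , refl ← m≤n⇒∃[o]m+o≡n k≤t = begin
    p * x ^ (k + e)          ≡⟨ cong (p *_) (^-distribˡ-+-* x k e) ⟩
    p * (x ^ k * x ^ e)      ≡⟨ sym (*-assoc p _ _) ⟩
    p * x ^ k * x ^ e        ≤⟨ *-mono-≤ base (^-monoˡ-≤ e x≤y) ⟩
    q * y ^ k * y ^ e        ≡⟨ *-assoc q _ _ ⟩
    q * (y ^ k * y ^ e)      ≡⟨ cong (q *_) (sym (^-distribˡ-+-* y k e)) ⟩
    q * y ^ (k + e)          ∎
  where open ≤-Reasoning

miss : Subset N → Subset N → Bool
miss []      []      = true
miss (z ∷ Z) (s ∷ S) = not (z ∧ s) ∧ miss Z S

miss-complete : ∀ (Z S : Subset N) → (∀ {c} → c ∈ Z → c ∉ S) → miss Z S ≡ true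
miss-complete []            []            disj = refl
miss-complete (inside ∷ Z)  (inside ∷ S)  disj = contradiction Vec.here (disj Vec.here)
miss-complete (inside ∷ Z)  (outside ∷ S) disj =
  miss-complete Z S λ c∈Z c∈S → disj (Vec.there c∈Z) (Vec.there c∈S)
miss-complete (outside ∷ Z) (s ∷ S)       disj =
  miss-complete Z S λ c∈Z c∈S → disj (Vec.there c∈Z) (Vec.there c∈S)

∣p∩q∣+∣p∩∁q∣≡∣p∣ : ∀ (p q : Subset N) → ∣ p ∩ q ∣ + ∣ p ∩ ∁ q ∣ ≡ ∣ p ∣
∣p∩q∣+∣p∩∁q∣≡∣p∣ []            []            = refl
∣p∩q∣+∣p∩∁q∣≡∣p∣ (outside ∷ p) (_ ∷ q)       = ∣p∩q∣+∣p∩∁q∣≡∣p∣ p q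
∣p∩q∣+∣p∩∁q∣≡∣p∣ (inside ∷ p)  (inside ∷ q)  = cong suc (∣p∩q∣+∣p∩∁q∣≡∣p∣ p q)
∣p∩q∣+∣p∩∁q∣≡∣p∣ (inside ∷ p)  (outside ∷ q) = trans (+-suc _ _) (cong suc (∣p∩q∣+∣p∩∁q∣≡∣p∣ p q))

-- The uniform measure on a list in which every colour is inside with
-- probability 1/(1+b), independently of the others.
module RandomSubset (b : ℕ) where

  copies : ℕ → List 𝐴 → List 𝐴
  copies k xs = List.concat (List.replicate k xs)

  ∑-copies : ∀ k (xs : List 𝐴) (f : 𝐴 → ℕ) → ∑ (copies k xs) f ≡ k * ∑ xs f
  ∑-copies zero    xs f = refl
  ∑-copies (suc k) xs f = trans (∑-++ xs (copies k xs) f) (cong (∑ xs f +_) (∑-copies k xs f))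

  subsets : ∀ N → List (Subset N)
  subsets zero    = [] ∷ []
  subsets (suc N) = copies b (List.map (outside ∷_) (subsets N)) ++ List.map (inside ∷_) (subsets N)

  ∑-subsets : ∀ N (f : Subset (suc N) → ℕ) → ∑ (subsets (suc N)) f
              ≡ b * ∑ (subsets N) (f ∘ (outside ∷_)) + ∑ (subsets N) (f ∘ (inside ∷_))
  ∑-subsets N f = begin
    ∑ (copies b out ++ ins) f          ≡⟨ ∑-++ (copies b out) ins f ⟩
    ∑ (copies b out) f + ∑ ins f       ≡⟨ cong₂ _+_ (∑-copies b out f) (∑-map (inside ∷_) (subsets N) f) ⟩
    b * ∑ out f + ∑ (subsets N) (f ∘ (inside ∷_))
      ≡⟨ cong (λ x → b * x + ∑ (subsets N) (f ∘ (inside ∷_))) (∑-map (outside ∷_) (subsets N) f) ⟩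
    b * ∑ (subsets N) (f ∘ (outside ∷_)) + ∑ (subsets N) (f ∘ (inside ∷_)) ∎
    where
    open ≡-Reasoning
    out = List.map (outside ∷_) (subsets N)
    ins = List.map (inside ∷_) (subsets N)

  ∑-subsets-1 : ∀ N → ∑ (subsets N) (λ _ → 1) ≡ suc b ^ N
  ∑-subsets-1 zero    = refl
  ∑-subsets-1 (suc N) = trans (∑-subsets N (λ _ → 1))
    (trans (cong (λ x → b * x + x) (∑-subsets-1 N)) (+-comm (b * suc b ^ N) _))

  miss-count : ∀ (Z : Subset N) →
    ∑ (subsets N) (λ S → ⟦ miss Z S ⟧) * suc b ^ ∣ Z ∣ ≡ b ^ ∣ Z ∣ * suc b ^ N
  miss-count []                      = refl
  miss-count {suc N} (outside ∷ Z)   =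
    trans (cong (_* suc b ^ ∣ Z ∣) (∑-subsets N _))
    (trans (pull b x (suc b ^ ∣ Z ∣))
    (trans (cong (suc b *_) (miss-count Z)) (swap (suc b) (b ^ ∣ Z ∣) (suc b ^ N))))
    where
    x = ∑ (subsets N) (λ S → ⟦ miss Z S ⟧)
    pull : ∀ b x y → (b * x + x) * y ≡ suc b * (x * y)
    pull = solve-∀
    swap : ∀ x y z → x * (y * z) ≡ y * (x * z)
    swap = solve-∀
  miss-count {suc N} (inside ∷ Z) =
    trans (cong (_* (suc b * suc b ^ ∣ Z ∣))
             (trans (∑-subsets N _)
               (cong (b * x +_) (trans (∑-const (subsets N) 0) (*-zeroʳ (length (subsets N)))))))
    (trans (pull b x (suc b ^ ∣ Z ∣))
    (trans (cong (b * suc b *_) (miss-count Z)) (push b (b ^ ∣ Z ∣) (suc b ^ N))))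
    where
    x = ∑ (subsets N) (λ S → ⟦ miss Z S ⟧)
    pull : ∀ b x y → (b * x + 0) * (suc b * y) ≡ b * suc b * (x * y)
    pull = solve-∀
    push : ∀ b y z → b * suc b * (y * z) ≡ b * y * (suc b * z)
    push = solve-∀

  -- The mean of 2^|P ∩ S| is (1 + 1/(b+1))^|P|, because each colour of `P` independently
  -- contributes a factor (b+2)/(b+1).
  moment : ∀ (P : Subset N) →
    ∑ (subsets N) (λ S → 2 ^ ∣ P ∩ S ∣) * suc b ^ ∣ P ∣ ≡ suc (suc b) ^ ∣ P ∣ * suc b ^ N
  moment []                    = refl
  moment {suc N} (outside ∷ P) =
    trans (cong (_* suc b ^ ∣ P ∣) (∑-subsets N _))
    (trans (pull b x (suc b ^ ∣ P ∣))
    (trans (cong (suc b *_) (moment P)) (swap (suc b) (suc (suc b) ^ ∣ P ∣) (suc b ^ N))))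
    where
    x = ∑ (subsets N) (λ S → 2 ^ ∣ P ∩ S ∣)
    pull : ∀ b x y → (b * x + x) * y ≡ suc b * (x * y)
    pull = solve-∀
    swap : ∀ x y z → x * (y * z) ≡ y * (x * z)
    swap = solve-∀
  moment {suc N} (inside ∷ P) =
    trans (cong (_* (suc b * suc b ^ ∣ P ∣))
             (trans (∑-subsets N _) (cong (b * x +_) (∑-*ˡ (subsets N) 2 _))))
    (trans (pull b x (suc b ^ ∣ P ∣))
    (trans (cong (suc (suc b) * suc b *_) (moment P)) (push b (suc (suc b) ^ ∣ P ∣) (suc b ^ N))))
    where
    x = ∑ (subsets N) (λ S → 2 ^ ∣ P ∩ S ∣)
    pull : ∀ b x y → (b * x + 2 * x) * (suc b * y) ≡ suc (suc b) * suc b * (x * y)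
    pull = solve-∀
    push : ∀ b y z → suc (suc b) * suc b * (y * z) ≡ suc (suc b) * y * (suc b * z)
    push = solve-∀

  exceeds : ℕ → Subset N → Subset N → Bool
  exceeds s P S = s <ᵇ ∣ P ∩ S ∣

  -- A Chernoff bound: Markov's inequality for 2^|P ∩ S|, whose mean is at most 2^t by the growth
  -- hypothesis.
  exceeds-rare : ∀ s t (P : Subset N) → suc (suc b) ^ ∣ P ∣ ≤ 2 ^ t * suc b ^ ∣ P ∣ →
    ∑ (subsets N) (λ S → ⟦ exceeds s P S ⟧) * 2 ^ suc s ≤ 2 ^ t * suc b ^ N
  exceeds-rare {N} s t P growth = begin
    ∑ (subsets N) (λ S → ⟦ exceeds s P S ⟧) * 2 ^ suc s
      ≡⟨ sym (∑-*ʳ (subsets N) (2 ^ suc s) _) ⟩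
    ∑ (subsets N) (λ S → ⟦ exceeds s P S ⟧ * 2 ^ suc s)
      ≤⟨ ∑-mono (subsets N) (λ S _ → markov S) ⟩
    M
      ≤⟨ *-cancelʳ-≤ M _ (suc b ^ ∣ P ∣) {{m^n≢0 (suc b) ∣ P ∣}} scaled ⟩
    2 ^ t * suc b ^ N ∎
    where
    open ≤-Reasoning
    M = ∑ (subsets N) (λ S → 2 ^ ∣ P ∩ S ∣)
    markov : ∀ S → ⟦ exceeds s P S ⟧ * 2 ^ suc s ≤ 2 ^ ∣ P ∩ S ∣
    markov S with s <ᵇ ∣ P ∩ S ∣ in eq
    ... | false = z≤n
    ... | true  = ≤-trans (≤-reflexive (*-identityˡ _))
                    (^-monoʳ-≤ 2 (<ᵇ⇒< s ∣ P ∩ S ∣ (subst T (sym eq) _)))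
    scaled : M * suc b ^ ∣ P ∣ ≤ 2 ^ t * suc b ^ N * suc b ^ ∣ P ∣
    scaled = begin
      M * suc b ^ ∣ P ∣                         ≡⟨ moment P ⟩
      suc (suc b) ^ ∣ P ∣ * suc b ^ N           ≤⟨ *-monoˡ-≤ (suc b ^ N) growth ⟩
      2 ^ t * suc b ^ ∣ P ∣ * suc b ^ N         ≡⟨ rotate (2 ^ t) _ _ ⟩
      2 ^ t * suc b ^ N * suc b ^ ∣ P ∣         ∎
      where
      rotate : ∀ x y z → x * y * z ≡ x * z * y
      rotate = solve-∀

  balanced : ℕ → List (Subset N) → Subset N → Bool
  balanced s []       S = true
  balanced s (P ∷ Ps) S = not (exceeds s P S) ∧ balanced s Ps S

  balanced-sound : ∀ s (Ps : List (Subset N)) S → balanced s Ps S ≡ true →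
                   ∀ {P} → P ∈ˡ Ps → ∣ P ∩ S ∣ ≤ s
  balanced-sound s (P ∷ Ps) S ok P∈ with s <ᵇ ∣ P ∩ S ∣ in eq
  balanced-sound s (P ∷ Ps) S ok (here refl) | false =
    ≮⇒≥ λ s< → subst T eq (<⇒<ᵇ s<)
  balanced-sound s (P ∷ Ps) S ok (there P∈)  | false = balanced-sound s Ps S ok P∈

  unbalanced-union : ∀ s (Ps : List (Subset N)) S →
    ⟦ not (balanced s Ps S) ⟧ ≤ ∑ Ps (λ P → ⟦ exceeds s P S ⟧)
  unbalanced-union s []       S = z≤n
  unbalanced-union s (P ∷ Ps) S with s <ᵇ ∣ P ∩ S ∣
  ... | true  = s≤s z≤n
  ... | false = unbalanced-union s Ps S

  balancedSubsets : ℕ → List (Subset N) → List (Subset N)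
  balancedSubsets s Ps = List.filter (λ S → balanced s Ps S Bool.≟ true) (subsets _)

  balanced-count : ∀ s (Ps : List (Subset N)) xs →
    length (List.filter (λ S → balanced s Ps S Bool.≟ true) xs)
      + ∑ xs (λ S → ⟦ not (balanced s Ps S) ⟧) ≡ ∑ xs (λ _ → 1)
  balanced-count s Ps []       = refl
  balanced-count s Ps (S ∷ xs) with balanced s Ps S
  ... | true  = cong suc (balanced-count s Ps xs)
  ... | false = trans (+-suc _ _) (cong suc (balanced-count s Ps xs))

  -- Each palette is exceeded with probability at most 1/(2(a+1)²), so one of at most a + 1 palettes
  -- is with probability at most 1/(2(a+1)). The square is chosen so that this loss stays bounded in
  -- a product over a + 1 vertices.
  balanced-common : ∀ s t a (Ps : List (Subset N)) → length Ps ≤ suc a →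
    (∀ {P} → P ∈ˡ Ps → suc (suc b) ^ ∣ P ∣ ≤ 2 ^ t * suc b ^ ∣ P ∣) →
    2 ^ t * (2 * suc a * suc a) ≤ 2 ^ suc s →
    2 * suc a * suc b ^ N ≤ 2 * suc a * length (balancedSubsets s Ps) + suc b ^ N
  balanced-common {N} s t a Ps few growth small = begin
    2 * K * F                      ≡⟨ cong (2 * K *_) (sym (trans (balanced-count s Ps (subsets N)) (∑-subsets-1 N))) ⟩
    2 * K * (ℓ + u)                ≡⟨ *-distribˡ-+ (2 * K) ℓ u ⟩
    2 * K * ℓ + 2 * K * u          ≤⟨ +-monoʳ-≤ (2 * K * ℓ) u-small ⟩
    2 * K * ℓ + F                  ∎
    where
    open ≤-Reasoning
    K = suc a
    F = suc b ^ N
    ℓ = length (balancedSubsets s Ps)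
    u = ∑ (subsets N) (λ S → ⟦ not (balanced s Ps S) ⟧)
    e : Subset N → ℕ
    e P = ∑ (subsets N) (λ S → ⟦ exceeds s P S ⟧)

    e-small : ∀ {P} → P ∈ˡ Ps → 2 * K * K * e P ≤ F
    e-small {P} P∈ = *-cancelˡ-≤ (2 ^ t) {{m^n≢0 2 t}} (begin
      2 ^ t * (2 * K * K * e P)     ≡⟨ sym (*-assoc (2 ^ t) _ _) ⟩
      2 ^ t * (2 * K * K) * e P     ≤⟨ *-monoˡ-≤ (e P) small ⟩
      2 ^ suc s * e P               ≡⟨ *-comm (2 ^ suc s) (e P) ⟩
      e P * 2 ^ suc s               ≤⟨ exceeds-rare s t P (growth P∈) ⟩
      2 ^ t * F                     ∎)

    u-small : 2 * K * u ≤ F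
    u-small = *-cancelˡ-≤ K (begin
      K * (2 * K * u)               ≡⟨ rearrange K u ⟩
      2 * K * K * u                 ≤⟨ *-monoʳ-≤ (2 * K * K) (∑-mono (subsets N) λ S _ → unbalanced-union s Ps S) ⟩
      2 * K * K * ∑ (subsets N) (λ S → ∑ Ps λ P → ⟦ exceeds s P S ⟧)
        ≡⟨ cong (2 * K * K *_) (∑-swap (subsets N) Ps _) ⟩
      2 * K * K * ∑ Ps e            ≡⟨ sym (∑-*ˡ Ps (2 * K * K) e) ⟩
      ∑ Ps (λ P → 2 * K * K * e P)  ≤⟨ ∑-mono Ps (λ P P∈ → e-small P∈) ⟩
      ∑ Ps (λ _ → F)                ≡⟨ ∑-const Ps F ⟩
      length Ps * F                 ≤⟨ *-monoˡ-≤ F few ⟩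
      K * F                         ∎)
      where
      rearrange : ∀ K u → K * (2 * K * u) ≡ 2 * K * K * u
      rearrange = solve-∀

-- Hall's theorem with defect

subset : ∀ {P : Fin N → Set} → (∀ c → Dec (P c)) → Subset N
subset P? = Vec.tabulate λ c → does (P? c)

module _ {P : Fin N → Set} (P? : ∀ c → Dec (P c)) where

  ∈-subset⁺ : ∀ {c} → P c → c ∈ subset P?
  ∈-subset⁺ {c} p = Vec.lookup⇒[]= c _ (trans (Vec.lookup∘tabulate _ c) (dec-true (P? c) p))

  ∈-subset⁻ : ∀ {c} → c ∈ subset P? → P c
  ∈-subset⁻ {c} c∈ with P? c in eq
  ... | yes p = p
  ... | no ¬p with () ← trans (sym (cong does eq))
                          (trans (sym (Vec.lookup∘tabulate (does ∘ P?) c)) (Vec.[]=⇒lookup c∈))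

module _ (Q : Vec (Subset N) m) (X : Subset m) where

  private
    covered? : ∀ c → Dec (∃[ i ] (i ∈ X × c ∈ lookup Q i))
    covered? c = Fin.any? λ i → (i Subset.∈? X) ×-dec (c Subset.∈? lookup Q i)

  nbhd : Subset N
  nbhd = subset covered?

  ∈-nbhd⁺ : ∀ {i c} → i ∈ X → c ∈ lookup Q i → c ∈ nbhd
  ∈-nbhd⁺ i∈X c∈Q = ∈-subset⁺ covered? (_ , i∈X , c∈Q)

  ∈-nbhd⁻ : ∀ {c} → c ∈ nbhd → ∃[ i ] (i ∈ X × c ∈ lookup Q i)
  ∈-nbhd⁻ = ∈-subset⁻ covered?

x∈p─q⁻ : ∀ (p q : Subset N) {x} → x ∈ p ─ q → x ∈ p × x ∉ q
x∈p─q⁻ (inside ∷ p)  (outside ∷ q) Vec.here       = Vec.here , λ ()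
x∈p─q⁻ (outside ∷ p) (inside ∷ q)  {zero} ()
x∈p─q⁻ (outside ∷ p) (outside ∷ q) {zero} ()
x∈p─q⁻ (_ ∷ p)       (_ ∷ q)       (Vec.there x∈) with x∈p , x∉q ← x∈p─q⁻ p q x∈ =
  Vec.there x∈p , λ { (Vec.there x∈q) → x∉q x∈q }

∣p∪q∣≤∣p∣+∣q∣ : ∀ (p q : Subset N) → ∣ p ∪ q ∣ ≤ ∣ p ∣ + ∣ q ∣
∣p∪q∣≤∣p∣+∣q∣ []            []            = z≤n
∣p∪q∣≤∣p∣+∣q∣ (outside ∷ p) (outside ∷ q) = ∣p∪q∣≤∣p∣+∣q∣ p q
∣p∪q∣≤∣p∣+∣q∣ (outside ∷ p) (inside ∷ q)  = ≤-trans (s≤s (∣p∪q∣≤∣p∣+∣q∣ p q)) (≤-reflexive (sym (+-suc _ _)))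
∣p∪q∣≤∣p∣+∣q∣ (inside ∷ p)  (outside ∷ q) = s≤s (∣p∪q∣≤∣p∣+∣q∣ p q)
∣p∪q∣≤∣p∣+∣q∣ (inside ∷ p)  (inside ∷ q)  =
  s≤s (≤-trans (∣p∪q∣≤∣p∣+∣q∣ p q) (+-monoʳ-≤ ∣ p ∣ (n≤1+n _)))

disjoint-∪ : ∀ (p q : Subset N) → (∀ {x} → x ∈ p → x ∉ q) → ∣ p ∣ + ∣ q ∣ ≤ ∣ p ∪ q ∣
disjoint-∪ []            []            disj = z≤n
disjoint-∪ (outside ∷ p) (outside ∷ q) disj = disjoint-∪ p q λ a b → disj (Vec.there a) (Vec.there b)
disjoint-∪ (outside ∷ p) (inside ∷ q)  disj =
  ≤-trans (≤-reflexive (+-suc _ _)) (s≤s (disjoint-∪ p q λ a b → disj (Vec.there a) (Vec.there b)))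
disjoint-∪ (inside ∷ p)  (outside ∷ q) disj = s≤s (disjoint-∪ p q λ a b → disj (Vec.there a) (Vec.there b))
disjoint-∪ (inside ∷ p)  (inside ∷ q)  disj = contradiction Vec.here (disj Vec.here)

size-positive : ∀ {p : Subset N} {x} → x ∈ p → 0 < ∣ p ∣
size-positive Vec.here                      = z<s
size-positive {p = s ∷ p} (Vec.there x∈p)   = ≤-trans (size-positive x∈p) (Subset.∣p∣≤∣x∷p∣ s p)

size-positive⁻ : ∀ (p : Subset N) → 0 < ∣ p ∣ → ∃[ x ] (x ∈ p)
size-positive⁻ (inside ∷ p)  0<p = zero , Vec.here
size-positive⁻ (outside ∷ p) 0<p with x , x∈ ← size-positive⁻ p 0<p = suc x , Vec.there x∈

∣p∣≤1+∣p-x∣ : ∀ (p : Subset N) x → ∣ p ∣ ≤ suc ∣ p - x ∣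
∣p∣≤1+∣p-x∣ p x = begin
  ∣ p ∣                   ≤⟨ Subset.p⊆q⇒∣p∣≤∣q∣ cover ⟩
  ∣ ⁅ x ⁆ ∪ (p - x) ∣     ≤⟨ ∣p∪q∣≤∣p∣+∣q∣ ⁅ x ⁆ (p - x) ⟩
  ∣ ⁅ x ⁆ ∣ + ∣ p - x ∣   ≡⟨ cong (_+ ∣ p - x ∣) (Subset.∣⁅x⁆∣≡1 x) ⟩
  suc ∣ p - x ∣           ∎
  where
  open ≤-Reasoning
  cover : p ⊆ ⁅ x ⁆ ∪ (p - x)
  cover {y} y∈p with y Fin.≟ x
  ... | yes refl = Subset.x∈p∪q⁺ (inj₁ (Subset.x∈⁅x⁆ x))
  ... | no  y≢x  = Subset.x∈p∪q⁺ {p = ⁅ x ⁆} (inj₂ (Subset.x∈p∧x≢y⇒x∈p-y y∈p y≢x))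

-- The Halmos–Vaughan proof of Hall's theorem, for the rows in I and the
-- colours in G.  Violating or tight sets need only be sought away from one
-- chosen row i₀.
module Hall (Q : Vec (Subset N) m) where

  Matching : Subset m → Subset N → Set
  Matching I G = Σ (∀ i → i ∈ I → Fin N) λ μ →
      (∀ i i∈ → μ i i∈ ∈ lookup Q i × μ i i∈ ∈ G)
    × (∀ i j i∈ j∈ → μ i i∈ ≡ μ j j∈ → i ≡ j)

  HallCondition : Subset m → Subset N → Set
  HallCondition I G = ∀ X → X ⊆ I → ∣ X ∣ ≤ ∣ nbhd Q X ∩ G ∣

  match : ∀ k I G → ∣ I ∣ ≤ k → HallCondition I G → Matching I G
  match k I G I≤k hall with Subset.nonempty? I
  match k I G I≤k hall | no empty =
    (λ i i∈ → contradiction (i , i∈) empty) ,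
    (λ i i∈ → contradiction (i , i∈) empty) ,
    (λ i j i∈ → contradiction (i , i∈) empty)
  match zero    I G I≤k hall | yes (i₀ , i₀∈) = contradiction (≤-trans (size-positive i₀∈) I≤k) λ ()
  match (suc k) I G I≤k hall | yes (i₀ , i₀∈)
    with Subset.anySubset? (λ X → (X Subset.⊆? (I - i₀)) ×-dec
                                  (Subset.nonempty? X ×-dec (∣ nbhd Q X ∩ G ∣ ≤? ∣ X ∣)))
  ... | yes (X , X⊆ , (x , x∈X) , tight) = combine
          (match k X G (s≤s⁻¹ (≤-trans (s≤s (Subset.p⊆q⇒∣p∣≤∣q∣ X⊆)) I-i₀<k))
             (λ Y Y⊆X → hall Y (X⊆I ∘ Y⊆X)))
          (match k (I ─ X) (G ─ nbhd Q X)
             (s≤s⁻¹ (≤-trans (Subset.p∩q≢∅⇒∣p─q∣<∣p∣ I X (x , Subset.x∈p∩q⁺ (X⊆I x∈X , x∈X))) I≤k))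
             rest)
    where
    I-i₀<k : suc ∣ I - i₀ ∣ ≤ suc k
    I-i₀<k = ≤-trans (Subset.x∈p⇒∣p-x∣<∣p∣ i₀∈) I≤k

    X⊆I : X ⊆ I
    X⊆I = Subset.p─q⊆p I ⁅ i₀ ⁆ ∘ X⊆

    rest : HallCondition (I ─ X) (G ─ nbhd Q X)
    rest Y Y⊆ = +-cancelˡ-≤ ∣ X ∣ _ _ (begin
      ∣ X ∣ + ∣ Y ∣
        ≤⟨ disjoint-∪ X Y (λ x∈X x∈Y → proj₂ (x∈p─q⁻ I X (Y⊆ x∈Y)) x∈X) ⟩
      ∣ X ∪ Y ∣
        ≤⟨ hall (X ∪ Y) (λ z∈ → [ X⊆I , Subset.p─q⊆p I X ∘ Y⊆ ]′ (Subset.x∈p∪q⁻ X Y z∈)) ⟩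
      ∣ nbhd Q (X ∪ Y) ∩ G ∣
        ≤⟨ Subset.p⊆q⇒∣p∣≤∣q∣ split ⟩
      ∣ (nbhd Q X ∩ G) ∪ (nbhd Q Y ∩ (G ─ nbhd Q X)) ∣
        ≤⟨ ∣p∪q∣≤∣p∣+∣q∣ (nbhd Q X ∩ G) _ ⟩
      ∣ nbhd Q X ∩ G ∣ + ∣ nbhd Q Y ∩ (G ─ nbhd Q X) ∣
        ≤⟨ +-monoˡ-≤ _ tight ⟩
      ∣ X ∣ + ∣ nbhd Q Y ∩ (G ─ nbhd Q X) ∣ ∎)
      where
      open ≤-Reasoning
      split : nbhd Q (X ∪ Y) ∩ G ⊆ (nbhd Q X ∩ G) ∪ (nbhd Q Y ∩ (G ─ nbhd Q X))
      split {c} c∈ with c∈N , c∈G ← Subset.x∈p∩q⁻ (nbhd Q (X ∪ Y)) G c∈ | c Subset.∈? nbhd Q X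
      ... | yes c∈NX = Subset.x∈p∪q⁺ (inj₁ (Subset.x∈p∩q⁺ (c∈NX , c∈G)))
      ... | no  c∉NX with i , i∈ , c∈Qi ← ∈-nbhd⁻ Q (X ∪ Y) c∈N with Subset.x∈p∪q⁻ X Y i∈
      ...   | inj₁ i∈X = contradiction (∈-nbhd⁺ Q X i∈X c∈Qi) c∉NX
      ...   | inj₂ i∈Y = Subset.x∈p∪q⁺ {p = nbhd Q X ∩ G} (inj₂ (Subset.x∈p∩q⁺
                (∈-nbhd⁺ Q Y i∈Y c∈Qi , Subset.x∈p∧x∉q⇒x∈p─q c∈G c∉NX)))

    combine : Matching X G → Matching (I ─ X) (G ─ nbhd Q X) → Matching I G
    combine (μ , μ-ok , μ-inj) (ν , ν-ok , ν-inj) = ρ , ρ-ok , ρ-inj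
      where
      ρ : ∀ i → i ∈ I → Fin N
      ρ i i∈ with i Subset.∈? X
      ... | yes i∈X = μ i i∈X
      ... | no  i∉X = ν i (Subset.x∈p∧x∉q⇒x∈p─q i∈ i∉X)

      ρ-ok : ∀ i i∈ → ρ i i∈ ∈ lookup Q i × ρ i i∈ ∈ G
      ρ-ok i i∈ with i Subset.∈? X
      ... | yes i∈X = μ-ok i i∈X
      ... | no  i∉X with c∈Q , c∈G ← ν-ok i (Subset.x∈p∧x∉q⇒x∈p─q i∈ i∉X) =
        c∈Q , Subset.p─q⊆p G (nbhd Q X) c∈G

      clash : ∀ i j i∈X j∈ → μ i i∈X ≢ ν j j∈
      clash i j i∈X j∈ eq = proj₂ (x∈p─q⁻ G (nbhd Q X) (proj₂ (ν-ok j j∈)))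
        (subst (_∈ nbhd Q X) eq (∈-nbhd⁺ Q X i∈X (proj₁ (μ-ok i i∈X))))

      ρ-inj : ∀ i j i∈ j∈ → ρ i i∈ ≡ ρ j j∈ → i ≡ j
      ρ-inj i j i∈ j∈ eq with i Subset.∈? X | j Subset.∈? X
      ... | yes i∈X | yes j∈X = μ-inj i j i∈X j∈X eq
      ... | yes i∈X | no  j∉X = contradiction eq (clash i j i∈X _)
      ... | no  i∉X | yes j∈X = contradiction (sym eq) (clash j i j∈X _)
      ... | no  i∉X | no  j∉X = ν-inj i j _ _ eq

  -- No nonempty set of the other rows is tight, so each has a colour to spare and `i₀` may take any
  -- colour of its own.
  ... | no none = extend (match k (I - i₀) (G - c) (s≤s⁻¹ (≤-trans (Subset.x∈p⇒∣p-x∣<∣p∣ i₀∈) I≤k)) rest)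
    where
    colour : ∃[ c ] (c ∈ nbhd Q ⁅ i₀ ⁆ ∩ G)
    colour = size-positive⁻ (nbhd Q ⁅ i₀ ⁆ ∩ G)
      (≤-trans (≤-reflexive (sym (Subset.∣⁅x⁆∣≡1 i₀)))
               (hall ⁅ i₀ ⁆ λ x∈ → subst (_∈ I) (sym (Subset.x∈⁅y⁆⇒x≡y i₀ x∈)) i₀∈))
    c = proj₁ colour

    c∈Q : c ∈ lookup Q i₀
    c∈Q with i , i∈ , c∈ ← ∈-nbhd⁻ Q ⁅ i₀ ⁆ (Subset.p∩q⊆p (nbhd Q ⁅ i₀ ⁆) G (proj₂ colour))
      = subst (λ i → c ∈ lookup Q i) (Subset.x∈⁅y⁆⇒x≡y i₀ i∈) c∈

    c∈G : c ∈ G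
    c∈G = Subset.p∩q⊆q (nbhd Q ⁅ i₀ ⁆) G (proj₂ colour)

    rest : HallCondition (I - i₀) (G - c)
    rest X X⊆ with Subset.nonempty? X
    ... | no empty = ≤-trans (≤-reflexive (trans (cong ∣_∣ (Subset.Empty-unique empty)) (Subset.∣⊥∣≡0 m))) z≤n
    ... | yes nonempty = s≤s⁻¹ (begin
      suc ∣ X ∣                       ≤⟨ ≰⇒> (λ tight → none (X , X⊆ , nonempty , tight)) ⟩
      ∣ nbhd Q X ∩ G ∣                ≤⟨ ∣p∣≤1+∣p-x∣ (nbhd Q X ∩ G) c ⟩
      suc ∣ (nbhd Q X ∩ G) - c ∣      ≤⟨ s≤s (Subset.p⊆q⇒∣p∣≤∣q∣ shift) ⟩
      suc ∣ nbhd Q X ∩ (G - c) ∣      ∎)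
      where
      open ≤-Reasoning
      shift : (nbhd Q X ∩ G) - c ⊆ nbhd Q X ∩ (G - c)
      shift x∈ with x∈NG , x∉c ← x∈p─q⁻ (nbhd Q X ∩ G) ⁅ c ⁆ x∈
               with x∈N , x∈G ← Subset.x∈p∩q⁻ (nbhd Q X) G x∈NG
        = Subset.x∈p∩q⁺ (x∈N , Subset.x∈p∧x∉q⇒x∈p─q x∈G x∉c)

    extend : Matching (I - i₀) (G - c) → Matching I G
    extend (μ , μ-ok , μ-inj) = ρ , ρ-ok , ρ-inj
      where
      ρ : ∀ i → i ∈ I → Fin N
      ρ i i∈ with i Fin.≟ i₀
      ... | yes _   = c
      ... | no i≢i₀ = μ i (Subset.x∈p∧x≢y⇒x∈p-y i∈ i≢i₀)

      ρ-ok : ∀ i i∈ → ρ i i∈ ∈ lookup Q i × ρ i i∈ ∈ G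
      ρ-ok i i∈ with i Fin.≟ i₀
      ... | yes refl = c∈Q , c∈G
      ... | no i≢i₀ with x∈Q , x∈G ← μ-ok i (Subset.x∈p∧x≢y⇒x∈p-y i∈ i≢i₀) =
        x∈Q , Subset.p─q⊆p G ⁅ c ⁆ x∈G

      fresh : ∀ i i∈ → μ i i∈ ≢ c
      fresh i i∈ eq = proj₂ (x∈p─q⁻ G ⁅ c ⁆ (proj₂ (μ-ok i i∈)))
        (subst (_∈ ⁅ c ⁆) (sym eq) (Subset.x∈⁅x⁆ c))

      ρ-inj : ∀ i j i∈ j∈ → ρ i i∈ ≡ ρ j j∈ → i ≡ j
      ρ-inj i j i∈ j∈ eq with i Fin.≟ i₀ | j Fin.≟ i₀
      ... | yes refl | yes refl = refl
      ... | yes refl | no  _    = contradiction (sym eq) (fresh j _)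
      ... | no  _    | yes refl = contradiction eq (fresh i _)
      ... | no  _    | no  _    = μ-inj i j _ _ eq

hall : (Q : Vec (Subset N) m) → (∀ X → ∣ X ∣ ≤ ∣ nbhd Q X ∣) →
       Σ (Fin m → Fin N) λ μ → (∀ i → μ i ∈ lookup Q i) × (∀ i j → μ i ≡ μ j → i ≡ j)
hall {m = m} Q condition
  with μ , μ-ok , μ-inj ← Hall.match Q m ⊤ ⊤ (Subset.∣p∣≤n ⊤)
         (λ X _ → ≤-trans (condition X) (≤-reflexive (sym (cong ∣_∣ (Subset.∩-identityʳ (nbhd Q X))))))
  = (λ i → μ i Subset.∈⊤) , (λ i → proj₁ (μ-ok i Subset.∈⊤)) ,
    λ i j → μ-inj i j Subset.∈⊤ Subset.∈⊤

∣p++q∣≡∣p∣+∣q∣ : ∀ (p : Subset m) (q : Subset n) → ∣ p Vec.++ q ∣ ≡ ∣ p ∣ + ∣ q ∣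
∣p++q∣≡∣p∣+∣q∣ []            q = refl
∣p++q∣≡∣p∣+∣q∣ (inside ∷ p)  q = cong suc (∣p++q∣≡∣p∣+∣q∣ p q)
∣p++q∣≡∣p∣+∣q∣ (outside ∷ p) q = ∣p++q∣≡∣p∣+∣q∣ p q

-- The defect d is absorbed by d dummy colours that are available everywhere.
hall-defect : ∀ d (Q : Vec (Subset N) m) → (∀ X → ∣ X ∣ ≤ ∣ nbhd Q X ∣ + d) →
  Σ (Fin m → Fin (N + d)) λ μ →
    (∀ i {c} → Fin.splitAt N (μ i) ≡ inj₁ c → c ∈ lookup Q i) × (∀ i j → μ i ≡ μ j → i ≡ j)
hall-defect {N} {m} d Q condition = μ , real , proj₂ (proj₂ matching)
  where
  Q⁺ : Vec (Subset (N + d)) m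
  Q⁺ = Vec.map (Vec._++ ⊤) Q

  condition⁺ : ∀ X → ∣ X ∣ ≤ ∣ nbhd Q⁺ X ∣
  condition⁺ X with Subset.nonempty? X
  ... | no empty = ≤-trans (≤-reflexive (trans (cong ∣_∣ (Subset.Empty-unique empty)) (Subset.∣⊥∣≡0 m))) z≤n
  ... | yes (i₀ , i₀∈) = begin
    ∣ X ∣                          ≤⟨ condition X ⟩
    ∣ nbhd Q X ∣ + d               ≡⟨ cong (∣ nbhd Q X ∣ +_) (sym (Subset.∣⊤∣≡n d)) ⟩
    ∣ nbhd Q X ∣ + ∣ ⊤ {d} ∣       ≡⟨ sym (∣p++q∣≡∣p∣+∣q∣ (nbhd Q X) ⊤) ⟩
    ∣ nbhd Q X Vec.++ ⊤ {d} ∣      ≤⟨ Subset.p⊆q⇒∣p∣≤∣q∣ (λ {c} → embed c) ⟩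
    ∣ nbhd Q⁺ X ∣                  ∎
    where
    open ≤-Reasoning
    ∈⁺ : ∀ i c → lookup (lookup Q i Vec.++ ⊤ {d}) c ≡ inside → c ∈ lookup Q⁺ i
    ∈⁺ i c eq = Vec.lookup⇒[]= c _ (trans (cong (λ p → lookup p c) (Vec.lookup-map i (Vec._++ ⊤) Q)) eq)

    embed : ∀ c → c ∈ nbhd Q X Vec.++ ⊤ {d} → c ∈ nbhd Q⁺ X
    embed c c∈ with Fin.splitAt N c in eq | trans (sym (Vec.lookup-splitAt N (nbhd Q X) (⊤ {d}) c)) (Vec.[]=⇒lookup c∈)
    ... | inj₁ c′ | in-nbhd with i , i∈ , c′∈ ← ∈-nbhd⁻ Q X (Vec.lookup⇒[]= c′ _ in-nbhd) =
      ∈-nbhd⁺ Q⁺ X i∈ (∈⁺ i c (trans (Vec.lookup-splitAt N (lookup Q i) ⊤ c)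
        (trans (cong [ lookup (lookup Q i) , lookup ⊤ ]′ eq) (Vec.[]=⇒lookup c′∈))))
    ... | inj₂ c′ | _ = ∈-nbhd⁺ Q⁺ X i₀∈ (∈⁺ i₀ c (trans (Vec.lookup-splitAt N (lookup Q i₀) ⊤ c)
        (trans (cong [ lookup (lookup Q i₀) , lookup ⊤ ]′ eq) (Vec.lookup-replicate c′ inside))))

  matching = hall Q⁺ condition⁺
  μ = proj₁ matching

  real : ∀ i {c} → Fin.splitAt N (μ i) ≡ inj₁ c → c ∈ lookup Q i
  real i {c} eq = Vec.lookup⇒[]= c _ (trans (sym (cong [ lookup (lookup Q i) , lookup (⊤ {d}) ]′ eq))
    (trans (sym (Vec.lookup-splitAt N (lookup Q i) ⊤ (μ i)))
    (trans (cong (λ p → lookup p (μ i)) (sym (Vec.lookup-map i (Vec._++ ⊤) Q)))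
           (Vec.[]=⇒lookup (proj₁ (proj₂ matching) i)))))

-- Tuples of independent random sets

tupleSum : List 𝐴 → ∀ m → (Vec 𝐴 m → ℕ) → ℕ
tupleSum K zero    f = f []
tupleSum K (suc m) f = ∑ K λ a → tupleSum K m (f ∘ (a ∷_))

tupleSum-mono : ∀ (K : List 𝐴) m {f g : Vec 𝐴 m → ℕ} → (∀ v → f v ≤ g v) → tupleSum K m f ≤ tupleSum K m g
tupleSum-mono K zero    f≤g = f≤g []
tupleSum-mono K (suc m) f≤g = ∑-mono K λ a _ → tupleSum-mono K m (f≤g ∘ (a ∷_))

tupleSum-∑ : ∀ (K : List 𝐴) m (xs : List 𝐵) (f : 𝐵 → Vec 𝐴 m → ℕ) →
             tupleSum K m (λ v → ∑ xs λ x → f x v) ≡ ∑ xs λ x → tupleSum K m (f x)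
tupleSum-∑ K zero    xs f = refl
tupleSum-∑ K (suc m) xs f =
  trans (∑-cong K λ a → tupleSum-∑ K m xs (λ x → f x ∘ (a ∷_))) (∑-swap K xs _)

tupleSum-* : ∀ (K : List 𝐴) m k (f : Vec 𝐴 m → ℕ) → tupleSum K m (λ v → k * f v) ≡ k * tupleSum K m f
tupleSum-* K zero    k f = refl
tupleSum-* K (suc m) k f = trans (∑-cong K λ a → tupleSum-* K m k (f ∘ (a ∷_))) (∑-*ˡ K k _)

-- Distinct coordinates are resampled independently, and replacing each `L u` by the larger common
-- list `K` only adds terms. This is how the balance condition is forgotten at the heads.
resample-tuple : ∀ (L : Fin n → List 𝐴) (K : List 𝐴) → (∀ u g → ∑ (L u) g ≤ ∑ K g) →
  ∀ (us : Vec (Fin n) m) → Unique (Vec.toList us) → ∀ f ω →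
  Resampling.resample L (Vec.toList us) (λ ω → f (Vec.map (lookup ω) us)) ω ≤ tupleSum K m f
resample-tuple L K L≤K []       us!          f ω = ≤-refl
resample-tuple {m = suc m} L K L≤K (u ∷ us) (u∉ ∷ us!) f ω = begin
  ∑ (L u) (λ a → resample (Vec.toList us) (λ ω → f (lookup ω u ∷ Vec.map (lookup ω) us)) (ω [ u ]≔ a))
    ≡⟨ ∑-cong (L u) (λ a → resample-cong-off (Vec.toList us) u (λ u∈ → All.lookup u∉ u∈ refl) (ω [ u ]≔ a)
         λ ω′ eq → cong (λ x → f (x ∷ Vec.map (lookup ω′) us)) (trans eq (Vec.lookup∘updateAt u ω))) ⟩
  ∑ (L u) (λ a → resample (Vec.toList us) (λ ω → f (a ∷ Vec.map (lookup ω) us)) (ω [ u ]≔ a))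
    ≤⟨ ∑-mono (L u) (λ a _ → resample-tuple L K L≤K us us! (f ∘ (a ∷_)) (ω [ u ]≔ a)) ⟩
  ∑ (L u) (λ a → tupleSum K m (f ∘ (a ∷_)))
    ≤⟨ L≤K u _ ⟩
  ∑ K (λ a → tupleSum K m (f ∘ (a ∷_))) ∎
  where
  open Resampling L
  open ≤-Reasoning

missAll : Vec (Subset N) m → Vec (Subset N) m → Bool
missAll []       []       = true
missAll (Z ∷ Zs) (S ∷ Ss) = miss Z S ∧ missAll Zs Ss

missAll-complete : ∀ (Zs Ss : Vec (Subset N) m) →
  (∀ i {c} → c ∈ lookup Zs i → c ∉ lookup Ss i) → missAll Zs Ss ≡ true
missAll-complete []       []       disj = refl
missAll-complete (Z ∷ Zs) (S ∷ Ss) disj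
  rewrite miss-complete Z S (disj zero) = missAll-complete Zs Ss (disj ∘ suc)

size : Vec (Subset N) m → ℕ
size []       = 0
size (Z ∷ Zs) = ∣ Z ∣ + size Zs

⟦∧⟧ : ∀ x y → ⟦ x ∧ y ⟧ ≡ ⟦ x ⟧ * ⟦ y ⟧
⟦∧⟧ true  y = sym (+-identityʳ ⟦ y ⟧)
⟦∧⟧ false y = refl

missAll-count : ∀ b (Zs : Vec (Subset N) m) → let open RandomSubset b in
  tupleSum (subsets N) m (λ Ss → ⟦ missAll Zs Ss ⟧) * suc b ^ size Zs
    ≡ b ^ size Zs * (suc b ^ N) ^ m
missAll-count b []                = refl
missAll-count {N} {suc m} b (Z ∷ Zs) = begin
  ∑ (subsets N) (λ S → tupleSum (subsets N) m (λ Ss → ⟦ miss Z S ∧ missAll Zs Ss ⟧)) * B ^ (∣ Z ∣ + size Zs)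
    ≡⟨ cong₂ _*_ factor (^-distribˡ-+-* B ∣ Z ∣ (size Zs)) ⟩
  μ * τ * (B ^ ∣ Z ∣ * B ^ size Zs)
    ≡⟨ interchange μ τ _ _ ⟩
  μ * B ^ ∣ Z ∣ * (τ * B ^ size Zs)
    ≡⟨ cong₂ _*_ (miss-count Z) (missAll-count b Zs) ⟩
  b ^ ∣ Z ∣ * B ^ N * (b ^ size Zs * (B ^ N) ^ m)
    ≡⟨ interchange (b ^ ∣ Z ∣) (B ^ N) _ _ ⟩
  b ^ ∣ Z ∣ * b ^ size Zs * (B ^ N * (B ^ N) ^ m)
    ≡⟨ cong (_* (B ^ N * (B ^ N) ^ m)) (sym (^-distribˡ-+-* b ∣ Z ∣ (size Zs))) ⟩
  b ^ (∣ Z ∣ + size Zs) * (B ^ N * (B ^ N) ^ m) ∎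
  where
  open RandomSubset b
  open ≡-Reasoning
  B = suc b
  μ = ∑ (subsets N) (λ S → ⟦ miss Z S ⟧)
  τ = tupleSum (subsets N) m (λ Ss → ⟦ missAll Zs Ss ⟧)
  interchange : ∀ w x y z → w * x * (y * z) ≡ w * y * (x * z)
  interchange = solve-∀
  factor : ∑ (subsets N) (λ S → tupleSum (subsets N) m (λ Ss → ⟦ miss Z S ∧ missAll Zs Ss ⟧)) ≡ μ * τ
  factor = trans
    (∑-cong (subsets N) λ S → trans
      (≤-antisym (tupleSum-mono (subsets N) m λ Ss → ≤-reflexive (⟦∧⟧ (miss Z S) (missAll Zs Ss)))
                 (tupleSum-mono (subsets N) m λ Ss → ≤-reflexive (sym (⟦∧⟧ (miss Z S) (missAll Zs Ss)))))
      (tupleSum-* (subsets N) m ⟦ miss Z S ⟧ _))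
    (∑-*ʳ (subsets N) τ _)

-- Subsets of a given size

choose : ∀ (n k : ℕ) → List (Subset n)
choose n       zero    = ⊥ ∷ []
choose zero    (suc k) = []
choose (suc n) (suc k) = List.map (inside ∷_) (choose n k) ++ List.map (outside ∷_) (choose n (suc k))

choose-size : ∀ n k {J} → J ∈ˡ choose n k → ∣ J ∣ ≡ k
choose-size n       zero    (here refl) = Subset.∣⊥∣≡0 n
choose-size (suc n) (suc k) J∈ with Mem.∈-++⁻ (List.map (inside ∷_) (choose n k)) J∈
... | inj₁ J∈ with _ , J′∈ , refl ← Mem.∈-map⁻ (inside ∷_) J∈  = cong suc (choose-size n k J′∈)
... | inj₂ J∈ with _ , J′∈ , refl ← Mem.∈-map⁻ (outside ∷_) J∈ = choose-size n (suc k) J′∈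

choose-below : ∀ {n} k (p : Subset n) → k ≤ ∣ p ∣ → ∃[ J ] (J ∈ˡ choose n k × J ⊆ p)
choose-below zero    p             k≤ = ⊥ , here refl , Subset.⊥⊆
choose-below {suc n} (suc k) (inside ∷ p) k≤ with J , J∈ , J⊆ ← choose-below k p (s≤s⁻¹ k≤) =
  inside ∷ J , Mem.∈-++⁺ˡ (Mem.∈-map⁺ (inside ∷_) J∈) , Subset.in⊆in J⊆
choose-below {suc n} (suc k) (outside ∷ p) k≤ with J , J∈ , J⊆ ← choose-below (suc k) p k≤ =
  outside ∷ J , Mem.∈-++⁺ʳ (List.map (inside ∷_) (choose n k)) (Mem.∈-map⁺ (outside ∷_) J∈) , Subset.out⊆ J⊆

choose-self : ∀ {n} (p : Subset n) → p ∈ˡ choose n ∣ p ∣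
choose-self []            = here refl
choose-self {suc n} (inside ∷ p) = Mem.∈-++⁺ˡ (Mem.∈-map⁺ (inside ∷_) (choose-self p))
choose-self {suc n} (outside ∷ p) with ∣ p ∣ in eq | choose-self p
... | zero  | here refl = here refl
... | suc k | p∈        = Mem.∈-++⁺ʳ (List.map (inside ∷_) (choose n k)) (Mem.∈-map⁺ (outside ∷_) p∈)

length-choose : ∀ n k → length (choose (suc n) (suc k)) ≡ length (choose n k) + length (choose n (suc k))
length-choose n k = trans (List.length-++ (List.map (inside ∷_) (choose n k)))
  (cong₂ _+_ (List.length-map (inside ∷_) (choose n k)) (List.length-map (outside ∷_) (choose n (suc k))))

choose≤^ : ∀ n k → length (choose n k) ≤ n ^ k
choose≤^ n       zero    = ≤-refl
choose≤^ zero    (suc k) = z≤n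
choose≤^ (suc n) (suc k) = begin
  length (choose (suc n) (suc k))                  ≡⟨ length-choose n k ⟩
  length (choose n k) + length (choose n (suc k))  ≤⟨ +-mono-≤ (choose≤^ n k) (choose≤^ n (suc k)) ⟩
  n ^ k + n * n ^ k                                ≤⟨ *-monoʳ-≤ (suc n) (^-monoˡ-≤ k (n≤1+n n)) ⟩
  suc n * suc n ^ k                                ∎
  where open ≤-Reasoning

choose-empty : ∀ n k → n < k → length (choose n k) ≡ 0
choose-empty zero    (suc k) n<k = refl
choose-empty (suc n) (suc k) n<k = trans (length-choose n k)
  (cong₂ _+_ (choose-empty n k (s≤s⁻¹ n<k)) (choose-empty n (suc k) (≤-trans (n≤1+n _) n<k)))

1≤n^n : ∀ n → 1 ≤ n ^ n
1≤n^n zero    = ≤-refl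
1≤n^n (suc n) = m^n>0 (suc n) (suc n)

-- A subset is determined by the n - k elements that it leaves out. The union bound uses this
-- estimate or `choose≤^`, according to which exponent is small.
choose≤^∸ : ∀ n k → length (choose n k) ≤ n ^ (n ∸ k)
choose≤^∸ n       zero    = 1≤n^n n
choose≤^∸ zero    (suc k) = z≤n
choose≤^∸ (suc n) (suc k) with k <? n
... | yes k<n = begin
  length (choose (suc n) (suc k))                  ≡⟨ length-choose n k ⟩
  length (choose n k) + length (choose n (suc k))  ≤⟨ +-mono-≤ (choose≤^∸ n k) (choose≤^∸ n (suc k)) ⟩
  n ^ (n ∸ k) + n ^ e                              ≡⟨ cong (λ i → n ^ i + n ^ e) n∸k ⟩
  n * n ^ e + n ^ e                                ≡⟨ +-comm (n * n ^ e) (n ^ e) ⟩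
  suc n * n ^ e                                    ≤⟨ *-monoʳ-≤ (suc n) (^-monoˡ-≤ e (n≤1+n n)) ⟩
  suc n * suc n ^ e                                ≡⟨ cong (suc n ^_) (sym n∸k) ⟩
  suc n ^ (n ∸ k)                                  ∎
  where
  open ≤-Reasoning
  e = n ∸ suc k
  n∸k : n ∸ k ≡ suc e
  n∸k = +-∸-assoc 1 k<n
... | no k≮n = begin
  length (choose (suc n) (suc k))                  ≡⟨ length-choose n k ⟩
  length (choose n k) + length (choose n (suc k))  ≡⟨ cong (length (choose n k) +_) (choose-empty n (suc k) (s≤s (≮⇒≥ k≮n))) ⟩
  length (choose n k) + 0                          ≡⟨ +-identityʳ _ ⟩
  length (choose n k)                              ≤⟨ choose≤^∸ n k ⟩
  n ^ (n ∸ k)                                      ≡⟨ cong (n ^_) (m≤n⇒m∸n≡0 (≮⇒≥ k≮n)) ⟩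
  1                                                ≤⟨ m^n>0 (suc n) (n ∸ k) ⟩
  suc n ^ (n ∸ k)                                  ∎
  where open ≤-Reasoning

choose-bound : ∀ {n k z a} → n ≤ suc a → k ≤ z ⊎ n ∸ k ≤ z → length (choose n k) ≤ suc a ^ z
choose-bound {n} {k} {z} {a} n≤a (inj₁ k≤z) =
  ≤-trans (choose≤^ n k) (≤-trans (^-monoˡ-≤ k n≤a) (^-monoʳ-≤ (suc a) k≤z))
choose-bound {n} {k} {z} {a} n≤a (inj₂ n∸k≤z) =
  ≤-trans (choose≤^∸ n k) (≤-trans (^-monoˡ-≤ (n ∸ k) n≤a) (^-monoʳ-≤ (suc a) n∸k≤z))

-- Packing colours into bins

-- Packing items of weight at most x into bins of weight at least x/2: a heavy
-- item (≥ x/2) gets a bin of its own, numbered from the top; light items go to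
-- bin 0, which already carries load, and the remaining bins are renumbered
-- as soon as bin 0 reaches x/2.  Items left over are put in arbitrary bins.
pack : (x A load : ℕ) → Vec ℕ N → Vec ℕ N
pack x zero    load ws       = Vec.replicate _ 0
pack x (suc A) load []       = []
pack x (suc A) load (w ∷ ws) with x ≤? 2 * w
... | yes _ = A ∷ pack x A load ws
... | no  _ with x ≤? 2 * (load + w)
...   | yes _ = 0 ∷ Vec.map suc (pack x A 0 ws)
...   | no  _ = 0 ∷ pack x (suc A) (load + w) ws

binWeight : Vec ℕ N → Vec ℕ N → ℕ → ℕ
binWeight []       []       j = 0
binWeight (β ∷ βs) (w ∷ ws) j = (if β ≡ᵇ j then w else 0) + binWeight βs ws j

carried : ℕ → ℕ → ℕ
carried load zero    = load
carried load (suc j) = 0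

carried-0 : ∀ j → carried 0 j ≡ 0
carried-0 zero    = refl
carried-0 (suc j) = refl

≡ᵇ-refl : ∀ j → (j ≡ᵇ j) ≡ true
≡ᵇ-refl zero    = refl
≡ᵇ-refl (suc j) = ≡ᵇ-refl j

binWeight-shift : ∀ (βs ws : Vec ℕ N) j → binWeight (Vec.map suc βs) ws (suc j) ≡ binWeight βs ws j
binWeight-shift []       []       j = refl
binWeight-shift (β ∷ βs) (w ∷ ws) j = cong ((if β ≡ᵇ j then w else 0) +_) (binWeight-shift βs ws j)

-- Each finished bin uses up at most `x` of the total weight: a heavy item weighs at most `x`, and a
-- bin closed by a light item held less than x/2 and gained less than x/2. So what remains always
-- suffices for the remaining bins, and the items cannot run out while the open bin is below x/2.
pack-half-full : ∀ x A load (ws : Vec ℕ N) → (∀ c → lookup ws c ≤ x) → 2 * load < x →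
  A * x ≤ load + Vec.sum ws → ∀ j → j < A →
  x ≤ 2 * (carried load j + binWeight (pack x A load ws) ws j)
pack-half-full x (suc A) load [] ws≤x open-bin enough j j<A = contradiction open-bin (≤⇒≯ (begin
  x             ≤⟨ m≤m+n x (A * x) ⟩
  suc A * x     ≤⟨ enough ⟩
  load + 0       ≤⟨ +-monoʳ-≤ load z≤n ⟩
  2 * load       ∎))
  where open ≤-Reasoning
pack-half-full x (suc A) load (w ∷ ws) ws≤x open-bin enough j j<A with x ≤? 2 * w
... | yes heavy = heavy-case (m≤n⇒m<n∨m≡n (s≤s⁻¹ j<A))
  where
  open ≤-Reasoning
  W = binWeight (pack x A load ws) ws

  remaining : A * x ≤ load + Vec.sum ws
  remaining = +-cancelˡ-≤ w _ _ (begin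
    w + A * x                    ≤⟨ +-monoˡ-≤ (A * x) (ws≤x zero) ⟩
    x + A * x                    ≤⟨ enough ⟩
    load + (w + Vec.sum ws)       ≡⟨ swap load w (Vec.sum ws) ⟩
    w + (load + Vec.sum ws)       ∎)
    where
    swap : ∀ x y z → x + (y + z) ≡ y + (x + z)
    swap = solve-∀

  heavy-case : j < A ⊎ j ≡ A → x ≤ 2 * (carried load j + ((if A ≡ᵇ j then w else 0) + W j))
  heavy-case (inj₁ j<A) = ≤-trans
    (pack-half-full x A load ws (ws≤x ∘ suc) open-bin remaining j j<A)
    (*-monoʳ-≤ 2 (+-monoʳ-≤ (carried load j) (m≤n+m (W j) _)))
  heavy-case (inj₂ refl) rewrite ≡ᵇ-refl j = ≤-trans heavy
    (*-monoʳ-≤ 2 (≤-trans (m≤m+n w (W j)) (m≤n+m _ (carried load j))))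
... | no light with x ≤? 2 * (load + w)
...   | no still-open = still j j<A
  where
  open ≤-Reasoning
  βs = pack x (suc A) (load + w) ws
  rec : ∀ j → j < suc A → x ≤ 2 * (carried (load + w) j + binWeight βs ws j)
  rec = pack-half-full x (suc A) (load + w) ws (ws≤x ∘ suc) (≰⇒> still-open)
          (≤-trans enough (≤-reflexive (sym (+-assoc load w _))))
  still : ∀ j → j < suc A → x ≤ 2 * (carried load j + ((if 0 ≡ᵇ j then w else 0) + binWeight βs ws j))
  still zero    j<A = ≤-trans (rec zero j<A) (≤-reflexive (cong (2 *_) (+-assoc load w _)))
  still (suc j) j<A = rec (suc j) j<A
...   | yes full = closed j j<A
  where
  open ≤-Reasoning
  βs = pack x A 0 ws

  load+w≤x : load + w ≤ x
  load+w≤x = *-cancelˡ-≤ 2 (begin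
    2 * (load + w)      ≡⟨ *-distribˡ-+ 2 load w ⟩
    2 * load + 2 * w    ≤⟨ +-mono-≤ (<⇒≤ open-bin) (<⇒≤ (≰⇒> light)) ⟩
    x + x              ≡⟨ cong (x +_) (sym (+-identityʳ x)) ⟩
    2 * x              ∎)

  remaining : A * x ≤ 0 + Vec.sum ws
  remaining = +-cancelˡ-≤ (load + w) _ _ (begin
    load + w + A * x              ≤⟨ +-monoˡ-≤ (A * x) load+w≤x ⟩
    x + A * x                    ≤⟨ enough ⟩
    load + (w + Vec.sum ws)       ≡⟨ sym (+-assoc load w _) ⟩
    load + w + Vec.sum ws         ∎)

  closed : ∀ j → j < suc A →
    x ≤ 2 * (carried load j + ((if 0 ≡ᵇ j then w else 0) + binWeight (Vec.map suc βs) ws j))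
  closed zero    j<A = ≤-trans full (*-monoʳ-≤ 2 (+-monoʳ-≤ load (m≤m+n w _)))
  closed (suc j) j<A = ≤-trans
    (pack-half-full x A 0 ws (ws≤x ∘ suc) (≤-<-trans z≤n open-bin) remaining j (s≤s⁻¹ j<A))
    (≤-reflexive (cong (2 *_) (cong₂ _+_ (carried-0 j) (sym (binWeight-shift βs ws j)))))

-- Sets of bins, unseen bins and their weights

member : Subset n → ℕ → Bool
member []      j       = false
member (b ∷ J) zero    = b
member (b ∷ J) (suc j) = member J j

clear : Subset n → ℕ → Subset n
clear []      j       = []
clear (b ∷ J) zero    = outside ∷ J
clear (b ∷ J) (suc j) = b ∷ clear J j

clear-size : ∀ (J : Subset n) j → ∣ J ∣ ≤ suc ∣ clear J j ∣
clear-size []            j       = z≤n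
clear-size (inside ∷ J)  zero    = ≤-refl
clear-size (outside ∷ J) zero    = n≤1+n _
clear-size (inside ∷ J)  (suc j) = s≤s (clear-size J j)
clear-size (outside ∷ J) (suc j) = clear-size J j

member-clear : ∀ (J : Subset n) j → member (clear J j) j ≡ false
member-clear []      j       = refl
member-clear (b ∷ J) zero    = refl
member-clear (b ∷ J) (suc j) = member-clear J j

member-clear-⊆ : ∀ (J : Subset n) i j → member (clear J i) j ≡ true → member J j ≡ true
member-clear-⊆ (b ∷ J) zero    (suc j) eq = eq
member-clear-⊆ (b ∷ J) (suc i) zero    eq = eq
member-clear-⊆ (b ∷ J) (suc i) (suc j) eq = member-clear-⊆ J i j eq

member-⊆ : ∀ {I J : Subset n} → I ⊆ J → ∀ j → member I j ≡ true → member J j ≡ true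
member-⊆ {I = inside ∷ I} {b ∷ J} I⊆J zero    eq with Vec.here ← I⊆J Vec.here = refl
member-⊆ {I = _ ∷ I}      {_ ∷ J} I⊆J (suc j) eq = member-⊆ (Subset.drop-∷-⊆ I⊆J) j eq

freeBins : ∀ A → Vec ℕ N → Subset N → Subset A
freeBins A []       []            = ⊤
freeBins A (β ∷ βs) (inside ∷ H)  = clear (freeBins A βs H) β
freeBins A (β ∷ βs) (outside ∷ H) = freeBins A βs H

-- Each colour of `H` lies in one bin and so spoils at most one.
freeBins-size : ∀ A (βs : Vec ℕ N) H → A ≤ ∣ freeBins A βs H ∣ + ∣ H ∣
freeBins-size A []       []            = ≤-reflexive (sym (trans (+-identityʳ _) (Subset.∣⊤∣≡n A)))
freeBins-size A (β ∷ βs) (inside ∷ H)  = begin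
  A                                           ≤⟨ freeBins-size A βs H ⟩
  ∣ freeBins A βs H ∣ + ∣ H ∣                 ≤⟨ +-monoˡ-≤ ∣ H ∣ (clear-size (freeBins A βs H) β) ⟩
  suc ∣ clear (freeBins A βs H) β ∣ + ∣ H ∣   ≡⟨ sym (+-suc _ _) ⟩
  ∣ clear (freeBins A βs H) β ∣ + suc ∣ H ∣   ∎
  where open ≤-Reasoning
freeBins-size A (β ∷ βs) (outside ∷ H) = freeBins-size A βs H

freeBins-free : ∀ A (βs : Vec ℕ N) H {c} → c ∈ H → member (freeBins A βs H) (lookup βs c) ≡ false
freeBins-free A (β ∷ βs) (inside ∷ H)  Vec.here       = member-clear (freeBins A βs H) β
freeBins-free A (β ∷ βs) (outside ∷ H) (Vec.there c∈) = freeBins-free A βs H c∈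
freeBins-free A (β ∷ βs) (inside ∷ H) {suc c} (Vec.there c∈)
  with member (clear (freeBins A βs H) β) (lookup βs c) in eq
... | false = refl
... | true with () ← trans (sym (freeBins-free A βs H c∈))
                       (member-clear-⊆ (freeBins A βs H) β (lookup βs c) eq)

∑ᵇ : Subset n → (ℕ → ℕ) → ℕ
∑ᵇ []      f = 0
∑ᵇ (b ∷ J) f = (if b then f 0 else 0) + ∑ᵇ J (f ∘ suc)

∑ᵇ-0 : ∀ (J : Subset n) → ∑ᵇ J (λ _ → 0) ≡ 0
∑ᵇ-0 []            = refl
∑ᵇ-0 (inside ∷ J)  = ∑ᵇ-0 J
∑ᵇ-0 (outside ∷ J) = ∑ᵇ-0 J

∑ᵇ-+ : ∀ (J : Subset n) f g → ∑ᵇ J (λ j → f j + g j) ≡ ∑ᵇ J f + ∑ᵇ J g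
∑ᵇ-+ []            f g = refl
∑ᵇ-+ (inside ∷ J)  f g = trans (cong (f 0 + g 0 +_) (∑ᵇ-+ J _ _)) (+-interchange (f 0) (g 0) _ _)
∑ᵇ-+ (outside ∷ J) f g = ∑ᵇ-+ J _ _

∑ᵇ-single : ∀ (J : Subset n) β w → ∑ᵇ J (λ j → if β ≡ᵇ j then w else 0) ≡ (if member J β then w else 0)
∑ᵇ-single []            β       w = refl
∑ᵇ-single (inside ∷ J)  zero    w = trans (cong (w +_) (∑ᵇ-0 J)) (+-identityʳ w)
∑ᵇ-single (outside ∷ J) zero    w = ∑ᵇ-0 J
∑ᵇ-single (inside ∷ J)  (suc β) w = ∑ᵇ-single J β w
∑ᵇ-single (outside ∷ J) (suc β) w = ∑ᵇ-single J β w

∑ᵇ-lower : ∀ (J : Subset n) x f → (∀ j → j < n → x ≤ 2 * f j) → ∣ J ∣ * x ≤ 2 * ∑ᵇ J f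
∑ᵇ-lower []            x f x≤ = z≤n
∑ᵇ-lower (inside ∷ J)  x f x≤ = ≤-trans
  (+-mono-≤ (x≤ 0 z<s) (∑ᵇ-lower J x (f ∘ suc) λ j j< → x≤ (suc j) (s≤s j<)))
  (≤-reflexive (sym (*-distribˡ-+ 2 (f 0) _)))
∑ᵇ-lower (outside ∷ J) x f x≤ = ∑ᵇ-lower J x (f ∘ suc) λ j j< → x≤ (suc j) (s≤s j<)

dot : Subset N → Vec ℕ N → ℕ
dot []      []       = 0
dot (b ∷ p) (w ∷ ws) = (if b then w else 0) + dot p ws

dot-bins : ∀ (J : Subset n) (βs ws : Vec ℕ N) → dot (Vec.map (member J) βs) ws ≡ ∑ᵇ J (binWeight βs ws)
dot-bins J []       []       = sym (∑ᵇ-0 J)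
dot-bins J (β ∷ βs) (w ∷ ws) = sym (trans (∑ᵇ-+ J _ _)
  (cong₂ _+_ (∑ᵇ-single J β w) (sym (dot-bins J βs ws))))

add : Subset N → Vec ℕ N → Vec ℕ N
add = Vec.zipWith (λ b w → ⟦ b ⟧ + w)

multiplicity : Subset m → Vec (Subset N) m → Vec ℕ N
multiplicity []            []       = Vec.replicate _ 0
multiplicity (inside ∷ X)  (Q ∷ Qs) = add Q (multiplicity X Qs)
multiplicity (outside ∷ X) (Q ∷ Qs) = multiplicity X Qs

targets : Subset m → Vec (Subset N) m → Subset N → Vec (Subset N) m
targets X Qs p = Vec.zipWith (λ b Q → if b then Q ∩ p else ⊥) X Qs

dot-0 : ∀ (p : Subset N) → dot p (Vec.replicate N 0) ≡ 0
dot-0 []            = refl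
dot-0 (inside ∷ p)  = dot-0 p
dot-0 (outside ∷ p) = dot-0 p

dot-add : ∀ (p Q : Subset N) ws → dot p (add Q ws) ≡ ∣ Q ∩ p ∣ + dot p ws
dot-add []            []            []       = refl
dot-add (outside ∷ p) (inside ∷ Q)  (w ∷ ws) = dot-add p Q ws
dot-add (outside ∷ p) (outside ∷ Q) (w ∷ ws) = dot-add p Q ws
dot-add (inside ∷ p)  (outside ∷ Q) (w ∷ ws) =
  trans (cong (w +_) (dot-add p Q ws)) (swap w ∣ Q ∩ p ∣ (dot p ws))
  where
  swap : ∀ x y z → x + (y + z) ≡ y + (x + z)
  swap = solve-∀
dot-add (inside ∷ p)  (inside ∷ Q)  (w ∷ ws) = cong suc
  (trans (cong (w +_) (dot-add p Q ws)) (swap w ∣ Q ∩ p ∣ (dot p ws)))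
  where
  swap : ∀ x y z → x + (y + z) ≡ y + (x + z)
  swap = solve-∀

-- Both sides count the pairs of a row in `X` and a colour of `p` in its palette.
dot-multiplicity : ∀ (X : Subset m) (Qs : Vec (Subset N) m) p →
                   dot p (multiplicity X Qs) ≡ size (targets X Qs p)
dot-multiplicity []            []       p = dot-0 p
dot-multiplicity (inside ∷ X)  (Q ∷ Qs) p =
  trans (dot-add p Q _) (cong (∣ Q ∩ p ∣ +_) (dot-multiplicity X Qs p))
dot-multiplicity {N = N} (outside ∷ X) (Q ∷ Qs) p =
  trans (dot-multiplicity X Qs p) (cong (_+ size (targets X Qs p)) (sym (Subset.∣⊥∣≡0 N)))

sum-add : ∀ (Q : Subset N) ws → Vec.sum (add Q ws) ≡ ∣ Q ∣ + Vec.sum ws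
sum-add []            []       = refl
sum-add (outside ∷ Q) (w ∷ ws) = trans (cong (w +_) (sum-add Q ws)) (swap w ∣ Q ∣ (Vec.sum ws))
  where
  swap : ∀ x y z → x + (y + z) ≡ y + (x + z)
  swap = solve-∀
sum-add (inside ∷ Q)  (w ∷ ws) = cong suc (trans (cong (w +_) (sum-add Q ws)) (swap w ∣ Q ∣ (Vec.sum ws)))
  where
  swap : ∀ x y z → x + (y + z) ≡ y + (x + z)
  swap = solve-∀

sum-multiplicity : ∀ A (X : Subset m) (Qs : Vec (Subset N) m) → (∀ i → A ≤ ∣ lookup Qs i ∣) →
                   ∣ X ∣ * A ≤ Vec.sum (multiplicity X Qs)
sum-multiplicity A []            []       A≤ = z≤n
sum-multiplicity A (inside ∷ X)  (Q ∷ Qs) A≤ = ≤-trans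
  (+-mono-≤ (A≤ zero) (sum-multiplicity A X Qs (A≤ ∘ suc))) (≤-reflexive (sym (sum-add Q _)))
sum-multiplicity A (outside ∷ X) (Q ∷ Qs) A≤ = sum-multiplicity A X Qs (A≤ ∘ suc)

multiplicity-bound : ∀ (X : Subset m) (Qs : Vec (Subset N) m) c → lookup (multiplicity X Qs) c ≤ ∣ X ∣
multiplicity-bound []            []       c = ≤-reflexive (Vec.lookup-replicate c 0)
multiplicity-bound (outside ∷ X) (Q ∷ Qs) c = multiplicity-bound X Qs c
multiplicity-bound (inside ∷ X)  (Q ∷ Qs) c = ≤-trans
  (≤-reflexive (Vec.lookup-zipWith (λ b w → ⟦ b ⟧ + w) c Q (multiplicity X Qs)))
  (+-mono-≤ (⟦b⟧≤1 (lookup Q c)) (multiplicity-bound X Qs c))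
  where
  ⟦b⟧≤1 : ∀ b → ⟦ b ⟧ ≤ 1
  ⟦b⟧≤1 true  = ≤-refl
  ⟦b⟧≤1 false = z≤n

-- The items are the colours. A colour weighs as much as the number of rows of `X` that offer it,
-- which is its number of chances to be seen; hence weights are at most |X|, and palettes of at
-- least `A` colours give a total of at least A|X|, enough to fill `A` bins to half.
bins : ℕ → Subset m → Vec (Subset N) m → Vec ℕ N
bins A X Qs = pack ∣ X ∣ A 0 (multiplicity X Qs)

binTargets : ∀ {A} → Subset m → Vec (Subset N) m → Subset A → Vec (Subset N) m
binTargets {A = A} X Qs J = targets X Qs (Vec.map (member J) (bins A X Qs))

binTargets-size : ∀ {A} (X : Subset m) (Qs : Vec (Subset N) m) (J : Subset A) →
  0 < ∣ X ∣ → (∀ i → A ≤ ∣ lookup Qs i ∣) → ∣ J ∣ * ∣ X ∣ ≤ 2 * size (binTargets X Qs J)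
binTargets-size {A = A} X Qs J X>0 A≤ = begin
  ∣ J ∣ * ∣ X ∣
    ≤⟨ ∑ᵇ-lower J ∣ X ∣ (binWeight βs ws) half-full ⟩
  2 * ∑ᵇ J (binWeight βs ws)
    ≡⟨ cong (2 *_) (sym (dot-bins J βs ws)) ⟩
  2 * dot (Vec.map (member J) βs) ws
    ≡⟨ cong (2 *_) (dot-multiplicity X Qs _) ⟩
  2 * size (binTargets X Qs J) ∎
  where
  open ≤-Reasoning
  ws = multiplicity X Qs
  βs = bins A X Qs
  half-full : ∀ j → j < A → ∣ X ∣ ≤ 2 * binWeight βs ws j
  half-full j j<A = ≤-trans
    (pack-half-full ∣ X ∣ A 0 ws (multiplicity-bound X Qs) X>0
      (≤-trans (≤-reflexive (*-comm A ∣ X ∣)) (sum-multiplicity A X Qs A≤)) j j<A)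
    (≤-reflexive (cong (λ a → 2 * (a + binWeight βs ws j)) (carried-0 j)))

-- Violators of Hall's condition and their union bound

available : Vec (Subset N) m → Vec (Subset N) m → Vec (Subset N) m
available Qs Ss = Vec.zipWith _∩_ Qs Ss

Violator : ℕ → Vec (Subset N) m → Subset m → Set
Violator d Qs X = ∣ nbhd Qs X ∣ + d < ∣ X ∣

violator? : ∀ d (Qs : Vec (Subset N) m) → Dec (∃ (Violator d Qs))
violator? d Qs = Subset.anySubset? λ X → ∣ nbhd Qs X ∣ + d <? ∣ X ∣

∈-targets : ∀ (X : Subset m) (Qs : Vec (Subset N) m) p i {c} →
            c ∈ lookup (targets X Qs p) i → i ∈ X × c ∈ lookup Qs i × c ∈ p
∈-targets (inside ∷ X)  (Q ∷ Qs) p zero c∈ with c∈Q , c∈p ← Subset.x∈p∩q⁻ Q p c∈ = Vec.here , c∈Q , c∈p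
∈-targets (outside ∷ X) (Q ∷ Qs) p zero c∈ = contradiction c∈ Subset.∉⊥
∈-targets (_ ∷ X) (Q ∷ Qs) p (suc i) c∈ with i∈ , rest ← ∈-targets X Qs p i c∈ = Vec.there i∈ , rest

-- The rows of `X` see at most `e` colours, which spoil at most `e` bins; `J` consists of A - e
-- unspoilt ones, and no row of `X` sees a colour in them. Recording `J` in place of the set of seen
-- colours makes the number of cases independent of `N`.
violator-misses : ∀ A d (Qs Ss : Vec (Subset N) m) X → Violator d (available Qs Ss) X →
  ∃[ e ] (∣ X ∣ ≡ suc d + e × ∃[ J ] (J ∈ˡ choose A (A ∸ e) × missAll (binTargets X Qs J) Ss ≡ true))
violator-misses A d Qs Ss X violates =
  e , size-X , J , J∈ , missAll-complete (binTargets X Qs J) Ss avoids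
  where
  H = nbhd (available Qs Ss) X
  βs = bins A X Qs
  e = ∣ X ∣ ∸ suc d

  size-X : ∣ X ∣ ≡ suc d + e
  size-X = sym (m+[n∸m]≡n (≤-trans (s≤s (m≤n+m d ∣ H ∣)) violates))

  H≤e : ∣ H ∣ ≤ e
  H≤e = +-cancelˡ-≤ (suc d) _ _ (≤-trans (≤-reflexive (cong suc (+-comm d ∣ H ∣)))
          (≤-trans violates (≤-reflexive size-X)))

  enough-free : A ∸ e ≤ ∣ freeBins A βs H ∣
  enough-free = m≤n+o⇒m∸n≤o A e (≤-trans (freeBins-size A βs H)
    (≤-trans (+-monoʳ-≤ ∣ freeBins A βs H ∣ H≤e) (≤-reflexive (+-comm ∣ freeBins A βs H ∣ e))))

  choice = choose-below (A ∸ e) (freeBins A βs H) enough-free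
  J  = proj₁ choice
  J∈ = proj₁ (proj₂ choice)

  avoids : ∀ i {c} → c ∈ lookup (binTargets X Qs J) i → c ∉ lookup Ss i
  avoids i {c} c∈ c∈S = case trans (sym (freeBins-free A βs H c∈H))
                                   (member-⊆ (proj₂ (proj₂ choice)) (lookup βs c) c∈J) of λ ()
    where
    target = ∈-targets X Qs (Vec.map (member J) βs) i c∈
    c∈H : c ∈ H
    c∈H = ∈-nbhd⁺ (available Qs Ss) X (proj₁ target)
      (subst (c ∈_) (sym (Vec.lookup-zipWith _∩_ i Qs Ss)) (Subset.x∈p∩q⁺ (proj₁ (proj₂ target) , c∈S)))
    c∈J : member J (lookup βs c) ≡ true
    c∈J = trans (sym (Vec.lookup-map c (member J) βs)) (Vec.[]=⇒lookup (proj₂ (proj₂ target)))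

module UnionBound
  (b M R a d : ℕ) (bins-vs-density : suc a ≡ 4 * M * suc b) (large : suc a ^ 3 * 2 ^ R ≤ 2 ^ M)
  (Qs : Vec (Subset N) m) (m≤ : m ≤ suc a) (Q≥ : ∀ i → suc a ≤ ∣ lookup Qs i ∣)
  where

  open RandomSubset b
  open ≤-Reasoning

  private
    B = suc b
    A = suc a
    F = B ^ N

    P : Vec (Subset N) m → ℕ
    P Zs = tupleSum (subsets N) m λ Ss → ⟦ missAll Zs Ss ⟧

  miss-rare : ∀ Zs z → B * (M * z) ≤ size Zs → P Zs * 2 ^ (M * z) ≤ F ^ m
  miss-rare Zs z z≤ = *-cancelʳ-≤ _ _ (B ^ t) {{m^n≢0 B t}} (begin
    P Zs * 2 ^ (M * z) * B ^ t       ≡⟨ rotate (P Zs) (2 ^ (M * z)) (B ^ t) ⟩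
    2 ^ (M * z) * (P Zs * B ^ t)     ≡⟨ cong (2 ^ (M * z) *_) (missAll-count b Zs) ⟩
    2 ^ (M * z) * (b ^ t * F ^ m)    ≡⟨ sym (*-assoc (2 ^ (M * z)) _ _) ⟩
    2 ^ (M * z) * b ^ t * F ^ m      ≤⟨ *-monoˡ-≤ (F ^ m) (power-tail (n≤1+n b) z≤ {2 ^ (M * z)} {1} halvings) ⟩
    1 * B ^ t * F ^ m                ≡⟨ swap (B ^ t) (F ^ m) ⟩
    F ^ m * B ^ t                    ∎)
    where
    t = size Zs
    rotate : ∀ x y z → x * y * z ≡ y * (x * z)
    rotate = solve-∀
    swap : ∀ x y → 1 * x * y ≡ y * x
    swap = solve-∀
    halvings : 2 ^ (M * z) * b ^ (B * (M * z)) ≤ 1 * B ^ (B * (M * z))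
    halvings = begin
      2 ^ (M * z) * b ^ (B * (M * z))    ≡⟨ cong (2 ^ (M * z) *_) (sym (^-*-assoc b B (M * z))) ⟩
      2 ^ (M * z) * (b ^ B) ^ (M * z)    ≡⟨ sym (^-distribʳ-* 2 (b ^ B) (M * z)) ⟩
      (2 * b ^ B) ^ (M * z)              ≤⟨ ^-monoˡ-≤ (M * z) (double-power b) ⟩
      (B ^ B) ^ (M * z)                  ≡⟨ ^-*-assoc B B (M * z) ⟩
      B ^ (B * (M * z))                  ≡⟨ sym (*-identityˡ _) ⟩
      1 * B ^ (B * (M * z))              ∎

  -- Violators are graded by the excess `e` of their size over d + 1, the least size a violator can
  -- have.
  layer : ℕ → ℕ
  layer e = ∑ (choose m (suc d + e)) λ X → ∑ (choose A (A ∸ e)) λ J → P (binTargets X Qs J)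

  module _ (e : ℕ) (e< : e < m ∸ d) where

    private
      x = suc d + e
      y = A ∸ e

      e+d<m : suc (e + d) ≤ m
      e+d<m = begin
        suc e + d        ≤⟨ +-monoˡ-≤ d e< ⟩
        m ∸ d + d        ≡⟨ m∸n+n≡m (<⇒≤ (m∸n≢0⇒n<m {m} {d} λ eq → n≮0 (subst (e <_) eq e<))) ⟩
        m                ∎

      e≤A : e ≤ A
      e≤A = ≤-trans (≤-trans (m≤m+n e d) (n≤1+n _)) (≤-trans e+d<m m≤)

      e+y : e + y ≡ A
      e+y = m+[n∸m]≡n e≤A

      d<y : suc d ≤ y
      d<y = m+n≤o⇒m≤o∸n (suc d) (≤-trans (≤-reflexive (cong suc (+-comm d e))) (≤-trans e+d<m m≤))

    -- Of the three factors `A ^ z` provided by `large`, two pay for the choices of `X` and `J`, and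
    -- the third for the later sum over at most `A` layers.
    layer-bound : ∀ z → suc d ≤ z → x ≤ z ⊎ m ∸ x ≤ z → y ≤ z ⊎ A ∸ y ≤ z → z * A ≤ 2 * (y * x) →
                  layer e * (A * 2 ^ (R * suc d)) ≤ F ^ m
    layer-bound z d<z X-few J-few z-spread = *-cancelˡ-≤ (A ^ z * A ^ z) {{m*n≢0 _ _ {{m^n≢0 A z}} {{m^n≢0 A z}}}} (begin
      A ^ z * A ^ z * (layer e * (A * 2 ^ (R * suc d)))
        ≤⟨ *-monoʳ-≤ (A ^ z * A ^ z) (*-monoʳ-≤ (layer e) (*-mono-≤ A≤A^z (^-monoʳ-≤ 2 (*-monoʳ-≤ R d<z)))) ⟩
      A ^ z * A ^ z * (layer e * (A ^ z * 2 ^ (R * z)))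
        ≡⟨ gather (A ^ z) (layer e) (2 ^ (R * z)) ⟩
      layer e * (A ^ z * A ^ z * A ^ z * 2 ^ (R * z))
        ≤⟨ *-monoʳ-≤ (layer e) exponents ⟩
      layer e * 2 ^ (M * z)
        ≡⟨ distribute ⟩
      ∑ (choose m x) (λ X → ∑ (choose A y) λ J → P (binTargets X Qs J) * 2 ^ (M * z))
        ≤⟨ ∑-mono (choose m x) (λ X X∈ → ∑-mono (choose A y) λ J J∈ →
             miss-rare (binTargets X Qs J) z (enough X J (choose-size m x X∈) (choose-size A y J∈))) ⟩
      ∑ (choose m x) (λ X → ∑ (choose A y) λ J → F ^ m)
        ≡⟨ trans (∑-cong (choose m x) λ _ → ∑-const (choose A y) (F ^ m)) (∑-const (choose m x) _) ⟩
      length (choose m x) * (length (choose A y) * F ^ m)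
        ≤⟨ *-mono-≤ (choose-bound m≤ X-few) (*-monoˡ-≤ (F ^ m) (choose-bound {k = y} ≤-refl J-few)) ⟩
      A ^ z * (A ^ z * F ^ m)
        ≡⟨ sym (*-assoc (A ^ z) _ _) ⟩
      A ^ z * A ^ z * F ^ m ∎)
      where
      gather : ∀ u v w → u * u * (v * (u * w)) ≡ v * (u * u * u * w)
      gather = solve-∀

      A≤A^z : A ≤ A ^ z
      A≤A^z = ≤-trans (≤-reflexive (sym (^-identityʳ A))) (^-monoʳ-≤ A (≤-trans (s≤s z≤n) d<z))

      exponents : A ^ z * A ^ z * A ^ z * 2 ^ (R * z) ≤ 2 ^ (M * z)
      exponents = begin
        A ^ z * A ^ z * A ^ z * 2 ^ (R * z)     ≡⟨ cong₂ _*_ cube (sym (^-*-assoc 2 R z)) ⟩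
        (A ^ 3) ^ z * (2 ^ R) ^ z               ≡⟨ sym (^-distribʳ-* (A ^ 3) (2 ^ R) z) ⟩
        (A ^ 3 * 2 ^ R) ^ z                     ≤⟨ ^-monoˡ-≤ z large ⟩
        (2 ^ M) ^ z                             ≡⟨ ^-*-assoc 2 M z ⟩
        2 ^ (M * z)                             ∎
        where
        cube : A ^ z * A ^ z * A ^ z ≡ (A ^ 3) ^ z
        cube = sym (trans (cong (_^ z) (trans (cong (λ u → A * (A * u)) (*-identityʳ A)) (sym (*-assoc A A A))))
          (trans (^-distribʳ-* (A * A) A z) (cong (_* A ^ z) (^-distribʳ-* A A z))))

      distribute : layer e * 2 ^ (M * z)
                 ≡ ∑ (choose m x) (λ X → ∑ (choose A y) λ J → P (binTargets X Qs J) * 2 ^ (M * z))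
      distribute = sym (trans (∑-cong (choose m x) λ X → ∑-*ʳ (choose A y) (2 ^ (M * z)) _)
                              (∑-*ʳ (choose m x) (2 ^ (M * z)) _))

      enough : ∀ X J → ∣ X ∣ ≡ x → ∣ J ∣ ≡ y → B * (M * z) ≤ size (binTargets X Qs J)
      enough X J X≡ J≡ = *-cancelˡ-≤ 4 (begin
        4 * (B * (M * z))                      ≡⟨ regroup M B z ⟩
        z * (4 * M * B)                        ≡⟨ cong (z *_) (sym bins-vs-density) ⟩
        z * A                                  ≤⟨ z-spread ⟩
        2 * (y * x)                            ≡⟨ cong (2 *_) (sym (cong₂ _*_ J≡ X≡)) ⟩
        2 * (∣ J ∣ * ∣ X ∣)                    ≤⟨ *-monoʳ-≤ 2 (binTargets-size X Qs J (subst (0 <_) (sym X≡) z<s) Q≥) ⟩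
        2 * (2 * size (binTargets X Qs J))     ≡⟨ sym (*-assoc 2 2 (size (binTargets X Qs J))) ⟩
        4 * size (binTargets X Qs J)           ∎)
        where
        regroup : ∀ M B z → 4 * (B * (M * z)) ≡ z * (4 * M * B)
        regroup = solve-∀

    -- Here `z` is the smaller of `x` and `y`. As x + y ≥ A, the larger is at least A/2, so the at
    -- least xy/2 chances number at least zA/4 = zMB. Moreover `X` or its complement has at most `z`
    -- elements, and so has `J` or its complement.
    layer-rare : layer e * (A * 2 ^ (R * suc d)) ≤ F ^ m
    layer-rare with ≤-total x y
    ... | inj₁ x≤y = layer-bound x (m≤m+n (suc d) e) (inj₁ ≤-refl)
      (inj₂ (≤-trans (≤-reflexive (m∸[m∸n]≡n e≤A)) (m≤n+m e (suc d))))
      (begin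
        x * A              ≡⟨ cong (x *_) (sym e+y) ⟩
        x * (e + y)        ≤⟨ *-monoʳ-≤ x (+-monoˡ-≤ y (≤-trans (m≤n+m e (suc d)) x≤y)) ⟩
        x * (y + y)        ≡⟨ rearrange x y ⟩
        2 * (y * x)        ∎)
      where
      rearrange : ∀ x y → x * (y + y) ≡ 2 * (y * x)
      rearrange = solve-∀
    ... | inj₂ y≤x = layer-bound y d<y (inj₂ (∸-mono m≤ (m≤n+m e (suc d)))) (inj₁ ≤-refl)
      (begin
        y * A              ≡⟨ cong (y *_) (sym e+y) ⟩
        y * (e + y)        ≤⟨ *-monoʳ-≤ y (+-mono-≤ (m≤n+m e (suc d)) y≤x) ⟩
        y * (x + x)        ≡⟨ rearrange x y ⟩
        2 * (y * x)        ∎)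
      where
      rearrange : ∀ x y → y * (x + x) ≡ 2 * (y * x)
      rearrange = solve-∀

  violator-union : ∀ Ss → ⟦ does (violator? d (available Qs Ss)) ⟧ ≤
    ∑ (upTo (m ∸ d)) λ e → ∑ (choose m (suc d + e)) λ X → ∑ (choose A (A ∸ e)) λ J →
      ⟦ missAll (binTargets X Qs J) Ss ⟧
  violator-union Ss with violator? d (available Qs Ss)
  ... | no  _ = z≤n
  ... | yes (X , violates) with e , X≡ , J , J∈ , missed ← violator-misses A d Qs Ss X violates = begin
    1
      ≡⟨ cong ⟦_⟧ (sym missed) ⟩
    ⟦ missAll (binTargets X Qs J) Ss ⟧
      ≤⟨ ∑-∈ (λ J → ⟦ missAll (binTargets X Qs J) Ss ⟧) J∈ ⟩
    ∑ (choose A (A ∸ e)) (λ J → ⟦ missAll (binTargets X Qs J) Ss ⟧)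
      ≤⟨ ∑-∈ (λ X → ∑ (choose A (A ∸ e)) λ J → ⟦ missAll (binTargets X Qs J) Ss ⟧)
             (subst (λ k → X ∈ˡ choose m k) X≡ (choose-self X)) ⟩
    ∑ (choose m (suc d + e)) (λ X → ∑ (choose A (A ∸ e)) λ J → ⟦ missAll (binTargets X Qs J) Ss ⟧)
      ≤⟨ ∑-∈ (λ e → ∑ (choose m (suc d + e)) λ X → ∑ (choose A (A ∸ e)) λ J →
               ⟦ missAll (binTargets X Qs J) Ss ⟧) (Mem.∈-upTo⁺ e<) ⟩
    _ ∎
    where
    e< : e < m ∸ d
    e< = m+n≤o⇒m≤o∸n (suc e) (≤-trans (≤-reflexive (cong suc (+-comm e d)))
           (≤-trans (≤-reflexive (sym X≡)) (Subset.∣p∣≤n X)))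

  violator-rare : tupleSum (subsets N) m (λ Ss → ⟦ does (violator? d (available Qs Ss)) ⟧)
                    * 2 ^ (R * suc d) ≤ F ^ m
  violator-rare = *-cancelˡ-≤ A (begin
    A * (V * 2 ^ (R * suc d))
      ≡⟨ swap A V _ ⟩
    V * (A * 2 ^ (R * suc d))
      ≤⟨ *-monoˡ-≤ _ V≤ ⟩
    ∑ (upTo (m ∸ d)) layer * (A * 2 ^ (R * suc d))
      ≡⟨ sym (∑-*ʳ (upTo (m ∸ d)) _ layer) ⟩
    ∑ (upTo (m ∸ d)) (λ e → layer e * (A * 2 ^ (R * suc d)))
      ≤⟨ ∑-mono (upTo (m ∸ d)) (λ e e∈ → layer-rare e (Mem.∈-upTo⁻ e∈)) ⟩
    ∑ (upTo (m ∸ d)) (λ _ → F ^ m)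
      ≡⟨ trans (∑-const (upTo (m ∸ d)) (F ^ m)) (cong (_* F ^ m) (List.length-upTo (m ∸ d))) ⟩
    (m ∸ d) * F ^ m
      ≤⟨ *-monoˡ-≤ (F ^ m) (≤-trans (m∸n≤m m d) m≤) ⟩
    A * F ^ m ∎)
    where
    V = tupleSum (subsets N) m λ Ss → ⟦ does (violator? d (available Qs Ss)) ⟧
    swap : ∀ x y z → x * (y * z) ≡ y * (x * z)
    swap = solve-∀
    V≤ : V ≤ ∑ (upTo (m ∸ d)) layer
    V≤ = ≤-trans (tupleSum-mono (subsets N) m violator-union) (≤-reflexive
      (trans (tupleSum-∑ (subsets N) m (upTo (m ∸ d)) _) (∑-cong (upTo (m ∸ d)) λ e →
       trans (tupleSum-∑ (subsets N) m (choose m (suc d + e)) _) (∑-cong (choose m (suc d + e)) λ X →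
       tupleSum-∑ (subsets N) m (choose A (A ∸ e)) _))))

-- The random colouring

∈-toList : ∀ (v : Vec 𝐴 m) i → lookup v i ∈ˡ Vec.toList v
∈-toList (x ∷ v) zero    = here refl
∈-toList (x ∷ v) (suc i) = there (∈-toList v i)

∈-toList⁻ : ∀ (v : Vec 𝐴 m) {x} → x ∈ˡ Vec.toList v → ∃[ i ] (lookup v i ≡ x)
∈-toList⁻ (x ∷ v) (here refl) = zero , refl
∈-toList⁻ (x ∷ v) (there x∈) with i , eq ← ∈-toList⁻ v x∈ = suc i , eq

length-concatMap : ∀ (f : 𝐴 → List 𝐵) k xs → (∀ x → length (f x) ≤ k) →
                   length (List.concatMap f xs) ≤ length xs * k
length-concatMap f k []       f≤k = z≤n
length-concatMap f k (x ∷ xs) f≤k =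
  ≤-trans (≤-reflexive (List.length-++ (f x))) (+-mono-≤ (f≤k x) (length-concatMap f k xs f≤k))

map-lookup-update : ∀ (ω : Vec 𝐴 n) u a (hs : Vec (Fin n) m) → u ∉ˡ Vec.toList hs →
                    Vec.map (lookup (ω [ u ]≔ a)) hs ≡ Vec.map (lookup ω) hs
map-lookup-update ω u a []       u∉ = refl
map-lookup-update ω u a (h ∷ hs) u∉ = cong₂ _∷_
  (Vec.lookup∘updateAt′ h u (λ h≡u → u∉ (here (sym h≡u))) ω) (map-lookup-update ω u a hs (u∉ ∘ there))

module RandomColouring
  {n N : ℕ} (outdeg : Fin n → ℕ) (heads : ∀ v → Vec (Fin n) (outdeg v))
  (heads-unique : ∀ v → Unique (Vec.toList (heads v)))
  (heads-irreflexive : ∀ v → v ∉ˡ Vec.toList (heads v))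
  (nbrs : Fin n → List (Fin n)) (nbrs-complete : ∀ w u → u ∈ˡ Vec.toList (heads w) → w ∈ˡ nbrs u)
  (Δ : ℕ) .{{_ : NonZero Δ}} (nbrs-bounded : ∀ u → length (nbrs u) ≤ Δ) (outdeg≤Δ : ∀ v → outdeg v ≤ Δ)
  (a b M R d s t : ℕ)
  (outdeg≤A : ∀ v → outdeg v ≤ suc a)
  (palette : ∀ v → Vec (Subset N) (outdeg v))
  (palette-size : ∀ v i → ∣ lookup (palette v) i ∣ ≡ suc a + s)
  (bins-vs-density : suc a ≡ 4 * M * suc b)
  (large : suc a ^ 3 * 2 ^ R ≤ 2 ^ M)
  (growth : suc (suc b) ^ (suc a + s) ≤ 2 ^ t * suc b ^ (suc a + s))
  (tail : 2 ^ t * (2 * suc a * suc a) ≤ 2 ^ suc s)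
  (sparse : 8 * (Δ * suc Δ) ≤ 2 ^ (R * suc d))
  where

  open RandomSubset b

  private
    F = suc b ^ N
    -- In this form `suc c` computes to `2 * suc a`, and `L-common` says that `L v` keeps a
    -- proportion 1 - 1/(2(a+1)) of all sets.
    c = a + (suc a + 0)

    c>0 : 0 < c
    c>0 = subst (0 <_) (sym (+-suc a (a + 0))) z<s

  palettes : Fin n → List (Subset N)
  palettes v = Vec.toList (palette v)

  L : Fin n → List (Subset N)
  L v = balancedSubsets s (palettes v)

  open Resampling L
  open ≤-Reasoning

  L-common : ∀ v → c * F ≤ suc c * length (L v)
  L-common v = +-cancelˡ-≤ F _ _ (≤-trans
    (balanced-common s t a (palettes v)
      (≤-trans (≤-reflexive (Vec.length-toList (palette v))) (outdeg≤A v))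
      (λ {P} P∈ → subst (λ k → suc (suc b) ^ k ≤ 2 ^ t * suc b ^ k) (sym (sizes P∈)) growth)
      tail)
    (≤-reflexive (+-comm _ F)))
    where
    sizes : ∀ {P} → P ∈ˡ palettes v → ∣ P ∣ ≡ suc a + s
    sizes P∈ with i , refl ← ∈-toList⁻ (palette v) P∈ = palette-size v i

  L-nonempty : ∀ v → 0 < length (L v)
  L-nonempty v = *-cancelˡ-< (suc c) 0 _ (≤-trans (≤-reflexive (cong suc (*-zeroʳ (suc c))))
    (≤-trans (*-mono-≤ c>0 (m^n>0 (suc b) N)) (L-common v)))

  -- A product of a + 1 factors 1 - 1/(2(a+1)) is at least 1/2 by `half-power`. Thus drawing the
  -- sets at all heads from the balanced ones at most doubles any probability.
  mass-common : ∀ us → length us ≤ suc a → F ^ length us ≤ 2 * mass us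
  mass-common us us≤ = *-cancelˡ-≤ (c ^ length us) {{m^n≢0 c (length us) {{>-nonZero c>0}}}} (begin
    c ^ length us * F ^ length us    ≡⟨ sym (^-distribʳ-* c F (length us)) ⟩
    (c * F) ^ length us              ≤⟨ product us ⟩
    suc c ^ length us * mass us      ≤⟨ *-monoˡ-≤ (mass us) (half-power c (length us) (*-monoʳ-≤ 2 us≤)) ⟩
    2 * c ^ length us * mass us      ≡⟨ rearrange (c ^ length us) (mass us) ⟩
    c ^ length us * (2 * mass us)    ∎)
    where
    rearrange : ∀ x y → 2 * x * y ≡ x * (2 * y)
    rearrange = solve-∀
    interchange : ∀ w x y z → w * x * (y * z) ≡ w * y * (x * z)
    interchange = solve-∀
    product : ∀ us → (c * F) ^ length us ≤ suc c ^ length us * mass us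
    product []       = ≤-refl
    product (u ∷ us) = ≤-trans (*-mono-≤ (L-common u) (product us))
      (≤-reflexive (interchange (suc c) (length (L u)) (suc c ^ length us) (mass us)))

  residual : ∀ v → Subset N → Vec (Subset N) (outdeg v)
  residual v S = Vec.map (_∩ ∁ S) (palette v)

  -- The local lemma asks for rarity at every outcome, including those where `S` is unbalanced and
  -- the residual palettes may be too small. Such `S` count as harmless, since `L v` does not
  -- contain them.
  fails : ∀ v → Subset N → Vec (Subset N) (outdeg v) → Bool
  fails v S Ss = balanced s (palettes v) S ∧ does (violator? d (available (residual v S) Ss))

  bad : Fin n → Vec (Subset N) n → Bool
  bad v ω = fails v (lookup ω v) (Vec.map (lookup ω) (heads v))

  R# : Fin n → List (Fin n)
  R# v = Vec.toList (heads v)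

  -- The set at `u` is read by the event at `u` itself and by the events at those vertices that have
  -- `u` as a head, all of them in `nbrs u`.
  Γ : Fin n → List (Fin n)
  Γ v = List.concatMap (λ u → u ∷ nbrs u) (R# v)

  Γ-bounded : ∀ v → length (Γ v) ≤ Δ * suc Δ
  Γ-bounded v = ≤-trans (length-concatMap (λ u → u ∷ nbrs u) (suc Δ) (R# v) λ u → s≤s (nbrs-bounded u))
    (*-monoˡ-≤ (suc Δ) (≤-trans (≤-reflexive (Vec.length-toList (heads v))) (outdeg≤Δ v)))

  Γ-complete : ∀ v w → w ∉ˡ Γ v → ∀ u → u ∈ˡ R# v → ∀ ω S → bad w (ω [ u ]≔ S) ≡ bad w ω
  Γ-complete v w w∉ u u∈ ω S = cong₂ (fails w)
    (Vec.lookup∘updateAt′ w u (λ w≡u → ∉-via (here w≡u)) ω)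
    (map-lookup-update ω u S (heads w) λ u∈w → ∉-via (there (nbrs-complete w u u∈w)))
    where
    ∉-via : w ∉ˡ u ∷ nbrs u
    ∉-via w∈ = w∉ (Mem.∈-concatMap⁺ (λ u → u ∷ nbrs u) (Any-map u∈))
      where
      open import Data.List.Relation.Unary.Any as Any using (Any)
      Any-map : u ∈ˡ R# v → Any (λ x → w ∈ˡ x ∷ nbrs x) (R# v)
      Any-map = Any.map λ { refl → w∈ }

  residual-size : ∀ v S → balanced s (palettes v) S ≡ true → ∀ i → suc a ≤ ∣ lookup (residual v S) i ∣
  residual-size v S ok i = +-cancelˡ-≤ s _ _ (begin
    s + suc a                           ≡⟨ +-comm s (suc a) ⟩
    suc a + s                           ≡⟨ sym (palette-size v i) ⟩
    ∣ P ∣                               ≡⟨ sym (∣p∩q∣+∣p∩∁q∣≡∣p∣ P S) ⟩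
    ∣ P ∩ S ∣ + ∣ P ∩ ∁ S ∣             ≤⟨ +-monoˡ-≤ _ (balanced-sound s (palettes v) S ok (∈-toList (palette v) i)) ⟩
    s + ∣ P ∩ ∁ S ∣                     ≡⟨ cong (λ Q → s + ∣ Q ∣) (sym (Vec.lookup-map i (_∩ ∁ S) (palette v))) ⟩
    s + ∣ lookup (residual v S) i ∣     ∎)
    where P = lookup (palette v) i

  -- The 8 in `sparse` is the 4 of the local lemma times the 2 lost in `mass-common`.
  fails-rare : ∀ v S ω → 4 * (Δ * suc Δ) *
    resample (R# v) (λ ω → ⟦ fails v S (Vec.map (lookup ω) (heads v)) ⟧) ω ≤ mass (R# v)
  fails-rare v S ω with balanced s (palettes v) S in eq
  ... | false = ≤-trans (≤-reflexive (trans (cong (4 * (Δ * suc Δ) *_) (resample-* (R# v) 0 (λ _ → 0) ω))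
                                            (*-zeroʳ (4 * (Δ * suc Δ))))) z≤n
  ... | true  = *-cancelˡ-≤ 2 (begin
    2 * (4 * (Δ * suc Δ) * r)       ≡⟨ double (Δ * suc Δ) r ⟩
    8 * (Δ * suc Δ) * r             ≤⟨ *-mono-≤ sparse r≤V ⟩
    2 ^ (R * suc d) * V             ≡⟨ *-comm (2 ^ (R * suc d)) V ⟩
    V * 2 ^ (R * suc d)             ≤⟨ UnionBound.violator-rare b M R a d bins-vs-density large
                                         (residual v S) (outdeg≤A v) (residual-size v S eq) ⟩
    F ^ outdeg v                    ≡⟨ cong (F ^_) (sym (Vec.length-toList (heads v))) ⟩
    F ^ length (R# v)               ≤⟨ mass-common (R# v) (≤-trans (≤-reflexive (Vec.length-toList (heads v))) (outdeg≤A v)) ⟩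
    2 * mass (R# v)                 ∎)
    where
    f : Vec (Subset N) (outdeg v) → ℕ
    f Ss = ⟦ does (violator? d (available (residual v S) Ss)) ⟧
    r = resample (R# v) (λ ω → f (Vec.map (lookup ω) (heads v))) ω
    V = tupleSum (subsets N) (outdeg v) f
    double : ∀ x y → 2 * (4 * x * y) ≡ 8 * x * y
    double = solve-∀
    r≤V : r ≤ V
    r≤V = resample-tuple L (subsets N) (λ u → ∑-filter-≤ _ (subsets N)) (heads v) (heads-unique v) f ω

  -- No vertex is its own head, so the set at `v` stays fixed while the sets at its heads are
  -- resampled, and `fails-rare` applies to that fixed set.
  rarely-bad : ∀ v ω → 4 * (Δ * suc Δ) * resample (R# v) (λ ω → ⟦ bad v ω ⟧) ω ≤ mass (R# v)
  rarely-bad v ω = ≤-trans (≤-reflexive (cong (4 * (Δ * suc Δ) *_)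
    (resample-cong-off (R# v) v (heads-irreflexive v) ω λ ω′ eq →
      cong (λ S → ⟦ fails v S (Vec.map (lookup ω′) (heads v)) ⟧) eq)))
    (fails-rare v (lookup ω v) ω)

  Assignment : Vec (Subset N) n → Fin n → Set
  Assignment C v = Σ (Fin (outdeg v) → Fin (N + d)) λ μ →
      (∀ i {c} → Fin.splitAt N (μ i) ≡ inj₁ c →
         c ∈ lookup (palette v) i × c ∉ lookup C v × c ∈ lookup C (lookup (heads v) i))
    × (∀ i j → μ i ≡ μ j → i ≡ j)

  assignments : ∃[ C ] (∀ v → Assignment C v)
  assignments
    with ω , ω-good , ω∈L ← LocalLemma.avoid-all L L-nonempty Fin._≟_ bad R# Γ (Δ * suc Δ)
           {{m*n≢0 Δ (suc Δ)}} Γ-bounded Γ-complete rarely-bad (Vec.replicate n ⊥)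
           (allFin n) (Unique.allFin⁺ n)
    = ω , assign
    where
    assign : ∀ v → Assignment ω v
    assign v = proj₁ matching , sound , proj₂ (proj₂ matching)
      where
      S = lookup ω v
      Qs = available (residual v S) (Vec.map (lookup ω) (heads v))

      is-balanced : balanced s (palettes v) S ≡ true
      is-balanced = proj₂ (Mem.∈-filter⁻ (λ S → balanced s (palettes v) S Bool.≟ true) {xs = subsets N} (ω∈L v))

      no-violator : ¬ ∃ (Violator d Qs)
      no-violator viol = case trans (sym (ω-good v (Mem.∈-allFin v)))
        (cong₂ _∧_ is-balanced (dec-true (violator? d Qs) viol)) of λ ()

      matching = hall-defect d Qs λ X → ≮⇒≥ λ violates → no-violator (X , violates)

      sound : ∀ i {c} → Fin.splitAt N (proj₁ matching i) ≡ inj₁ c →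
              c ∈ lookup (palette v) i × c ∉ S × c ∈ lookup ω (lookup (heads v) i)
      sound i {c} eq
        with c∈res , c∈head ← Subset.x∈p∩q⁻ _ _
               (subst (c ∈_) (Vec.lookup-zipWith _∩_ i (residual v S) _) (proj₁ (proj₂ matching) i eq))
        with c∈P , c∈∁S ← Subset.x∈p∩q⁻ _ _ (subst (c ∈_) (Vec.lookup-map i (_∩ ∁ S) (palette v)) c∈res)
        = c∈P , Subset.x∈∁p⇒x∉p c∈∁S , subst (c ∈_) (Vec.lookup-map i (lookup ω) (heads v)) c∈head

-- Star-forests and forests

module StarCriterion
  {V : Set} {_~_ _⟶_ : V → V → Set}
  (orient : ∀ {u v} → u ~ v → u ⟶ v ⊎ v ⟶ u)
  (forward : ∀ {u v} → u ⟶ v → u ~ v) (backward : ∀ {u v} → u ⟶ v → v ~ u)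
  (functional : ∀ {u v w} → u ⟶ v → u ⟶ w → v ≡ w)
  (no-path : ∀ {u v w} → u ⟶ v → ¬ (v ⟶ w))
  (tail? : ∀ v → Dec (∃[ u ] (v ⟶ u)))
  where

  open import Relation.Binary.Construct.Closure.ReflexiveTransitive using (ε; _◅_)

  -- Next to the first edge of a cycle, at its tail, lies another edge: it either forms a directed
  -- path with the first one or is a second arrow out of the same tail.
  acyclic : IsForest _~_
  acyclic (m , c , c-inj , step , close) with orient (step zero)
  ... | inj₁ 0⟶1 with orient close
  ...   | inj₁ l⟶0 = no-path l⟶0 0⟶1
  ...   | inj₂ 0⟶l with () ← c-inj (functional 0⟶1 0⟶l)
  acyclic (m , c , c-inj , step , close) | inj₂ 1⟶0 with orient (step (suc zero))
  ...   | inj₁ 1⟶2 with () ← c-inj (functional 1⟶0 1⟶2)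
  ...   | inj₂ 2⟶1 = no-path 2⟶1 1⟶0

  module Centre (c : V) (sink : ∀ {w} → ¬ (c ⟶ w)) where

    Near : V → Set
    Near x = x ≡ c ⊎ x ⟶ c

    near-step : ∀ {x y} → Near x → x ~ y → Near y
    near-step (inj₁ refl) x~y with orient x~y
    ... | inj₁ c⟶y = contradiction c⟶y sink
    ... | inj₂ y⟶c = inj₂ y⟶c
    near-step (inj₂ x⟶c) x~y with orient x~y
    ... | inj₁ x⟶y = inj₁ (functional x⟶y x⟶c)
    ... | inj₂ y⟶x = contradiction x⟶c (no-path y⟶x)

    near-connected : ∀ {x y} → Near x → Connected _~_ x y → Near y
    near-connected near ε            = near
    near-connected near (x~z ◅ z~*y) = near-connected (near-step near x~z) z~*y

    spoke : ∀ {u} → Near u → u ≢ c → c ~ u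
    spoke (inj₁ u≡c) u≢c = contradiction u≡c u≢c
    spoke (inj₂ u⟶c) _   = backward u⟶c

    incident : ∀ {u w} → Near u → u ~ w → u ≡ c ⊎ w ≡ c
    incident (inj₁ u≡c) u~w = inj₁ u≡c
    incident (inj₂ u⟶c) u~w with orient u~w
    ... | inj₁ u⟶w = inj₂ (functional u⟶w u⟶c)
    ... | inj₂ w⟶u = contradiction u⟶c (no-path w⟶u)

    star : ∀ {v} → Near v → Connected _~_ v c → ComponentIsStar _~_ v
    star near v~*c = c , v~*c ,
      (λ u v~*u → spoke (near-connected near v~*u)) ,
      (λ u w v~*u → incident (near-connected near v~*u))

  isStarForest : IsStarForest _~_
  isStarForest = acyclic , component
    where
    component : ∀ v → ComponentIsStar _~_ v
    component v with tail? v
    ... | yes (u , v⟶u) = Centre.star u (no-path v⟶u) (inj₂ v⟶u) (forward v⟶u ◅ ε)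
    ... | no  v-sink    = Centre.star v (λ v⟶w → v-sink (_ , v⟶w)) (inj₁ refl) ε

-- Orienting a forest by peeling off leaves

module ForestOrientation
  {n : ℕ} {_~_ : Fin n → Fin n → Set} (_~?_ : ∀ u v → Dec (u ~ v))
  (~-sym : ∀ {u v} → u ~ v → v ~ u) (~-irrefl : ∀ {v} → ¬ (v ~ v))
  (forest : IsForest _~_)
  where

  -- Paths are extended at the front, so only the vertex at position 0 has to lie in `S`. Positions
  -- beyond `l` carry default values.
  record Path (S : Subset n) (l : ℕ) : Set where
    field
      at        : ℕ → Fin n
      inside-S  : at 0 ∈ S
      step      : ∀ i → i < l → at i ~ at (suc i)
      injective : ∀ i j → i ≤ l → j ≤ l → at i ≡ at j → i ≡ j

  open Path

  path-length : ∀ {S l} → Path S l → suc l ≤ n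
  path-length {l = l} p = Fin.injective⇒≤ {f = at p ∘ toℕ {suc l}} λ {i} {j} eq →
    Fin.toℕ-injective (injective p (toℕ i) (toℕ j) (Fin.toℕ≤pred[n] i) (Fin.toℕ≤pred[n] j) eq)

  close-cycle : ∀ {S l} (p : Path S l) m → 2 + m ≤ l → ¬ (at p 0 ~ at p (2 + m))
  close-cycle {l = l} p m m≤l closing = forest (m , at p ∘ toℕ , inj , steps , back)
    where
    below : ∀ (i : Fin (3 + m)) → toℕ i ≤ l
    below i = ≤-trans (Fin.toℕ≤pred[n] i) m≤l
    inj : ∀ {i j : Fin (3 + m)} → at p (toℕ i) ≡ at p (toℕ j) → i ≡ j
    inj {i} {j} eq = Fin.toℕ-injective (injective p (toℕ i) (toℕ j) (below i) (below j) eq)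
    steps : ∀ (i : Fin (2 + m)) → at p (toℕ (Fin.inject₁ i)) ~ at p (suc (toℕ i))
    steps i = subst (λ k → at p k ~ at p (suc (toℕ i))) (sym (Fin.toℕ-inject₁ i))
                (step p (toℕ i) (≤-trans (Fin.toℕ<n i) m≤l))
    back : at p (toℕ (Fin.fromℕ (2 + m))) ~ at p 0
    back = subst (λ k → at p k ~ at p 0) (sym (Fin.toℕ-fromℕ (2 + m))) (~-sym closing)

  -- If every vertex of `S` could be left through `S` avoiding a prescribed vertex, a path could
  -- grow past `n` vertices, because meeting itself again would close a cycle.
  no-endless-walk : ∀ (S : Subset n) → (∀ v p → v ∈ S → ∃[ w ] (w ∈ S × v ~ w × w ≢ p)) →
                    ∀ fuel l → n ≤ l + fuel → ¬ Path S l
  no-endless-walk S next zero       l n≤ p =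
    <-irrefl refl (≤-trans (path-length p) (≤-trans n≤ (≤-reflexive (+-identityʳ l))))
  no-endless-walk S next (suc fuel) l n≤ p
    -- The vertex to avoid is the one behind the front. For `l` zero it is a default value, which
    -- merely narrows the choice of `w`.
    with w , w∈S , v~w , w≢p₁ ← next (at p 0) (at p 1) (inside-S p)
    with Fin.any? {n = suc l} (λ i → at p (toℕ i) Fin.≟ w)
  ... | yes (zero , refl)           = ~-irrefl v~w
  ... | yes (suc zero , eq)         = w≢p₁ (sym eq)
  ... | yes (suc (suc i) , refl)    = close-cycle p (toℕ i) (Fin.toℕ≤pred[n] (suc (suc i))) v~w
  ... | no  fresh = no-endless-walk S next fuel (suc l) (≤-trans n≤ (≤-reflexive (+-suc l fuel))) longer
    where
    off : ∀ i → i ≤ l → at p i ≢ w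
    off i i≤l eq = fresh (Fin.fromℕ< (s≤s i≤l) , trans (cong (at p) (Fin.toℕ-fromℕ< (s≤s i≤l))) eq)

    longer : Path S (suc l)
    longer .at zero    = w
    longer .at (suc i) = at p i
    longer .inside-S   = w∈S
    longer .step zero    _   = ~-sym v~w
    longer .step (suc i) i<l = step p i (s≤s⁻¹ i<l)
    longer .injective zero    zero    _   _   eq = refl
    longer .injective zero    (suc j) _   j≤l eq = contradiction (sym eq) (off j (s≤s⁻¹ j≤l))
    longer .injective (suc i) zero    i≤l _   eq = contradiction eq (off i (s≤s⁻¹ i≤l))
    longer .injective (suc i) (suc j) i≤l j≤l eq = cong suc (injective p i j (s≤s⁻¹ i≤l) (s≤s⁻¹ j≤l) eq)

  Branching : Subset n → Fin n → Set
  Branching S v = ∃[ w ] (∃[ w′ ] (w ∈ S × w′ ∈ S × v ~ w × v ~ w′ × w ≢ w′))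

  branching? : ∀ S v → Dec (Branching S v)
  branching? S v = Fin.any? λ w → Fin.any? λ w′ →
    (w Subset.∈? S) ×-dec ((w′ Subset.∈? S) ×-dec ((v ~? w) ×-dec ((v ~? w′) ×-dec ¬? (w Fin.≟ w′))))

  leaf : ∀ S → (∃[ v ] (v ∈ S)) → ∃[ v ] (v ∈ S × ¬ Branching S v)
  leaf S (v₀ , v₀∈S) with Fin.any? (λ v → (v Subset.∈? S) ×-dec ¬? (branching? S v))
  ... | yes found = found
  ... | no  none  = contradiction start (no-endless-walk S next n 0 ≤-refl)
    where
    next : ∀ v p → v ∈ S → ∃[ w ] (w ∈ S × v ~ w × w ≢ p)
    next v p v∈S with branching? S v
    ... | no ¬b = contradiction (v , v∈S , ¬b) none
    ... | yes (w , w′ , w∈ , w′∈ , v~w , v~w′ , w≢w′) with w Fin.≟ p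
    ...   | no  w≢p  = w , w∈ , v~w , w≢p
    ...   | yes refl = w′ , w′∈ , v~w′ , w≢w′ ∘ sym

    start : Path S 0
    start .at _                     = v₀
    start .inside-S                 = v₀∈S
    start .step _ ()
    start .injective .0 .0 z≤n z≤n _ = refl

  -- This stands for a rooting: arrows go down in rank, and the third clause gives every vertex at
  -- most one parent. Ranks arise by peeling off a vertex with at most one remaining neighbour and
  -- giving it the top rank.
  Ranking : Subset n → ℕ → (Fin n → ℕ) → Set
  Ranking S k r =
      (∀ v → v ∈ S → r v < k)
    × (∀ u v → u ∈ S → v ∈ S → u ~ v → r u ≢ r v)
    × (∀ u v w → u ∈ S → v ∈ S → w ∈ S → u ~ v → u ~ w → r v < r u → r w < r u → v ≡ w)

  ranking : ∀ k S → ∣ S ∣ ≤ k → ∃ (Ranking S k)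
  ranking k S S≤k with Subset.nonempty? S
  ranking k S S≤k | no empty = (λ _ → 0) ,
    (λ v v∈ → contradiction (v , v∈) empty) ,
    (λ u v u∈ → contradiction (u , u∈) empty) ,
    (λ u v w u∈ → contradiction (u , u∈) empty)
  ranking zero    S S≤k | yes (v , v∈) = contradiction (≤-trans (size-positive v∈) S≤k) λ ()
  ranking (suc k) S S≤k | yes nonempty
    with ℓ , ℓ∈ , ℓ-leaf ← leaf S nonempty
    with r , r<k , r-distinct , r-unique ←
           ranking k (S - ℓ) (s≤s⁻¹ (≤-trans (Subset.x∈p⇒∣p-x∣<∣p∣ ℓ∈) S≤k))
    = rank , bounded , distinct , unique
    where
    rank : Fin n → ℕ
    rank v with v Fin.≟ ℓ
    ... | yes _ = k
    ... | no  _ = r v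

    bounded : ∀ v → v ∈ S → rank v < suc k
    bounded v v∈ with v Fin.≟ ℓ
    ... | yes _  = ≤-refl
    ... | no v≢ℓ = ≤-trans (r<k v (Subset.x∈p∧x≢y⇒x∈p-y v∈ v≢ℓ)) (n≤1+n k)

    distinct : ∀ u v → u ∈ S → v ∈ S → u ~ v → rank u ≢ rank v
    distinct u v u∈ v∈ u~v eq with u Fin.≟ ℓ | v Fin.≟ ℓ
    ... | yes refl | yes refl = ~-irrefl u~v
    ... | yes refl | no  v≢ℓ  = <-irrefl (sym eq) (r<k v (Subset.x∈p∧x≢y⇒x∈p-y v∈ v≢ℓ))
    ... | no  u≢ℓ  | yes refl = <-irrefl eq (r<k u (Subset.x∈p∧x≢y⇒x∈p-y u∈ u≢ℓ))
    ... | no  u≢ℓ  | no  v≢ℓ  = r-distinct u v (Subset.x∈p∧x≢y⇒x∈p-y u∈ u≢ℓ)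
                                  (Subset.x∈p∧x≢y⇒x∈p-y v∈ v≢ℓ) u~v eq

    unique : ∀ u v w → u ∈ S → v ∈ S → w ∈ S → u ~ v → u ~ w →
             rank v < rank u → rank w < rank u → v ≡ w
    unique u v w u∈ v∈ w∈ u~v u~w v<u w<u with u Fin.≟ ℓ
    ... | yes refl with v Fin.≟ w
    ...   | yes v≡w = v≡w
    ...   | no  v≢w = contradiction (v , w , v∈ , w∈ , u~v , u~w , v≢w) ℓ-leaf
    unique u v w u∈ v∈ w∈ u~v u~w v<u w<u | no u≢ℓ with v Fin.≟ ℓ | w Fin.≟ ℓ
    ... | yes _  | _      = contradiction v<u (<-asym (r<k u (Subset.x∈p∧x≢y⇒x∈p-y u∈ u≢ℓ)))
    ... | no _   | yes _  = contradiction w<u (<-asym (r<k u (Subset.x∈p∧x≢y⇒x∈p-y u∈ u≢ℓ)))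
    ... | no v≢ℓ | no w≢ℓ = r-unique u v w (Subset.x∈p∧x≢y⇒x∈p-y u∈ u≢ℓ)
      (Subset.x∈p∧x≢y⇒x∈p-y v∈ v≢ℓ) (Subset.x∈p∧x≢y⇒x∈p-y w∈ w≢ℓ) u~v u~w v<u w<u

  abstract
    forestRank : Σ (Fin n → ℕ) λ r → ((∀ u v → u ~ v → r u ≢ r v)
      × (∀ u v w → u ~ v → u ~ w → r v < r u → r w < r u → v ≡ w))
    forestRank with r , _ , distinct , unique ← ranking n ⊤ (Subset.∣p∣≤n ⊤) =
      r , (λ u v → distinct u v Subset.∈⊤ Subset.∈⊤) ,
      (λ u v w → unique u v w Subset.∈⊤ Subset.∈⊤ Subset.∈⊤)

length-filter-tabulate : ∀ {P : 𝐴 → Set} (P? : ∀ x → Dec (P x)) (g : Fin n → 𝐴) →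
  length (List.filter P? (List.tabulate g)) ≡ ∣ Vec.tabulate (does ∘ P? ∘ g) ∣
length-filter-tabulate {n = zero}  P? g = refl
length-filter-tabulate {n = suc n} P? g with does (P? (g zero))
... | true  = cong suc (length-filter-tabulate P? (g ∘ suc))
... | false = length-filter-tabulate P? (g ∘ suc)

-- Edges, colour classes and orientations of a graph

module GraphFacts (G : Graph) where

  open Graph G
  open Edge

  edge-≡ : ∀ {e e′ : Edge} → src e ≡ src e′ → tgt e ≡ tgt e′ → e ≡ e′
  edge-≡ {record { src<tgt = p ; adjacent = q }} {record { src<tgt = p′ ; adjacent = q′ }} refl refl =
    cong₂ (λ p q → record { src<tgt = p ; adjacent = q }) (Fin.<-irrelevant p p′) (Bool.T-irrelevant q q′)

  joins-unique : ∀ e e′ {u v} → Joins e u v → Joins e′ u v → e ≡ e′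
  joins-unique e e′ (inj₁ (refl , refl)) (inj₁ (s , t)) = edge-≡ (sym s) (sym t)
  joins-unique e e′ (inj₂ (refl , refl)) (inj₂ (s , t)) = edge-≡ (sym s) (sym t)
  joins-unique e e′ (inj₁ (refl , refl)) (inj₂ (s , t)) =
    contradiction (subst₂ Fin._<_ s t (src<tgt e′)) (<-asym (src<tgt e))
  joins-unique e e′ (inj₂ (refl , refl)) (inj₁ (s , t)) =
    contradiction (subst₂ Fin._<_ s t (src<tgt e′)) (<-asym (src<tgt e))

  joins-sym : ∀ e {u v} → Joins e u v → Joins e v u
  joins-sym e (inj₁ p) = inj₂ p
  joins-sym e (inj₂ p) = inj₁ p

  joins-irreflexive : ∀ e {v} → ¬ Joins e v v
  joins-irreflexive e (inj₁ (refl , t)) = <-irrefl (cong toℕ (sym t)) (src<tgt e)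
  joins-irreflexive e (inj₂ (refl , t)) = <-irrefl (cong toℕ (sym t)) (src<tgt e)

  joins-other-end : ∀ e {u v w} → Joins e u v → Joins e u w → v ≡ w
  joins-other-end e (inj₁ (refl , refl)) (inj₁ (_ , refl)) = refl
  joins-other-end e (inj₂ (refl , refl)) (inj₂ (refl , _)) = refl
  joins-other-end e (inj₁ (refl , refl)) (inj₂ (_ , t)) = contradiction (src<tgt e) (<-irrefl (cong toℕ (sym t)))
  joins-other-end e (inj₂ (refl , refl)) (inj₁ (s , _)) = contradiction (src<tgt e) (<-irrefl (cong toℕ s))

  joins-cases : ∀ e {u v x y} → Joins e u v → Joins e x y → (u ≡ x × v ≡ y) ⊎ (u ≡ y × v ≡ x)
  joins-cases e (inj₁ (refl , refl)) (inj₁ p)       = inj₁ p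
  joins-cases e (inj₁ (refl , refl)) (inj₂ p)       = inj₂ p
  joins-cases e (inj₂ (refl , refl)) (inj₁ (s , t)) = inj₂ (t , s)
  joins-cases e (inj₂ (refl , refl)) (inj₂ (s , t)) = inj₁ (t , s)

  joins⇒adj : ∀ e {u v} → Joins e u v → T (adj u v)
  joins⇒adj e (inj₁ (refl , refl)) = adjacent e
  joins⇒adj e (inj₂ (refl , refl)) = subst T (adj-sym (src e) (tgt e)) (adjacent e)

  edgeBetween : ∀ u v → T (adj u v) → ∃[ e ] Joins e u v
  edgeBetween u v u~v with Fin.<-cmp u v
  ... | tri< u<v _ _ = record { src = u ; tgt = v ; src<tgt = u<v ; adjacent = u~v } , inj₁ (refl , refl)
  ... | tri≈ _ refl _ = ⊥-elim (subst T (loopless u) u~v)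
  ... | tri> _ _ v<u = record { src = v ; tgt = u ; src<tgt = v<u ; adjacent = subst T (adj-sym u v) u~v } ,
                       inj₂ (refl , refl)

  -- Two vertices are joined by at most one edge, so testing `P` on that edge decides the
  -- existential without an enumeration of the edges.
  joined? : ∀ {P : Edge → Set} → (∀ e → Dec (P e)) → ∀ u v → Dec (∃[ e ] (P e × Joins e u v))
  joined? {P} P? u v with Bool.T? (adj u v)
  ... | no  ¬adj = no λ { (e , _ , j) → ¬adj (joins⇒adj e j) }
  ... | yes u~v with e , j ← edgeBetween u v u~v with P? e
  ...   | yes p = yes (e , p , j)
  ...   | no ¬p = no λ { (e′ , p , j′) → ¬p (subst P (joins-unique e′ e j′ j) p) }

  neighbourList : Vertex → List Vertex
  neighbourList v = List.filter (λ u → Bool.T? (adj v u)) (allFin order)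

  degree≤maxDegree : ∀ v → degree v ≤ maxDegree
  degree≤maxDegree v = All.lookup (xs≤max 0 (List.map degree (allFin order)))
    (Mem.∈-map⁺ degree (Mem.∈-allFin v))
    where open import Data.List.Extrema.Nat using (xs≤max)

  neighbourList-length : ∀ v → length (neighbourList v) ≤ maxDegree
  neighbourList-length v = ≤-trans (≤-reflexive (length-filter-tabulate (λ u → Bool.T? (adj v u)) id)) (degree≤maxDegree v)

  star-forests : ∀ {C : Set} → DecidableEquality C → (φ : Edge → C) (tail head : Edge → Vertex) →
    (∀ e → Joins e (tail e) (head e)) →
    (∀ e e′ → φ e ≡ φ e′ → tail e ≡ tail e′ → e ≡ e′) →
    (∀ e e′ → φ e ≡ φ e′ → head e ≢ tail e′) →
    ∀ c → IsStarForest (ColourClass φ c)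
  star-forests {C} _≟ᶜ_ φ tail head joins tail-unique no-path c =
    StarCriterion.isStarForest orient forward backward functional bipartite tail?
    where
    _⟶_ : Vertex → Vertex → Set
    u ⟶ v = ∃[ e ] ((φ e ≡ c × tail e ≡ u) × Joins e u v)

    head≡ : ∀ {u v} ((e , _) : u ⟶ v) → head e ≡ v
    head≡ (e , (_ , refl) , j) = joins-other-end e (joins e) j

    orient : ∀ {u v} → ColourClass φ c u v → u ⟶ v ⊎ v ⟶ u
    orient (e , φe , j) with joins-cases e (joins e) j
    ... | inj₁ (t≡u , _) = inj₁ (e , (φe , t≡u) , j)
    ... | inj₂ (t≡v , _) = inj₂ (e , (φe , t≡v) , joins-sym e j)

    forward : ∀ {u v} → u ⟶ v → ColourClass φ c u v
    forward (e , (φe , _) , j) = e , φe , j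

    backward : ∀ {u v} → u ⟶ v → ColourClass φ c v u
    backward (e , (φe , _) , j) = e , φe , joins-sym e j

    functional : ∀ {u v w} → u ⟶ v → u ⟶ w → v ≡ w
    functional {u} {v} {w} (e , (φe , te) , j) (e′ , (φe′ , te′) , j′)
      with refl ← tail-unique e e′ (trans φe (sym φe′)) (trans te (sym te′)) = joins-other-end e j j′

    bipartite : ∀ {u v w} → u ⟶ v → ¬ (v ⟶ w)
    bipartite u⟶v@(e , (φe , _) , _) (e′ , (φe′ , te′) , _) =
      no-path e e′ (trans φe (sym φe′)) (trans (head≡ u⟶v) (sym te′))

    tail? : ∀ v → Dec (∃[ u ] (v ⟶ u))
    tail? v = Fin.any? λ u → joined? (λ e → (φ e ≟ᶜ c) ×-dec (tail e Fin.≟ v)) v u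

  ∈-singleton : ∀ {p : Subset n} {x y} → ∣ p ∣ ≤ 1 → x ∈ p → y ∈ p → y ≡ x
  ∈-singleton {x = x} {y} p≤1 x∈ y∈ with y Fin.≟ x
  ... | yes y≡x = y≡x
  ... | no  y≢x = contradiction (≤-trans (s≤s (size-positive (Subset.x∈p∧x≢y⇒x∈p-y y∈ y≢x)))
                                 (≤-trans (Subset.x∈p⇒∣p-x∣<∣p∣ x∈) p≤1)) λ { (s≤s ()) }

  -- The edges form a matching, so every colouring at all has star-forests as classes.
  matching-classes : maxDegree ≤ 1 → ∀ {C : Set} → DecidableEquality C → (φ : Edge → C) →
                     ∀ c → IsStarForest (ColourClass φ c)
  matching-classes Δ≤1 _≟ᶜ_ φ = star-forests _≟ᶜ_ φ src tgt (λ e → inj₁ (refl , refl))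
    (λ { e e′ _ eq → edge-≡ eq (one-neighbour (src e′) (adjacent′ e eq) (adjacent e′)) })
    (λ e e′ _ eq → <-asym (src<tgt e) (subst₂ Fin._<_ (sym eq)
       (one-neighbour (src e′) (adjacent e′) (adjacent″ e eq)) (src<tgt e′)))
    where
    ∈-neighbours : ∀ v {u} → T (adj v u) → u ∈ neighbours v
    ∈-neighbours v = ∈-subset⁺ (λ u → Bool.T? (adj v u))
    one-neighbour : ∀ v {u w} → T (adj v u) → T (adj v w) → u ≡ w
    one-neighbour v v~u v~w =
      ∈-singleton (≤-trans (degree≤maxDegree v) Δ≤1) (∈-neighbours v v~w) (∈-neighbours v v~u)
    adjacent′ : ∀ e {v} → src e ≡ v → T (adj v (tgt e))
    adjacent′ e refl = adjacent e
    adjacent″ : ∀ e {v} → tgt e ≡ v → T (adj v (src e))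
    adjacent″ e refl = subst T (adj-sym (src e) (tgt e)) (adjacent e)

  module Orientation {a : ℕ} (φ : Edge → Fin a) (forests : ∀ c → IsForest (ColourClass φ c)) where

    class? : ∀ c u v → Dec (ColourClass φ c u v)
    class? c = joined? (λ e → φ e Fin.≟ c)

    class-sym : ∀ c {u v} → ColourClass φ c u v → ColourClass φ c v u
    class-sym c (e , φe , j) = e , φe , joins-sym e j

    class-irreflexive : ∀ c {v} → ¬ ColourClass φ c v v
    class-irreflexive c (e , _ , j) = joins-irreflexive e j

    module Ranked (c : Fin a) = ForestOrientation (class? c) (class-sym c) (class-irreflexive c) (forests c)

    rank : Fin a → Vertex → ℕ
    rank c = proj₁ (Ranked.forestRank c)

    _⟶_ : Vertex → Vertex → Set
    u ⟶ v = ∃[ e ] (rank (φ e) v < rank (φ e) u × Joins e u v)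

    _⟶?_ : ∀ u v → Dec (u ⟶ v)
    u ⟶? v = joined? (λ e → rank (φ e) v <? rank (φ e) u) u v

    orient : ∀ e → src e ⟶ tgt e ⊎ tgt e ⟶ src e
    orient e with <-cmp (rank (φ e) (src e)) (rank (φ e) (tgt e))
    ... | tri< lt _ _ = inj₂ (e , lt , inj₂ (refl , refl))
    ... | tri≈ _ eq _ = contradiction eq
      (proj₁ (proj₂ (Ranked.forestRank (φ e))) (src e) (tgt e) (e , refl , inj₁ (refl , refl)))
    ... | tri> _ _ gt = inj₁ (e , gt , inj₁ (refl , refl))

    out-unique : ∀ {u v w} ((e , _) : u ⟶ v) ((e′ , _) : u ⟶ w) → φ e ≡ φ e′ → v ≡ w
    out-unique {u} {v} {w} (e , v<u , j) (e′ , w<u , j′) eq =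
      proj₂ (proj₂ (Ranked.forestRank (φ e))) u v w (e , refl , j) (e′ , sym eq , j′) v<u
        (subst (λ c → rank c w < rank c u) (sym eq) w<u)

    outList : Vertex → List Vertex
    outList v = List.filter (v ⟶?_) (allFin order)

    outList-unique : ∀ v → Unique (outList v)
    outList-unique v = Unique.filter⁺ (v ⟶?_) (Unique.allFin⁺ order)

    ∈-outList : ∀ {u v} → u ⟶ v → v ∈ˡ outList u
    ∈-outList {u} {v} u⟶v = Mem.∈-filter⁺ (u ⟶?_) (Mem.∈-allFin v) u⟶v

    ∈-outList⁻ : ∀ {u v} → v ∈ˡ outList u → u ⟶ v
    ∈-outList⁻ {u} v∈ = proj₂ (Mem.∈-filter⁻ (u ⟶?_) {xs = allFin order} v∈)

    outdeg : Vertex → ℕ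
    outdeg v = length (outList v)

    -- Two arrows out of `v` in the same forest would both lead to the parent of `v` there.
    outdeg≤a : ∀ v → outdeg v ≤ a
    outdeg≤a v = Fin.injective⇒≤ {f = λ i → φ (proj₁ (arrow i))} λ {i} {j} eq →
      lookup-injective (outList-unique v) i j (out-unique (arrow i) (arrow j) eq)
      where
      arrow : ∀ i → v ⟶ List.lookup (outList v) i
      arrow i = ∈-outList⁻ (Mem.∈-lookup i)

    ⟶⇒neighbour : ∀ {u v} → u ⟶ v → v ∈ˡ neighbourList u
    ⟶⇒neighbour {u} {v} (e , _ , j) = Mem.∈-filter⁺ (λ v → Bool.T? (adj u v)) (Mem.∈-allFin v) (joins⇒adj e j)

    outdeg≤maxDegree : ∀ v → outdeg v ≤ maxDegree
    outdeg≤maxDegree v = ≤-trans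
      (unique-⊆-length (outList-unique v) (⟶⇒neighbour ∘ ∈-outList⁻)) (neighbourList-length v)

    heads : ∀ v → Vec Vertex (outdeg v)
    heads v = Vec.fromList (outList v)

    toList-heads : ∀ v → Vec.toList (heads v) ≡ outList v
    toList-heads v = Vec.toList∘fromList (outList v)

    heads-unique : ∀ v → Unique (Vec.toList (heads v))
    heads-unique v = subst Unique (sym (toList-heads v)) (outList-unique v)

    heads⇒⟶ : ∀ {u v} → v ∈ˡ Vec.toList (heads u) → u ⟶ v
    heads⇒⟶ {u} v∈ = ∈-outList⁻ (subst (_ ∈ˡ_) (toList-heads u) v∈)

    heads-irreflexive : ∀ v → v ∉ˡ Vec.toList (heads v)
    heads-irreflexive v v∈ with e , _ , j ← heads⇒⟶ v∈ = joins-irreflexive e j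

    neighbourList-complete : ∀ w u → u ∈ˡ Vec.toList (heads w) → w ∈ˡ neighbourList u
    neighbourList-complete w u u∈ with e , _ , j ← heads⇒⟶ u∈ =
      Mem.∈-filter⁺ (λ v → Bool.T? (adj u v)) (Mem.∈-allFin w) (joins⇒adj e (joins-sym e j))

    edgeAt : ∀ v → Fin (outdeg v) → Edge
    edgeAt v i = proj₁ (heads⇒⟶ (∈-toList (heads v) i))

    edgeAt-joins : ∀ v i → Joins (edgeAt v i) v (lookup (heads v) i)
    edgeAt-joins v i = proj₂ (proj₂ (heads⇒⟶ (∈-toList (heads v) i)))

    -- An edge is addressed by its tail and its position among the out-edges there, the rows of the
    -- matching at that vertex.
    Slot : Set
    Slot = Σ Vertex λ v → Fin (outdeg v)

    slotOf : ∀ {u v} → u ⟶ v → ∃[ i ] (lookup (heads u) i ≡ v)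
    slotOf {u} u⟶v = ∈-toList⁻ (heads u) (subst (_ ∈ˡ_) (sym (toList-heads u)) (∈-outList u⟶v))

    slot : Edge → Slot
    slot e with orient e
    ... | inj₁ s⟶t = src e , proj₁ (slotOf s⟶t)
    ... | inj₂ t⟶s = tgt e , proj₁ (slotOf t⟶s)

    tail head : Edge → Vertex
    tail e = proj₁ (slot e)
    head e = lookup (heads (proj₁ (slot e))) (proj₂ (slot e))

    joins-slot : ∀ e → Joins e (tail e) (head e)
    joins-slot e with orient e
    ... | inj₁ s⟶t = inj₁ (refl , sym (proj₂ (slotOf s⟶t)))
    ... | inj₂ t⟶s = inj₂ (sym (proj₂ (slotOf t⟶s)) , refl)

    edgeAt-slot : ∀ e → edgeAt (tail e) (proj₂ (slot e)) ≡ e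
    edgeAt-slot e = joins-unique (edgeAt (tail e) (proj₂ (slot e))) e (edgeAt-joins (tail e) (proj₂ (slot e))) (joins-slot e)

    slot-injective : ∀ e e′ → slot e ≡ slot e′ → e ≡ e′
    slot-injective e e′ eq = trans (sym (edgeAt-slot e))
      (trans (cong (λ (v , i) → edgeAt v i) eq) (edgeAt-slot e′))

-- Choice of the parameters

n≤2^⌈log₂n⌉ : ∀ n → n ≤ 2 ^ ⌈log₂ n ⌉
n≤2^⌈log₂n⌉ n = <-rec (λ n → n ≤ 2 ^ ⌈log₂ n ⌉) step n
  where
  open import Data.Nat.Induction using (<-rec)
  open ≤-Reasoning
  step : ∀ n → (∀ {m} → m < n → m ≤ 2 ^ ⌈log₂ m ⌉) → n ≤ 2 ^ ⌈log₂ n ⌉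
  step zero          rec = z≤n
  step (suc zero)    rec = ≤-refl
  step n@(suc (suc k)) rec = begin
    n                                 ≡⟨ sym (⌊n/2⌋+⌈n/2⌉≡n n) ⟩
    ⌊ n /2⌋ + ⌈ n /2⌉                 ≤⟨ +-monoˡ-≤ ⌈ n /2⌉ (⌊n/2⌋≤⌈n/2⌉ n) ⟩
    ⌈ n /2⌉ + ⌈ n /2⌉                 ≡⟨ cong (⌈ n /2⌉ +_) (sym (+-identityʳ _)) ⟩
    2 * ⌈ n /2⌉                       ≤⟨ *-monoʳ-≤ 2 (rec (⌈n/2⌉<n k)) ⟩
    2 * 2 ^ ⌈log₂ ⌈ n /2⌉ ⌉           ≡⟨ cong (2 ^_) (trans (cong suc (⌈log₂⌈n/2⌉⌉≡⌈log₂n⌉∸1 n)) (m+[n∸m]≡n 1≤log)) ⟩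
    2 ^ ⌈log₂ n ⌉                     ∎
    where
    1≤log : 1 ≤ ⌈log₂ n ⌉
    1≤log = ⌈log₂⌉-mono-≤ {2} {n} (s≤s (s≤s z≤n))

n<2^n : ∀ n → n < 2 ^ n
n<2^n zero    = z<s
n<2^n (suc n) = begin-strict
  suc n            <⟨ s≤s (n<2^n n) ⟩
  suc (2 ^ n)      ≤⟨ +-monoˡ-≤ (2 ^ n) (m^n>0 2 n) ⟩
  2 ^ n + 2 ^ n    ≡⟨ cong (2 ^ n +_) (sym (+-identityʳ _)) ⟩
  2 ^ suc n        ∎
  where open ≤-Reasoning

power-prefix : ∀ {x y k t} .{{_ : NonZero x}} → x ≤ y → k ≤ t → ∀ {p} → y ^ t ≤ p * x ^ t → y ^ k ≤ p * x ^ k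
power-prefix {x} {y} {k} x≤y k≤t {p} y≤
  with e , refl ← m≤n⇒∃[o]m+o≡n k≤t = *-cancelʳ-≤ _ _ (x ^ e) {{m^n≢0 x e}} (begin
    y ^ k * x ^ e          ≤⟨ *-monoʳ-≤ (y ^ k) (^-monoˡ-≤ e x≤y) ⟩
    y ^ k * y ^ e          ≡⟨ sym (^-distribˡ-+-* y k e) ⟩
    y ^ (k + e)            ≤⟨ y≤ ⟩
    p * x ^ (k + e)        ≡⟨ cong (p *_) (^-distribˡ-+-* x k e) ⟩
    p * (x ^ k * x ^ e)    ≡⟨ sym (*-assoc p _ _) ⟩
    p * x ^ k * x ^ e      ∎)
  where open ≤-Reasoning

-- Out-degrees are at most a.  A colour lies in a given random set with probability
-- 1/B, and A = 4MB colours of each palette of size A + s survive; M is just large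
-- enough for 2^M to exceed A³ 2^R although A itself depends on M.
module Parameters
  (a l R M₀ M q b A′ : ℕ) .{{_ : NonZero M₀}}
  (M₀≡ : M₀ ≡ 3 * l + R + 21) (M≡ : M ≡ 4 * M₀) (a≤2^l : a ≤ 2 ^ l)
  (q-upper : a ≤ 8 * M + q * (8 * M)) (q-lower : q * (8 * M) ≤ a)
  (B≡ : suc b ≡ 2 * (2 + q)) (A≡ : suc A′ ≡ 4 * M * suc b)
  where

  open ≤-Reasoning

  private
    h B A s t : ℕ
    -- Half of `B`, so that (1 + 1/B)^h ≤ 2 by `half-power`; that it is at least 2 is used in
    -- `k≤ht`.
    h = 2 + q
    B = suc b
    A = suc A′
    -- `t` bounds the logarithm of the mean of 2^|P ∩ S|: a palette has A + s ≤ 8Mh + 9Mh colours,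
    -- and every `h` of them at most double the mean. The extra `M` in `s` pays for A² ≤ 2^M.
    s = 18 * M
    t = 17 * M

    A≡8Mh : A ≡ h * (8 * M)
    A≡8Mh = trans A≡ (trans (cong (4 * M *_) B≡) (rearrange M h))
      where
      rearrange : ∀ M h → 4 * M * (2 * h) ≡ h * (8 * M)
      rearrange = solve-∀

    A≡q : A ≡ 16 * M + q * (8 * M)
    A≡q = trans A≡8Mh (expand M q)
      where
      expand : ∀ M q → (2 + q) * (8 * M) ≡ 16 * M + q * (8 * M)
      expand = solve-∀

  a≤A : a ≤ A
  a≤A = begin
    a                                ≤⟨ q-upper ⟩
    8 * M + q * (8 * M)              ≤⟨ +-monoˡ-≤ (q * (8 * M)) (*-monoˡ-≤ M (m≤m+n 8 8)) ⟩
    16 * M + q * (8 * M)             ≡⟨ sym A≡q ⟩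
    A                                ∎

  A≤ : A ≤ a + 16 * M
  A≤ = begin
    A                                ≡⟨ A≡q ⟩
    16 * M + q * (8 * M)             ≤⟨ +-monoʳ-≤ (16 * M) q-lower ⟩
    16 * M + a                       ≡⟨ +-comm (16 * M) a ⟩
    a + 16 * M                       ∎

  palette≤ : A + s ≤ a + 136 * M₀
  palette≤ = begin
    A + 18 * M                       ≤⟨ +-monoˡ-≤ (18 * M) A≤ ⟩
    a + 16 * M + 18 * M              ≡⟨ trans (cong (λ x → a + 16 * x + 18 * x) M≡) (collect a M₀) ⟩
    a + 136 * M₀                     ∎
    where
    collect : ∀ a m → a + 16 * (4 * m) + 18 * (4 * m) ≡ a + 136 * m
    collect = solve-∀

  -- As A ≤ 2^(l+7) M₀ ≤ 2^(l+7+M₀), the left side has logarithm at most 3l + 21 + R + 3M₀ = 4M₀.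
  -- This is the origin of 21 = 3 · 7 in `M₀` and of `M` being 4 `M₀`.
  large : A ^ 3 * 2 ^ R ≤ 2 ^ M
  large = begin
    A ^ 3 * 2 ^ R                                          ≤⟨ *-monoˡ-≤ (2 ^ R) (^-monoˡ-≤ 3 A-crude) ⟩
    (2 ^ l * (2 ^ 7 * M₀)) ^ 3 * 2 ^ R                     ≤⟨ *-monoˡ-≤ (2 ^ R) (^-monoˡ-≤ 3 (*-monoʳ-≤ (2 ^ l) (*-monoʳ-≤ (2 ^ 7) (<⇒≤ (n<2^n M₀))))) ⟩
    (2 ^ l * (2 ^ 7 * 2 ^ M₀)) ^ 3 * 2 ^ R                 ≡⟨ cong (λ x → x ^ 3 * 2 ^ R)
                                                                (trans (cong (2 ^ l *_) (sym (^-distribˡ-+-* 2 7 M₀)))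
                                                                       (sym (^-distribˡ-+-* 2 l (7 + M₀)))) ⟩
    (2 ^ (l + (7 + M₀))) ^ 3 * 2 ^ R                       ≡⟨ cong (_* 2 ^ R) (^-*-assoc 2 (l + (7 + M₀)) 3) ⟩
    2 ^ ((l + (7 + M₀)) * 3) * 2 ^ R                       ≡⟨ sym (^-distribˡ-+-* 2 ((l + (7 + M₀)) * 3) R) ⟩
    2 ^ ((l + (7 + M₀)) * 3 + R)                           ≡⟨ cong (2 ^_) exponent ⟩
    2 ^ M                                                  ∎
    where
    exponent : (l + (7 + M₀)) * 3 + R ≡ M
    exponent = trans (collect l R M₀) (trans (cong (λ x → x + 3 * M₀) (sym M₀≡)) (sym M≡))
      where
      collect : ∀ l R m → (l + (7 + m)) * 3 + R ≡ 3 * l + R + 21 + 3 * m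
      collect = solve-∀
    A-crude : A ≤ 2 ^ l * (2 ^ 7 * M₀)
    A-crude = begin
      A                                                    ≤⟨ A≤ ⟩
      a + 16 * M                                           ≡⟨ cong (a +_) (trans (cong (16 *_) M≡) (sixty-four M₀)) ⟩
      a + 64 * M₀                                          ≤⟨ +-mono-≤ a≤2^l ≤-refl ⟩
      2 ^ l + 64 * M₀                                      ≤⟨ +-mono-≤ (m≤m*n (2 ^ l) (64 * M₀) {{m*n≢0 64 M₀}}) (m≤n*m (64 * M₀) (2 ^ l) {{m^n≢0 2 l}}) ⟩
      2 ^ l * (64 * M₀) + 2 ^ l * (64 * M₀)                ≡⟨ twice (2 ^ l) M₀ ⟩
      2 ^ l * (2 ^ 7 * M₀)                                 ∎
      where
      sixty-four : ∀ m → 16 * (4 * m) ≡ 64 * m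
      sixty-four = solve-∀
      twice : ∀ x m → x * (64 * m) + x * (64 * m) ≡ x * (128 * m)
      twice = solve-∀

  k≤ht : A + s ≤ h * t
  k≤ht = begin
    A + 18 * M                       ≡⟨ cong (_+ 18 * M) A≡8Mh ⟩
    h * (8 * M) + 18 * M             ≡⟨ cong (h * (8 * M) +_) (two-nines M) ⟩
    h * (8 * M) + 2 * (9 * M)        ≤⟨ +-monoʳ-≤ (h * (8 * M)) (*-monoˡ-≤ (9 * M) {2} {h} (m≤m+n 2 q)) ⟩
    h * (8 * M) + h * (9 * M)        ≡⟨ seventeen h M ⟩
    h * (17 * M)                     ∎
    where
    two-nines : ∀ M → 18 * M ≡ 2 * (9 * M)
    two-nines = solve-∀
    seventeen : ∀ h M → h * (8 * M) + h * (9 * M) ≡ h * (17 * M)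
    seventeen = solve-∀

  growth : suc B ^ (A + s) ≤ 2 ^ t * B ^ (A + s)
  growth = power-prefix (n≤1+n B) k≤ht {2 ^ t} (begin
    suc B ^ (h * t)        ≡⟨ sym (^-*-assoc (suc B) h t) ⟩
    (suc B ^ h) ^ t        ≤⟨ ^-monoˡ-≤ t (half-power B h (≤-trans (≤-reflexive (sym B≡)) (n≤1+n B))) ⟩
    (2 * B ^ h) ^ t        ≡⟨ ^-distribʳ-* 2 (B ^ h) t ⟩
    2 ^ t * (B ^ h) ^ t    ≡⟨ cong (2 ^ t *_) (^-*-assoc B h t) ⟩
    2 ^ t * B ^ (h * t)    ∎)

  tail : 2 ^ t * (2 * A * A) ≤ 2 ^ suc s
  tail = begin
    2 ^ t * (2 * A * A)        ≡⟨ regroup (2 ^ t) A ⟩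
    2 * (2 ^ t * (A * A))      ≤⟨ *-monoʳ-≤ 2 (*-monoʳ-≤ (2 ^ t) A²≤) ⟩
    2 * (2 ^ t * 2 ^ M)        ≡⟨ cong (2 *_) (sym (^-distribˡ-+-* 2 t M)) ⟩
    2 ^ suc (t + M)            ≡⟨ cong (λ x → 2 ^ suc x) (eighteen M) ⟩
    2 ^ suc s                  ∎
    where
    regroup : ∀ x A → x * (2 * A * A) ≡ 2 * (x * (A * A))
    regroup = solve-∀
    eighteen : ∀ M → 17 * M + M ≡ 18 * M
    eighteen = solve-∀
    A²≤ : A * A ≤ 2 ^ M
    A²≤ = begin
      A * A            ≡⟨ cong (A *_) (sym (*-identityʳ A)) ⟩
      A ^ 2            ≤⟨ ^-monoʳ-≤ A (n≤1+n 2) ⟩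
      A ^ 3            ≤⟨ m≤m*n (A ^ 3) (2 ^ R) {{m^n≢0 2 R}} ⟩
      A ^ 3 * 2 ^ R    ≤⟨ large ⟩
      2 ^ M            ∎

sparse-events : ∀ Δ L E → 1 ≤ Δ → Δ ≤ 2 ^ L → 4 + 2 * L ≤ E → 8 * (Δ * suc Δ) ≤ 2 ^ E
sparse-events Δ L E 1≤Δ Δ≤ L≤E = begin
  8 * (Δ * suc Δ)              ≤⟨ *-monoʳ-≤ 8 (*-monoʳ-≤ Δ (+-monoˡ-≤ Δ 1≤Δ)) ⟩
  8 * (Δ * (Δ + Δ))            ≡⟨ regroup Δ ⟩
  16 * (Δ * Δ)                 ≤⟨ *-monoʳ-≤ 16 (*-mono-≤ Δ≤ Δ≤) ⟩
  2 ^ 4 * (2 ^ L * 2 ^ L)      ≡⟨ cong (2 ^ 4 *_) (sym (^-distribˡ-+-* 2 L L)) ⟩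
  2 ^ 4 * 2 ^ (L + L)          ≡⟨ sym (^-distribˡ-+-* 2 4 (L + L)) ⟩
  2 ^ (4 + (L + L))            ≡⟨ cong (λ x → 2 ^ (4 + (L + x))) (sym (+-identityʳ L)) ⟩
  2 ^ (4 + 2 * L)              ≤⟨ ^-monoʳ-≤ 2 L≤E ⟩
  2 ^ E                        ∎
  where
  open ≤-Reasoning
  regroup : ∀ Δ → 8 * (Δ * (Δ + Δ)) ≡ 16 * (Δ * Δ)
  regroup = solve-∀

-- From orientations to decompositions

record Params (a R : ℕ) : Set where
  private
    l : ℕ
    l = ⌈log₂ a ⌉

  field
    A′ b M s t : ℕ
    a≤A        : a ≤ suc A′
    palette≤   : suc A′ + s ≤ a + 136 * (3 * l + R + 21)
    density    : suc A′ ≡ 4 * M * suc b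
    large      : suc A′ ^ 3 * 2 ^ R ≤ 2 ^ M
    growth     : suc (suc b) ^ (suc A′ + s) ≤ 2 ^ t * suc b ^ (suc A′ + s)
    balance    : 2 ^ t * (2 * suc A′ * suc A′) ≤ 2 ^ suc s

abstract
  params : ∀ a R → Params a R
  params a R = build (3 * l + R + 21) {{>-nonZero (m≤n+m 1 (3 * l + R + 20) ⟨ ≤-trans ⟩ ≤-reflexive (+-assoc (3 * l + R) 20 1))}} refl
    where
    open import Function using (_⟨_⟩_)
    l : ℕ
    l = ⌈log₂ a ⌉
    build : ∀ M₀ .{{_ : NonZero M₀}} → M₀ ≡ 3 * l + R + 21 → Params a R
    build M₀ M₀≡ = record
      { A′ = A′ ; b = b ; M = M ; s = 18 * M ; t = 17 * M
      ; a≤A = P.a≤A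
      ; palette≤ = subst (λ m → suc A′ + 18 * M ≤ a + 136 * m) M₀≡ P.palette≤
      ; density = A≡ ; large = P.large ; growth = P.growth ; balance = P.tail }
      where
      M q b A′ : ℕ
      M = 4 * M₀
      instance
        M≢0 : NonZero M
        M≢0 = m*n≢0 4 M₀
        8M≢0 : NonZero (8 * M)
        8M≢0 = m*n≢0 8 M
      q = a / (8 * M)
      b = suc q + (2 + q + 0)
      A′ = pred (4 * M * suc b)
      A≡ : suc A′ ≡ 4 * M * suc b
      A≡ = suc-pred (4 * M * suc b) {{m*n≢0 (4 * M) (suc b) {{m*n≢0 4 M}}}}
      module P = Parameters a l R M₀ M q b A′ M₀≡ refl (n≤2^⌈log₂n⌉ a)
        (≤-trans (≤-reflexive (m≡m%n+[m/n]*n a (8 * M))) (+-monoˡ-≤ (q * (8 * M)) (<⇒≤ (m%n<n a (8 * M)))))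
        (m/n*n≤m a (8 * M)) refl A≡

-- Along a functional relation that descends in a well-founded order, vertices
-- can be 2-coloured by the parity of the length of the maximal descent.
module Alternating {V : Set} {_≺_ _↝_ : V → V → Set}
  (≺-wf : WellFounded _≺_) (descending : ∀ {v u} → v ↝ u → u ≺ v)
  (functional : ∀ {v u w} → v ↝ u → v ↝ w → u ≡ w) (next? : ∀ v → Dec (∃[ u ] (v ↝ u)))
  where

  colourAcc : ∀ v → Acc _≺_ v → Bool
  colourAcc v (acc rs) with next? v
  ... | yes (u , v↝u) = not (colourAcc u (rs (descending v↝u)))
  ... | no  _         = false

  colourAcc-irrelevant : ∀ v (p q : Acc _≺_ v) → colourAcc v p ≡ colourAcc v q
  colourAcc-irrelevant v (acc rs) (acc rs′) with next? v
  ... | yes (u , v↝u) = cong not (colourAcc-irrelevant u (rs (descending v↝u)) (rs′ (descending v↝u)))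
  ... | no  _         = refl

  colour : V → Bool
  colour v = colourAcc v (≺-wf v)

  colour-alternates : ∀ {v u} → v ↝ u → colour v ≢ colour u
  colour-alternates {v} {u} v↝u eq = Bool.not-¬ refl (trans (sym eq) (step (≺-wf v)))
    where
    step : (p : Acc _≺_ v) → colourAcc v p ≡ not (colour u)
    step (acc rs) with next? v
    ... | no  none       = contradiction (u , v↝u) none
    ... | yes (w , v↝w) with refl ← functional v↝u v↝w = cong not (colourAcc-irrelevant u (rs (descending v↝w)) (≺-wf u))

module Decomposition (G : Graph) {a : ℕ} (φ : Graph.Edge G → Fin a)
  (forests : ∀ c → IsForest (Graph.ColourClass G φ c)) (Δ≥2 : 2 ≤ Graph.maxDegree G) where

  open Graph G
  open GraphFacts G
  open Orientation φ forests

  private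
    Δ a⁻ L : ℕ
    Δ = maxDegree
    -- Out-degrees are bounded both by the number of forests and by `Δ`. With the minimum, the
    -- logarithm in the palette size is at most that of `a` for star-forests and at most that of `Δ`
    -- for lists.
    a⁻ = a ⊓ Δ
    L = ⌈log₂ Δ ⌉

    1≤L : 1 ≤ L
    1≤L = ⌈log₂⌉-mono-≤ Δ≥2

  module _ (R d : ℕ) where

    open Params (params a⁻ R) public

    paletteSize : ℕ
    paletteSize = suc A′ + s

    record NearDecomposition {N : ℕ} (P : Edge → Subset N) : Set where
      field
        centres  : Vec (Subset N) order
        ψ        : Edge → Fin N ⊎ Fin d
        ψ-centre : ∀ e {c} → ψ e ≡ inj₁ c → c ∈ P e × c ∉ lookup centres (tail e) × c ∈ lookup centres (head e)
        ψ-unique : ∀ e e′ → ψ e ≡ ψ e′ → tail e ≡ tail e′ → e ≡ e′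

    module _ {N : ℕ} (P : Edge → Subset N) where

      palette : ∀ v → Vec (Subset N) (outdeg v)
      palette v = Vec.tabulate (P ∘ edgeAt v)

      lookup-palette : ∀ v i → lookup (palette v) i ≡ P (edgeAt v i)
      lookup-palette v = Vec.lookup∘tabulate (P ∘ edgeAt v)

      Assigned : Vec (Subset N) order → Vertex → Set
      Assigned C v = Σ (Fin (outdeg v) → Fin (N + d)) λ μ →
          (∀ i {c} → Fin.splitAt N (μ i) ≡ inj₁ c →
             c ∈ lookup (palette v) i × c ∉ lookup C v × c ∈ lookup C (lookup (heads v) i))
        × (∀ i j → μ i ≡ μ j → i ≡ j)

      collect : ∃[ C ] (∀ v → Assigned C v) → NearDecomposition P
      collect (C , assigned) = record
        { centres = C ; ψ = ψ ; ψ-centre = ψ-centre ; ψ-unique = ψ-unique }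
        where
        μ : ∀ v → Fin (outdeg v) → Fin (N + d)
        μ v = proj₁ (assigned v)

        ψ : Edge → Fin N ⊎ Fin d
        ψ e = Fin.splitAt N (μ (tail e) (proj₂ (slot e)))

        ψ-centre : ∀ e {c} → ψ e ≡ inj₁ c → c ∈ P e × c ∉ lookup C (tail e) × c ∈ lookup C (head e)
        ψ-centre e {c} eq = subst (c ∈_) row (proj₁ centred) , proj₂ centred
          where
          centred = proj₁ (proj₂ (assigned (tail e))) (proj₂ (slot e)) eq
          row : lookup (palette (tail e)) (proj₂ (slot e)) ≡ P e
          row = trans (lookup-palette (tail e) (proj₂ (slot e))) (cong P (edgeAt-slot e))

        same-slot : ∀ ((v , i) (v′ , i′) : Slot) → v ≡ v′ →
                    Fin.splitAt N (μ v i) ≡ Fin.splitAt N (μ v′ i′) → (v , i) ≡ (v′ , i′)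
        same-slot (v , i) (.v , i′) refl eq = cong (v ,_) (proj₂ (proj₂ (assigned v)) i i′
          (trans (sym (Fin.join-splitAt N d (μ v i))) (trans (cong (Fin.join N d) eq) (Fin.join-splitAt N d (μ v i′)))))

        ψ-unique : ∀ e e′ → ψ e ≡ ψ e′ → tail e ≡ tail e′ → e ≡ e′
        ψ-unique e e′ eq tails = slot-injective e e′ (same-slot (slot e) (slot e′) tails eq)

      abstract
        nearDecomposition : 4 + 2 * L ≤ R * suc d → (∀ e → ∣ P e ∣ ≡ paletteSize) → NearDecomposition P
        nearDecomposition enough P-size = collect (RandomColouring.assignments
          outdeg heads heads-unique heads-irreflexive
          neighbourList neighbourList-complete Δ {{>-nonZero (≤-trans (s≤s z≤n) Δ≥2)}}
          neighbourList-length outdeg≤maxDegree A′ b M R d s t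
          (λ v → ≤-trans (⊓-glb (outdeg≤a v) (outdeg≤maxDegree v)) a≤A)
          palette (λ v i → trans (cong ∣_∣ (lookup-palette v i)) (P-size (edgeAt v i)))
          density large growth balance
          (sparse-events Δ L (R * suc d) (≤-trans (s≤s z≤n) Δ≥2) (n≤2^⌈log₂n⌉ Δ) enough))

-- Colouring the leftover edges

bit : Bool → Fin 2
bit false = zero
bit true  = suc zero

bit-injective : ∀ {x y} → bit x ≡ bit y → x ≡ y
bit-injective {false} {false} _ = refl
bit-injective {true}  {true}  _ = refl

module Leftover (G : Graph) (tail head : Graph.Edge G → Graph.Vertex G)
  (joins : ∀ e → Graph.Joins G e (tail e) (head e))
  {N d : ℕ} (ψ : Graph.Edge G → Fin N ⊎ Fin d)
  (ψ-unique : ∀ e e′ → ψ e ≡ ψ e′ → tail e ≡ tail e′ → e ≡ e′)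
  (ψ-no-path : ∀ e e′ {c} → ψ e ≡ inj₁ c → ψ e′ ≡ inj₁ c → head e ≢ tail e′)
  where

  open Graph G
  open GraphFacts G

  _≟ᶜ_ : DecidableEquality (Fin N ⊎ Fin d)
  _≟ᶜ_ = Sum.≡-dec Fin._≟_ Fin._≟_

  -- The edges with one leftover label have at most one arrow out of each vertex but, coming from
  -- different forests, may form directed cycles, even odd ones. Separating arrows that descend in
  -- the vertex order from those that ascend makes both parts well-founded.
  _≺[_]_ : Vertex → Bool → Vertex → Set
  u ≺[ true ]  v = u Fin.< v
  u ≺[ false ] v = v Fin.< u

  ≺-dec : ∀ δ u v → Dec (u ≺[ δ ] v)
  ≺-dec true  u v = u Fin.<? v
  ≺-dec false u v = v Fin.<? u

  ≺-wf : ∀ δ → WellFounded (λ u v → u ≺[ δ ] v)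
  ≺-wf true  = Fin.<-wellFounded
  ≺-wf false = Fin.>-wellFounded

  Step : Fin d → Bool → Vertex → Vertex → Set
  Step j δ v u = (∃[ e ] ((ψ e ≡ inj₂ j × tail e ≡ v) × Joins e v u)) × u ≺[ δ ] v

  step-functional : ∀ {j δ v u w} → Step j δ v u → Step j δ v w → u ≡ w
  step-functional ((e , (ψe , te) , J₁) , _) ((e′ , (ψe′ , te′) , J₂) , _)
    with refl ← ψ-unique e e′ (trans ψe (sym ψe′)) (trans te (sym te′)) = joins-other-end e J₁ J₂

  step? : ∀ j δ v → Dec (∃[ u ] Step j δ v u)
  step? j δ v = Fin.any? λ u →
    joined? (λ e → (ψ e ≟ᶜ inj₂ j) ×-dec (tail e Fin.≟ v)) v u ×-dec ≺-dec δ u v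

  module Alternate (j : Fin d) (δ : Bool) =
    Alternating {_↝_ = Step j δ} (≺-wf δ) proj₂ step-functional (step? j δ)

  direction : Edge → Bool
  direction e = toℕ (head e) <ᵇ toℕ (tail e)

  ≺-total : ∀ u v → u ≢ v → u ≺[ toℕ u <ᵇ toℕ v ] v
  ≺-total u v u≢v with toℕ u <ᵇ toℕ v in eq
  ... | true  = <ᵇ⇒< (toℕ u) (toℕ v) (subst T (sym eq) _)
  ... | false = ≤∧≢⇒< (≮⇒≥ λ u<v → subst T eq (<⇒<ᵇ u<v)) λ eq → u≢v (sym (Fin.toℕ-injective eq))

  step : ∀ {j} e → ψ e ≡ inj₂ j → Step j (direction e) (tail e) (head e)
  step e ψe = (e , (ψe , refl) , joins e) ,
    ≺-total (head e) (tail e) λ h≡t → joins-irreflexive e (subst (Joins e (tail e)) h≡t (joins e))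

  side : Edge → Fin d → Bool
  side e j = Alternate.colour j (direction e) (head e)

  -- If the head of `e` were the tail of `e′`, the two sides would be the colours of the two ends of
  -- `e′`, which differ.
  side-alternates : ∀ {j} e e′ → ψ e ≡ inj₂ j → ψ e′ ≡ inj₂ j → direction e ≡ direction e′ →
                    side e j ≡ side e′ j → head e ≢ tail e′
  side-alternates {j} e e′ ψe ψe′ δ≡ side≡ he≡te′ =
    Alternate.colour-alternates j (direction e′) (step e′ ψe′)
      (trans (trans (cong (Alternate.colour j (direction e′)) (sym he≡te′))
                    (cong (λ δ → Alternate.colour j δ (head e)) (sym δ≡))) side≡)

  -- A leftover label j is refined into four colours: by whether the edge
  -- descends or ascends in the vertex order, and by a 2-colouring of its head.
  paint : Edge → Fin N ⊎ Fin d → Fin N ⊎ Fin (d * 4)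
  paint e (inj₁ c) = inj₁ c
  paint e (inj₂ j) = inj₂ (Fin.combine j (Fin.combine (bit (direction e)) (bit (side e j))))

  colour : Edge → Fin (N + d * 4)
  colour e = Fin.join N (d * 4) (paint e (ψ e))

  SameLeftover : Edge → Edge → Fin N ⊎ Fin d → Set
  SameLeftover e e′ (inj₁ c) = Fin 1
  SameLeftover e e′ (inj₂ j) = direction e ≡ direction e′ × side e j ≡ side e′ j

  paint-injective : ∀ e e′ x y → paint e x ≡ paint e′ y → x ≡ y × SameLeftover e e′ x
  paint-injective e e′ (inj₁ c) (inj₁ .c) refl = refl , zero
  paint-injective e e′ (inj₂ j) (inj₂ j′) eq
    with refl , eq₁ ← Fin.combine-injective j _ j′ _ (Sum.inj₂-injective eq)
    with eq₂ , eq₃ ← Fin.combine-injective (bit (direction e)) _ (bit (direction e′)) _ eq₁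
    = refl , bit-injective eq₂ , bit-injective eq₃

  colour-injective : ∀ e e′ → colour e ≡ colour e′ → ψ e ≡ ψ e′ × SameLeftover e e′ (ψ e)
  colour-injective e e′ eq = paint-injective e e′ (ψ e) (ψ e′)
    (trans (sym (Fin.splitAt-join N (d * 4) _)) (trans (cong (Fin.splitAt N) eq) (Fin.splitAt-join N (d * 4) _)))

  no-path : ∀ e e′ → colour e ≡ colour e′ → head e ≢ tail e′
  no-path e e′ eq = cases (ψ e) refl (colour-injective e e′ eq)
    where
    cases : ∀ x → ψ e ≡ x → ψ e ≡ ψ e′ × SameLeftover e e′ (ψ e) → head e ≢ tail e′
    cases (inj₁ c) ψe (ψ≡ , _) = ψ-no-path e e′ ψe (trans (sym ψ≡) ψe)
    cases (inj₂ j) ψe (ψ≡ , same) with δ≡ , side≡ ← subst (SameLeftover e e′) ψe same =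
      side-alternates e e′ ψe (trans (sym ψ≡) ψe) δ≡ side≡

  leftover-star-forests : ∀ c → IsStarForest (ColourClass colour c)
  leftover-star-forests = star-forests Fin._≟_ colour tail head joins
    (λ e e′ eq → ψ-unique e e′ (proj₁ (colour-injective e e′ eq))) no-path

abstract
  constant : ℕ
  -- This is 136 · 30: for lists 3L + (4 + 2L) + 21 ≤ 30L once L ≥ 1. For star-forests the
  -- coefficients 136 · 3 and 136 · 24 + 12 stay below it.
  constant = 4080

  constant≡ : constant ≡ 4080
  constant≡ = refl

-- The two decompositions and their sizes

module Colourings (G : Graph) {a : ℕ} (φ : Graph.Edge G → Fin a)
  (forests : ∀ c → IsForest (Graph.ColourClass G φ c)) (Δ≥2 : 2 ≤ Graph.maxDegree G) where

  open Graph G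
  open GraphFacts G
  open Orientation φ forests
  open Decomposition G φ forests Δ≥2
  open import Data.List.Membership.DecPropositional _≟_ using () renaming (_∈?_ to _∈ˡ?_)

  private
    L r : ℕ
    L = ⌈log₂ maxDegree ⌉
    r = ⌈√ L ⌉

    1≤L : 1 ≤ L
    1≤L = ⌈log₂⌉-mono-≤ Δ≥2

  paletteSize≤ : ∀ R d → paletteSize R d ≤ a + 136 * (3 * ⌈log₂ a ⊓ maxDegree ⌉ + R + 21)
  paletteSize≤ R d = ≤-trans (palette≤ R d) (+-monoˡ-≤ _ (m⊓n≤m a maxDegree))

  module Lists (Q : Edge → List ℕ) where

    edgeColours : ∀ u v → Dec (T (adj u v)) → ℕ
    edgeColours u v (yes u~v) = ∑ (Q (proj₁ (edgeBetween u v u~v))) id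
    edgeColours u v (no _)    = 0

    colourBound : ℕ
    -- The sum of all colours in all palettes is a crude common bound, which places the
    -- natural-number colours in a finite type.
    colourBound = suc (∑ (allFin order) λ u → ∑ (allFin order) λ v → edgeColours u v (Bool.T? (adj u v)))

    Q<colourBound : ∀ e {c} → c ∈ˡ Q e → c < colourBound
    Q<colourBound e {c} c∈ = s≤s (begin
      c                                            ≤⟨ ∑-∈ id c∈ ⟩
      ∑ (Q e) id                                   ≤⟨ at-edge (Bool.T? (adj u v)) ⟩
      edgeColours u v (Bool.T? (adj u v))          ≤⟨ ∑-∈ (λ v → edgeColours u v (Bool.T? (adj u v))) (Mem.∈-allFin v) ⟩
      ∑ (allFin order) (λ v → edgeColours u v (Bool.T? (adj u v)))
        ≤⟨ ∑-∈ (λ u → ∑ (allFin order) λ v → edgeColours u v (Bool.T? (adj u v))) (Mem.∈-allFin u) ⟩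
      _                                            ∎)
      where
      open ≤-Reasoning
      u = Edge.src e
      v = Edge.tgt e
      at-edge : ∀ u~v? → ∑ (Q e) id ≤ edgeColours u v u~v?
      at-edge (no ¬adj)  = contradiction (Edge.adjacent e) ¬adj
      at-edge (yes u~v) = ≤-reflexive (cong (λ e → ∑ (Q e) id)
        (joins-unique e _ (inj₁ (refl , refl)) (proj₂ (edgeBetween u v u~v))))

    paletteSet : Edge → Subset colourBound
    paletteSet e = subset λ c → toℕ c ∈ˡ? Q e

    ∣paletteSet∣ : ∀ e → Unique (Q e) → ∣ paletteSet e ∣ ≡ length (Q e)
    ∣paletteSet∣ e Q! = trans (sym (length-filter-tabulate (λ c → toℕ c ∈ˡ? Q e) id))
      (trans (sym (List.length-map toℕ colours)) (≤-antisym
        (unique-⊆-length (Unique.map⁺ Fin.toℕ-injective (Unique.filter⁺ (λ c → toℕ c ∈ˡ? Q e) (Unique.allFin⁺ colourBound))) sound)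
        (unique-⊆-length Q! complete)))
      where
      colours : List (Fin colourBound)
      colours = List.filter (λ c → toℕ c ∈ˡ? Q e) (allFin colourBound)

      sound : ∀ {c} → c ∈ˡ List.map toℕ colours → c ∈ˡ Q e
      sound c∈ with _ , i∈ , refl ← Mem.∈-map⁻ toℕ c∈ =
        proj₂ (Mem.∈-filter⁻ (λ c → toℕ c ∈ˡ? Q e) {xs = allFin colourBound} i∈)

      complete : ∀ {c} → c ∈ˡ Q e → c ∈ˡ List.map toℕ colours
      complete {c} c∈ = subst (_∈ˡ List.map toℕ colours) toℕ-i (Mem.∈-map⁺ toℕ
        (Mem.∈-filter⁺ (λ c → toℕ c ∈ˡ? Q e) (Mem.∈-allFin i) (subst (_∈ˡ Q e) (sym toℕ-i) c∈)))
        where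
        i = Fin.fromℕ< (Q<colourBound e c∈)
        toℕ-i : toℕ i ≡ c
        toℕ-i = Fin.toℕ-fromℕ< (Q<colourBound e c∈)

  listSize : ℕ
  listSize = paletteSize (4 + 2 * L) 0

  lists-decompose : LSFDsExist G listSize
  lists-decompose Q Q-ok = (λ e → toℕ (real (ψ e))) , in-palette , star-forests _≟_ _ tail head joins-slot
    (λ e e′ eq → ψ-unique e e′ (real-injective (Fin.toℕ-injective eq)))
    (λ e e′ eq → no-path e e′ (real-injective (Fin.toℕ-injective eq)))
    where
    open Lists Q

    near : NearDecomposition (4 + 2 * L) 0 paletteSet
    near = nearDecomposition (4 + 2 * L) 0 paletteSet (≤-reflexive (sym (*-identityʳ (4 + 2 * L))))
      λ e → trans (∣paletteSet∣ e (proj₁ (Q-ok e))) (proj₂ (Q-ok e))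

    open NearDecomposition near

    real : Fin colourBound ⊎ Fin 0 → Fin colourBound
    real (inj₁ c) = c

    inj₁-real : ∀ x → x ≡ inj₁ (real x)
    inj₁-real (inj₁ c) = refl

    real-injective : ∀ {x y} → real x ≡ real y → x ≡ y
    real-injective {inj₁ _} {inj₁ _} refl = refl

    in-palette : ∀ e → toℕ (real (ψ e)) ∈ˡ Q e
    in-palette e = ∈-subset⁻ (λ c → toℕ c ∈ˡ? Q e) (proj₁ (ψ-centre e (inj₁-real (ψ e))))

    no-path : ∀ e e′ → ψ e ≡ ψ e′ → head e ≢ tail e′
    no-path e e′ eq he≡te′ = proj₁ (proj₂ (ψ-centre e′ (trans (sym eq) (inj₁-real (ψ e)))))
      (subst (λ v → real (ψ e) ∈ lookup centres v) he≡te′ (proj₂ (proj₂ (ψ-centre e (inj₁-real (ψ e))))))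

  listSize≤ : listSize ≤ a + constant * ⌈log₂ maxDegree ⌉
  listSize≤ = begin
    listSize                                   ≤⟨ paletteSize≤ (4 + 2 * L) 0 ⟩
    a + 136 * (3 * ⌈log₂ a ⊓ maxDegree ⌉ + (4 + 2 * L) + 21)
      ≤⟨ +-monoʳ-≤ a (*-monoʳ-≤ 136 (+-monoˡ-≤ 21 (+-monoˡ-≤ (4 + 2 * L)
           (*-monoʳ-≤ 3 (⌈log₂⌉-mono-≤ (m⊓n≤n a maxDegree)))))) ⟩
    a + 136 * (3 * L + (4 + 2 * L) + 21)       ≡⟨ cong (λ x → a + 136 * x) (gather L) ⟩
    a + 136 * (5 * L + 25 * 1)                 ≤⟨ +-monoʳ-≤ a (*-monoʳ-≤ 136 (+-monoʳ-≤ (5 * L) (*-monoʳ-≤ 25 1≤L))) ⟩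
    a + 136 * (5 * L + 25 * L)                 ≡⟨ cong (a +_) (factor L) ⟩
    a + 4080 * L                               ≡⟨ cong (λ k → a + k * L) (sym constant≡) ⟩
    a + constant * L                           ∎
    where
    open ≤-Reasoning
    gather : ∀ L → 3 * L + (4 + 2 * L) + 21 ≡ 5 * L + 25 * 1
    gather = solve-∀
    factor : ∀ L → 136 * (5 * L + 25 * L) ≡ 4080 * L
    factor = solve-∀

  R₀ : ℕ
  -- Used for both R and d: their product condition holds since 3r(3r + 1) ≥ 6r² ≥ 4 + 2L.
  R₀ = 3 * r

  starSize : ℕ
  starSize = paletteSize R₀ R₀ + R₀ * 4

  1≤r : 1 ≤ r
  1≤r = ≰⇒> λ r≤0 → n≮0 (subst (λ x → 0 < x * x) (n≤0⇒n≡0 r≤0) (≤-trans 1≤L (n≤⌈√n⌉² L)))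

  enough-labels : ∀ {L} r → 1 ≤ r → L ≤ r * r → 4 + 2 * L ≤ 3 * r * suc (3 * r)
  enough-labels {L} r 1≤r L≤r² = begin
    4 + 2 * L                       ≤⟨ +-mono-≤ (*-monoʳ-≤ 4 (*-mono-≤ 1≤r 1≤r)) (*-monoʳ-≤ 2 L≤r²) ⟩
    4 * (r * r) + 2 * (r * r)       ≤⟨ m≤m+n _ (3 * (r * r) + 3 * r) ⟩
    4 * (r * r) + 2 * (r * r) + (3 * (r * r) + 3 * r)  ≡⟨ gather r ⟩
    3 * r * suc (3 * r)             ∎
    where
    open ≤-Reasoning
    gather : ∀ r → 4 * (r * r) + 2 * (r * r) + (3 * (r * r) + 3 * r) ≡ 3 * r * suc (3 * r)
    gather = solve-∀

  near⊤ : NearDecomposition R₀ R₀ {paletteSize R₀ R₀} (λ _ → ⊤)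
  near⊤ = nearDecomposition R₀ R₀ (λ _ → ⊤) (enough-labels r 1≤r (n≤⌈√n⌉² L)) λ _ → Subset.∣⊤∣≡n (paletteSize R₀ R₀)

  partition : ∀ {N d} {P : Edge → Subset N} → NearDecomposition R₀ d P → PartitionsIntoStarForests G (N + d * 4)
  partition near = colour , leftover-star-forests
    where
    open NearDecomposition near
    no-real-path : ∀ e e′ {c} → ψ e ≡ inj₁ c → ψ e′ ≡ inj₁ c → head e ≢ tail e′
    no-real-path e e′ {c} ψe ψe′ he≡te′ = proj₁ (proj₂ (ψ-centre e′ ψe′))
      (subst (λ v → c ∈ lookup centres v) he≡te′ (proj₂ (proj₂ (ψ-centre e ψe))))
    open Leftover G tail head joins-slot ψ ψ-unique no-real-path

  starSize≤ : starSize ≤ a + constant * (⌈log₂ a ⌉ + ⌈√ ⌈log₂ maxDegree ⌉ ⌉)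
  starSize≤ = begin
    paletteSize R₀ R₀ + R₀ * 4                         ≤⟨ +-monoˡ-≤ (R₀ * 4) (paletteSize≤ R₀ R₀) ⟩
    a + 136 * (3 * ⌈log₂ a ⊓ maxDegree ⌉ + R₀ + 21) + R₀ * 4
      ≤⟨ +-monoˡ-≤ (R₀ * 4) (+-monoʳ-≤ a (*-monoʳ-≤ 136 (+-mono-≤ (+-monoˡ-≤ R₀ (*-monoʳ-≤ 3
           (⌈log₂⌉-mono-≤ (m⊓n≤m a maxDegree)))) (*-monoʳ-≤ 21 1≤r)))) ⟩
    a + 136 * (3 * l + R₀ + 21 * r) + R₀ * 4           ≡⟨ +-assoc a _ _ ⟩
    a + (136 * (3 * l + R₀ + 21 * r) + R₀ * 4)         ≤⟨ +-monoʳ-≤ a (m≤m+n _ (3672 * l + 804 * r)) ⟩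
    a + (136 * (3 * l + R₀ + 21 * r) + R₀ * 4 + (3672 * l + 804 * r))
                                                       ≡⟨ cong (a +_) (gather l r) ⟩
    a + 4080 * (l + r)                                 ≡⟨ cong (λ k → a + k * (l + r)) (sym constant≡) ⟩
    a + constant * (l + r)                             ∎
    where
    open ≤-Reasoning
    l = ⌈log₂ a ⌉
    gather : ∀ l r → 136 * (3 * l + 3 * r + 21 * r) + 3 * r * 4 + (3672 * l + 804 * r) ≡ 4080 * (l + r)
    gather = solve-∀

  star-partition : PartitionsIntoStarForests G starSize
  star-partition = partition {N = paletteSize R₀ R₀} {d = R₀} near⊤

corollary1p2 : ∃[ C ] (∀ (G : Graph) (a : ℕ) → IsArboricity G a →
    let Δ = Graph.maxDegree G in
    (∀ s → IsStarArboricity G s → s ≤ a + C * (⌈log₂ a ⌉ + ⌈√ ⌈log₂ Δ ⌉ ⌉))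
    × (∀ l → IsListStarArboricity G l → l ≤ a + C * ⌈log₂ Δ ⌉))
corollary1p2 = constant , bounds
  where
  bounds : ∀ (G : Graph) (a : ℕ) → IsArboricity G a →
    (∀ s → IsStarArboricity G s → s ≤ a + constant * (⌈log₂ a ⌉ + ⌈√ ⌈log₂ Graph.maxDegree G ⌉ ⌉))
    × (∀ l → IsListStarArboricity G l → l ≤ a + constant * ⌈log₂ Graph.maxDegree G ⌉)
  bounds G a ((φ , forests) , _) with 2 ≤? Graph.maxDegree G
  ... | yes Δ≥2 =
    (λ s (_ , least) → ≤-trans (least starSize star-partition) starSize≤) ,
    (λ l (_ , least) → ≤-trans (least listSize lists-decompose) listSize≤)
    where open Colourings G φ forests Δ≥2
  -- For Δ ≤ 1 the logarithm of Δ vanishes, so lists leave no slack above `a` and the random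
  -- construction, which needs L ≥ 1, gives way to the fact that the graph is a matching.
  ... | no  Δ≱2 =
    (λ s (_ , least) → ≤-trans (least a (φ , matching-classes Δ≤1 Fin._≟_ φ)) (m≤m+n a _)) ,
    (λ l (_ , least) → ≤-trans (least a lists) (m≤m+n a _))
    where
    open GraphFacts G
    Δ≤1 : Graph.maxDegree G ≤ 1
    Δ≤1 = s≤s⁻¹ (≰⇒> Δ≱2)

    lists : LSFDsExist G a
    lists Q Q-ok = pick , (λ e → Mem.∈-lookup (index e)) , matching-classes Δ≤1 _≟_ pick
      where
      index : ∀ e → Fin (length (Q e))
      -- Palettes have length `a`, so the forest number of an edge is a valid position in its
      -- palette.
      index e = Fin.cast (sym (proj₂ (Q-ok e))) (φ e)
      pick : Graph.Edge G → ℕ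
      pick e = List.lookup (Q e) (index e)
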